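{- For any integers $n\leq k$, the minimum number of adaptive queries needed to solve sparse set query with parameters $k,n$ is $\Theta\left(n\frac{\log(1+k/n)}{\log n}+k/n\right)$ (with absolute implicit constants).
   Context: Sparse set query with parameters $k\geq n$: Codemaker chooses a hidden set $f\subseteq[k]$ with $|f|\leq n$ (the set of counterfeit coins among $k$ coins). Codebreaker adaptively asks queries, each a set $q\subseteq[k]$ with $|q|\leq n$ (each query may depend on the previous answers), and is told $|f\cap q|$. The game is solved once the answers determine $f$ uniquely among all subsets of $[k]$ of size at most $n$. The minimum number of adaptive queries needed is the least $T$ such that Codebreaker has an adaptive strategy determining every possible $f$ within $T$ queries. -}

module Defs where

open import Data.Nat using (ℕ; zero; suc; _+_; _*_; _≤_)
open import Data.Nat.DivMod using (_/_)
open import Data.Nat.Logarithm using (⌊log₂_⌋)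
open import Data.Fin.Subset using (Subset; _∩_; ∣_∣)
open import Data.Product using (Σ; _×_)
open import Data.Sum using (_⊎_)
open import Relation.Binary.PropositionalEquality using (_≡_)

Candidates : ℕ → Set₁
Candidates k = Subset k → Set

Determined : {k : ℕ} → Candidates k → Set
Determined {k} S = (f g : Subset k) → S f → S g → f ≡ g

SolvableIn : (k n : ℕ) → ℕ → Candidates k → Set
SolvableIn k n zero    S = Determined S
SolvableIn k n (suc T) S =
  Determined S ⊎
  Σ (Subset k) (λ q → (∣ q ∣ ≤ n) ×
     ((a : ℕ) → SolvableIn k n T (λ f → S f × (∣ f ∩ q ∣ ≡ a))))

Initial : (k n : ℕ) → Candidates k
Initial k n f = ∣ f ∣ ≤ n

IsMinQueries : (k n T : ℕ) → Set
IsMinQueries k n T =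
  SolvableIn k n T (Initial k n) × ((T' : ℕ) → SolvableIn k n T' (Initial k n) → T ≤ T')

-- Natural-number floor division (value at n = 0 irrelevant; only used for n ≥ 2).
quot : ℕ → ℕ → ℕ
quot k zero    = 0
quot k (suc m) = k / suc m

-- For 2 ≤ n ≤ k the target expression  n·log(1+k/n)/log n + k/n  agrees up to absolute
-- constant factors with  Num k n / Den n  where
--   Num k n = n·⌊log₂(1+⌊k/n⌋)⌋ + ⌊k/n⌋·⌊log₂ n⌋ ,  Den n = ⌊log₂ n⌋ (≥ 1).
Num : ℕ → ℕ → ℕ
Num k n = n * ⌊log₂ (1 + quot k n) ⌋ + quot k n * ⌊log₂ n ⌋

Den : ℕ → ℕ
Den n = ⌊log₂ n ⌋

-- Lower bound.  If every answer is 0, the empty set and the singletons outside the queries stay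
-- possible, so k ≤ T n; and the transcripts of length T separate the (1 + k/n)^n sets that meet
-- each of n blocks of size k/n in at most one element.
--
-- Upper bound.  Let a and b be signed queries from two independent copies of a scheme.  The
-- answers to a + b and a − b + r add up to 2a + r, which reveals r modulo 2 and then a and b
-- (Cantor and Mills), so that 2^H queries determine about H·2^H bits.  A number r of several bits
-- is handled in a row of the scheme whose index begins with trues: its higher bits are a
-- perturbation of a, passed on to the first copy, which leaves room for them.
--
-- If k/n is a small power of n, the numbers of elements in small blocks are queried directly, and
-- the set inside a group of blocks is determined by the parities of its intersections with the
-- members of a suitable family, found by repeatedly halving the weight of the undetected
-- differences.  Otherwise O(n + k/n) queries are allowed, and the elements are located by
-- descending 4-ary trees.  Coarse nodes can take part in few queries only and fine nodes in many,
-- as do the bits that the scheme hosts at its different depths; therefore the nodes are refined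
-- in a pipeline, in which every round serves all levels of the trees at once.

module Submission where

open import Defs
open import Data.Bool using (Bool; true; false; _∧_; _xor_; not; if_then_else_)
import Data.Bool.Properties as Bool
open import Data.Empty using (⊥-elim)
open import Data.Fin as Fin using (Fin; combine; remQuot; fromℕ<)
import Data.Fin.Properties as Fin
open import Data.Fin.Subset using (Subset; _∩_; _∪_; ∣_∣; ⊥; ⊤; ⁅_⁆; _∈_; _∉_)
open import Data.Fin.Subset.Properties
  using (anySubset?; _∈?_; ∉⊥; x∈⁅x⁆; x∈⁅y⁆⇒x≡y; x∈p∩q⁻; p⊆p∪q; q⊆p∪q; p⊆q⇒∣p∣≤∣q∣; ∩-zeroˡ;
         Empty-unique; ∣⊥∣≡0; ∣⊤∣≡n; ∣⁅x⁆∣≡1; ∣p∣≤∣x∷p∣; ∣p∩q∣≤∣q∣)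
open import Data.Integer as ℤ using (ℤ; 0ℤ; 1ℤ; -1ℤ; -[1+_]) renaming (+_ to +ᶻ_)
import Data.Integer.Properties as ℤ
import Data.Integer.Tactic.RingSolver as ℤ-Solver
open import Data.List using (List; []; _∷_; length; _++_; map; applyUpTo; take; drop; replicate)
open import Data.List.Properties
  using (length-map; length-++; length-applyUpTo; length-take; length-drop; length-replicate;
         take++drop≡id; ++-cancelˡ; ∷-injectiveˡ; ∷-injectiveʳ; ≡-dec)
open import Data.List.Relation.Unary.All as All using (All; []; _∷_)
import Data.List.Relation.Unary.All.Properties as All
open import Data.Nat
open import Data.Nat.DivMod
open import Data.Nat.Induction using (<-rec)
open import Data.Nat.Logarithm
open import Data.Nat.Properties
import Data.Nat.Tactic.RingSolver as ℕ-Solver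
open import Data.Product using (Σ; ∃; ∃₂; _×_; _,_; proj₁; proj₂; map₂)
open import Data.Sum using (_⊎_; inj₁; inj₂; [_,_]′)
open import Data.Vec as Vec using ([]; _∷_)
import Data.Vec.Properties as Vec
open import Function using (_∘_; case_of_)
open import Relation.Binary.PropositionalEquality
open import Relation.Nullary
open import Relation.Nullary.Decidable
  using (does; dec-true; dec-false; map′; _×-dec_; _⊎-dec_; _→-dec_; ¬?; decidable-stable)

-- Upper-bound strategies are described by pairs of candidates instead of answers. A later stage
-- takes its queries from a representative `f₀` of the current answer class, using only data of `f₀`
-- that the answers so far make common to the class, such as prefix counts at known boundaries.
--
-- Decoding, too, concerns the difference of two candidates: if all rows vanish, everything hosted
-- vanishes. The obstacle is that hosted numbers are not bits, while a pair of rows reveals only a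
-- residue modulo 2, or modulo a higher power of 2 where leading trues leave room. So a host has to
-- guarantee that a difference which is even throughout its instance is smaller than the room of its
-- row. For parity tests, evenness already identifies the set and the difference is 0; for numbers
-- of elements, the known number of the parent node is a bound.
--
-- In the pipeline 2^h is about n^(1/2) and 2^e about n^(1/4), and a round serves Q = 2^(h+e)
-- elements per level. This is small enough for the h rounds that fill the pipeline to cost O(n),
-- and large enough that nodes with 2^e or more elements can be queried directly within the budget
-- of a round.

∑ : ℕ → (ℕ → ℕ) → ℕ
∑ zero    g = 0
∑ (suc k) g = g 0 + ∑ k (g ∘ suc)

bit : Bool → ℕ
bit true  = 1
bit false = 0

# : ℕ → (ℕ → Bool) → ℕ
# k P = ∑ k (bit ∘ P)

at : ∀ {k} → Subset k → ℕ → Bool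
at []      _       = false
at (b ∷ f) zero    = b
at (b ∷ f) (suc x) = at f x

subset : (k : ℕ) → (ℕ → Bool) → Subset k
subset zero    P = []
subset (suc k) P = P 0 ∷ subset k (P ∘ suc)

∣subset∣ : ∀ k P → ∣ subset k P ∣ ≡ # k P
∣subset∣ zero    P = refl
∣subset∣ (suc k) P with P 0
... | true  = cong suc (∣subset∣ k (P ∘ suc))
... | false = ∣subset∣ k (P ∘ suc)

∣f∩subset∣ : ∀ {k} (f : Subset k) P → ∣ f ∩ subset k P ∣ ≡ # k (λ x → at f x ∧ P x)
∣f∩subset∣ []      P = refl
∣f∩subset∣ (b ∷ f) P with b ∧ P 0
... | true  = cong suc (∣f∩subset∣ f (P ∘ suc))
... | false = ∣f∩subset∣ f (P ∘ suc)

∣f∣≡#at : ∀ {k} (f : Subset k) → ∣ f ∣ ≡ # k (at f)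
∣f∣≡#at []          = refl
∣f∣≡#at (true  ∷ f) = cong suc (∣f∣≡#at f)
∣f∣≡#at (false ∷ f) = ∣f∣≡#at f

at-ext : ∀ {k} (f g : Subset k) → (∀ x → x < k → at f x ≡ at g x) → f ≡ g
at-ext []      []      eq = refl
at-ext (b ∷ f) (c ∷ g) eq =
  cong₂ _∷_ (eq 0 (s≤s z≤n)) (at-ext f g (λ x x<k → eq (suc x) (s≤s x<k)))

-- The game

module _ {k : ℕ} where

  hits : Subset k → (ℕ → Bool) → ℕ
  hits f P = # k (λ x → at f x ∧ P x)

  Same : List (ℕ → Bool) → Subset k → Subset k → Set
  Same L f g = All (λ P → hits f P ≡ hits g P) L

  same? : ∀ L f g → Dec (Same L f g)
  same? L f g = All.all? (λ P → hits f P ≟ hits g P) L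

  _≟ˢ_ : (f g : Subset k) → Dec (f ≡ g)
  _≟ˢ_ = Vec.≡-dec Bool._≟_

  allSubset? : {P : Subset k → Set} → (∀ f → Dec (P f)) → Dec (∀ f → P f)
  allSubset? P? with anySubset? (λ f → ¬? (P? f))
  ... | yes (f , ¬Pf) = no (λ all → ¬Pf (all f))
  ... | no ¬∃         = yes (λ f → decidable-stable (P? f) (λ ¬Pf → ¬∃ (f , ¬Pf)))

  determined? : {S : Candidates k} → (∀ f → Dec (S f)) → Dec (Determined S)
  determined? S? =
    allSubset? (λ f → allSubset? (λ g → S? f →-dec (S? g →-dec (f ≟ˢ g))))

  module _ {n : ℕ} where

    determined⇒solvable : ∀ T {S : Candidates k} → Determined S → SolvableIn k n T S
    determined⇒solvable zero    d = d
    determined⇒solvable (suc T) d = inj₁ d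

    solvable-⊆ : ∀ T {S S′ : Candidates k} → (∀ f → S′ f → S f) →
                 SolvableIn k n T S → SolvableIn k n T S′
    solvable-⊆ zero    sub d = λ f g Sf Sg → d f g (sub f Sf) (sub g Sg)
    solvable-⊆ (suc T) sub (inj₁ d) = inj₁ (λ f g Sf Sg → d f g (sub f Sf) (sub g Sg))
    solvable-⊆ (suc T) sub (inj₂ (q , ∣q∣≤n , next)) =
      inj₂ (q , ∣q∣≤n , λ a → solvable-⊆ T (λ f (Sf , eq) → sub f Sf , eq) (next a))

    solvable-≤ : ∀ {T T′} {S : Candidates k} → T ≤ T′ →
                 SolvableIn k n T S → SolvableIn k n T′ S
    solvable-≤ {T′ = T′} z≤n d = determined⇒solvable T′ d
    solvable-≤ (s≤s T≤T′) (inj₁ d) = inj₁ d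
    solvable-≤ (s≤s T≤T′) (inj₂ (q , ∣q∣≤n , next)) =
      inj₂ (q , ∣q∣≤n , λ a → solvable-≤ T≤T′ (next a))

    -- Answers above `∣ q ∣` leave no candidate, so finitely many have to be examined. Decidability
    -- is what turns an upper bound into a least number of queries in `minQueries`.
    solvable? : ∀ T {S : Candidates k} → (∀ f → Dec (S f)) → Dec (SolvableIn k n T S)
    solvable? zero    S? = determined? S?
    solvable? (suc T) {S} S? =
      determined? S? ⊎-dec anySubset? (λ q → (∣ q ∣ ≤? n) ×-dec answers? q)
      where
      refine? : ∀ q a f → Dec (S f × ∣ f ∩ q ∣ ≡ a)
      refine? q a f = S? f ×-dec (∣ f ∩ q ∣ ≟ a)
      answers? : ∀ q → Dec (∀ a → SolvableIn k n T (λ f → S f × ∣ f ∩ q ∣ ≡ a))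
      answers? q = map′ {A = ∀ {a} → a < suc ∣ q ∣ → SolvableIn k n T (λ f → S f × ∣ f ∩ q ∣ ≡ a)}
                        (λ all a → extend all a (a <? suc ∣ q ∣)) (λ all {a} _ → all a)
                        (allUpTo? (λ a → solvable? T (refine? q a)) (suc ∣ q ∣))
        where
        extend : (∀ {a} → a < suc ∣ q ∣ → SolvableIn k n T (λ f → S f × ∣ f ∩ q ∣ ≡ a)) →
                 ∀ a → Dec (a < suc ∣ q ∣) → SolvableIn k n T (λ f → S f × ∣ f ∩ q ∣ ≡ a)
        extend all a (yes a≤∣q∣) = all a≤∣q∣
        extend all a (no  a≰∣q∣) = determined⇒solvable T
          (λ f _ (_ , eq) _ → ⊥-elim (a≰∣q∣ (s≤s (subst (_≤ ∣ q ∣) eq (∣p∩q∣≤∣q∣ f q)))))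

    -- The continuation is required only relative to a representative `f₀` of the answer class.
    -- Deciding `S` yields such an `f₀` or shows that the class is empty, where nothing is left to
    -- do.
    askAll : ∀ (L : List (ℕ → Bool)) T {S : Candidates k} → All (λ P → # k P ≤ n) L →
             (∀ f → Dec (S f)) →
             (∀ f₀ → S f₀ → SolvableIn k n T (λ f → S f × Same L f₀ f)) →
             SolvableIn k n (length L + T) S
    askAll [] T {S} [] S? solve with anySubset? S?
    ... | yes (f₀ , Sf₀) = solvable-⊆ T (λ f Sf → Sf , []) (solve f₀ Sf₀)
    ... | no ¬∃          = determined⇒solvable T (λ f _ Sf _ → ⊥-elim (¬∃ (f , Sf)))
    askAll (P ∷ L) T {S} (#P≤n ∷ sizes) S? solve =
      inj₂ (q , subst (_≤ n) (sym (∣subset∣ k P)) #P≤n , λ a →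
        askAll L T sizes (λ f → S? f ×-dec (∣ f ∩ q ∣ ≟ a))
          (λ f₀ (Sf₀ , eq₀) → solvable-⊆ T
            (λ f ((Sf , eq) , same) → Sf ,
              trans (sym (∣f∩subset∣ f₀ P)) (trans eq₀ (trans (sym eq) (∣f∩subset∣ f P))) ∷ same)
            (solve f₀ Sf₀)))
      where q = subset k P

    -- The representative f₀ of the current candidates fixes the next queries, and then
    -- a representative of every answer class takes over.
    rounds : (E : ℕ → Subset k → Subset k → Set) (L : ℕ → Subset k → List (ℕ → Bool)) (b : ℕ) →
             (∀ t f → ∣ f ∣ ≤ n → All (λ P → # k P ≤ n) (L t f)) →
             (∀ t f → length (L t f) ≤ b) →
             (∀ t {f₀ f f₁} → ∣ f₀ ∣ ≤ n → ∣ f ∣ ≤ n → ∣ f₁ ∣ ≤ n →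
               E t f₀ f → E t f₀ f₁ → Same (L t f₀) f₁ f → E (suc t) f₁ f) →
             ∀ R t → (∀ {f₀ f} → ∣ f₀ ∣ ≤ n → ∣ f ∣ ≤ n → E (R + t) f₀ f → f₀ ≡ f) →
             ∀ {S : Candidates k} f₀ → (∀ f → Dec (S f)) → (∀ f → S f → ∣ f ∣ ≤ n) →
             ∣ f₀ ∣ ≤ n → (∀ f → S f → E t f₀ f) → SolvableIn k n (R * b) S
    rounds E L b sizes len step zero t final f₀ S? small f₀≤n agree =
      λ f g Sf Sg → trans (sym (final f₀≤n (small f Sf) (agree f Sf)))
                          (final f₀≤n (small g Sg) (agree g Sg))
    rounds E L b sizes len step (suc R) t final {S} f₀ S? small f₀≤n agree =
      solvable-≤ (+-monoˡ-≤ (R * b) (len t f₀))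
        (askAll (L t f₀) (R * b) (sizes t f₀ f₀≤n) S? (λ f₁ Sf₁ →
          rounds E L b sizes len step R (suc t)
            (subst (λ s → ∀ {f₀ f} → ∣ f₀ ∣ ≤ n → ∣ f ∣ ≤ n → E s f₀ f → f₀ ≡ f) (sym (+-suc R t)) final)
            f₁ (λ f → S? f ×-dec same? (L t f₀) f₁ f) (λ f (Sf , _) → small f Sf)
            (small f₁ Sf₁)
            (λ f (Sf , same) → step t f₀≤n (small f Sf) (small f₁ Sf₁) (agree f Sf) (agree f₁ Sf₁) same)))

    initial? : ∀ f → Dec (Initial k n f)
    initial? f = ∣ f ∣ ≤? n

    minQueries : ∀ T → SolvableIn k n T (Initial k n) →
                 ∃ λ T₀ → IsMinQueries k n T₀ × T₀ ≤ T
    minQueries zero    s = 0 , (s , λ _ _ → z≤n) , z≤n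
    minQueries (suc T) s with solvable? T initial?
    ... | yes s′ = map₂ (map₂ m≤n⇒m≤1+n) (minQueries T s′)
    ... | no ¬s′ = suc T , (s , λ T′ s′ → ≰⇒> (λ T′≤T → ¬s′ (solvable-≤ T′≤T s′))) , ≤-refl

-- Lower bound

∣p∪q∣≤∣p∣+∣q∣ : ∀ {k} (p q : Subset k) → ∣ p ∪ q ∣ ≤ ∣ p ∣ + ∣ q ∣
∣p∪q∣≤∣p∣+∣q∣ []          []          = z≤n
∣p∪q∣≤∣p∣+∣q∣ (true  ∷ p) (b ∷ q)     =
  s≤s (≤-trans (∣p∪q∣≤∣p∣+∣q∣ p q) (+-monoʳ-≤ ∣ p ∣ (∣p∣≤∣x∷p∣ b q)))
∣p∪q∣≤∣p∣+∣q∣ (false ∷ p) (true  ∷ q) =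
  ≤-trans (s≤s (∣p∪q∣≤∣p∣+∣q∣ p q)) (≤-reflexive (sym (+-suc ∣ p ∣ ∣ q ∣)))
∣p∪q∣≤∣p∣+∣q∣ (false ∷ p) (false ∷ q) = ∣p∪q∣≤∣p∣+∣q∣ p q

∣p++q∣ : ∀ {a b} (p : Subset a) (q : Subset b) → ∣ p Vec.++ q ∣ ≡ ∣ p ∣ + ∣ q ∣
∣p++q∣ []          q = refl
∣p++q∣ (true  ∷ p) q = cong suc (∣p++q∣ p q)
∣p++q∣ (false ∷ p) q = ∣p++q∣ p q

unmarked : ∀ {k} (V : Subset k) → ∣ V ∣ < k → ∃ λ x → x ∉ V
unmarked {k} V ∣V∣<k with Fin.any? (λ x → ¬? (x ∈? V))
... | yes (x , x∉V) = x , x∉V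
... | no ¬∃ = ⊥-elim (<-irrefl refl (<-≤-trans ∣V∣<k
        (subst (_≤ ∣ V ∣) (∣⊤∣≡n k)
          (p⊆q⇒∣p∣≤∣q∣ {p = ⊤} (λ {x} _ → decidable-stable (x ∈? V) (λ x∉V → ¬∃ (x , x∉V)))))))

module _ {k n : ℕ} where

  -- `V` collects the elements queried so far along the branch of zero answers.
  zeroAnswers : ∀ T {S : Candidates k} (V : Subset k) → S ⊥ → (∀ x → x ∉ V → S ⁅ x ⁆) →
                SolvableIn k n T S → k ≤ ∣ V ∣ + T * n
  determined⇒covered : ∀ {S : Candidates k} (V : Subset k) → S ⊥ → (∀ x → x ∉ V → S ⁅ x ⁆) →
                       Determined S → k ≤ ∣ V ∣
  determined⇒covered V S⊥ S⁅⁆ d with ∣ V ∣ <? k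
  ... | no  ∣V∣≮k = ≮⇒≥ ∣V∣≮k
  ... | yes ∣V∣<k = let (x , x∉V) = unmarked V ∣V∣<k in
    ⊥-elim (∉⊥ (subst (x ∈_) (sym (d ⊥ ⁅ x ⁆ S⊥ (S⁅⁆ x x∉V))) (x∈⁅x⁆ x)))
  zeroAnswers zero    V S⊥ S⁅⁆ d = ≤-trans (determined⇒covered V S⊥ S⁅⁆ d) (m≤m+n _ _)
  zeroAnswers (suc T) V S⊥ S⁅⁆ (inj₁ d) = ≤-trans (determined⇒covered V S⊥ S⁅⁆ d) (m≤m+n _ _)
  zeroAnswers (suc T) V S⊥ S⁅⁆ (inj₂ (q , ∣q∣≤n , next)) = begin
    k                       ≤⟨ zeroAnswers T (V ∪ q) (S⊥ , ∣⊥∩q∣) survives (next 0) ⟩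
    ∣ V ∪ q ∣ + T * n       ≤⟨ +-monoˡ-≤ (T * n) (∣p∪q∣≤∣p∣+∣q∣ V q) ⟩
    ∣ V ∣ + ∣ q ∣ + T * n   ≤⟨ +-monoˡ-≤ (T * n) (+-monoʳ-≤ ∣ V ∣ ∣q∣≤n) ⟩
    ∣ V ∣ + n + T * n       ≡⟨ +-assoc ∣ V ∣ n (T * n) ⟩
    ∣ V ∣ + (n + T * n)     ∎
    where
    open ≤-Reasoning
    ∣⊥∩q∣ : ∣ ⊥ ∩ q ∣ ≡ 0
    ∣⊥∩q∣ = trans (cong ∣_∣ (∩-zeroˡ q)) (∣⊥∣≡0 k)
    survives : ∀ x → x ∉ V ∪ q → _ × ∣ ⁅ x ⁆ ∩ q ∣ ≡ 0
    survives x x∉ = S⁅⁆ x (x∉ ∘ p⊆p∪q q) , trans (cong ∣_∣ (Empty-unique empty)) (∣⊥∣≡0 k)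
      where
      empty : ¬ ∃ λ y → y ∈ ⁅ x ⁆ ∩ q
      empty (y , y∈) = let (y∈x , y∈q) = x∈p∩q⁻ ⁅ x ⁆ q y∈ in
        x∉ (q⊆p∪q V q (subst (_∈ q) (x∈⁅y⁆⇒x≡y x y∈x) y∈q))

  solvable⇒k≤Tn : ∀ T → 1 ≤ n → SolvableIn k n T (Initial k n) → k ≤ T * n
  solvable⇒k≤Tn T 1≤n s = subst (λ v → k ≤ v + T * n) (∣⊥∣≡0 k)
    (zeroAnswers T ⊥ (≤-trans (≤-reflexive (∣⊥∣≡0 k)) z≤n)
      (λ x _ → ≤-trans (≤-reflexive (∣⁅x⁆∣≡1 x)) 1≤n) s)

  answer : ∀ (f q : Subset k) → ∣ q ∣ ≤ n → Fin (suc n)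
  answer f q ∣q∣≤n = fromℕ< (s≤s (≤-trans (∣p∩q∣≤∣q∣ f q) ∣q∣≤n))

  transcript : ∀ T {S : Candidates k} → SolvableIn k n T S → Subset k → Fin (suc n ^ T)
  transcript zero    s f = Fin.zero
  -- A branch that ends early gets an arbitrary code, since at most one candidate reaches it.
  transcript (suc T) (inj₁ d) f = fromℕ< (m^n>0 (suc n) (suc T))
  transcript (suc T) (inj₂ (q , ∣q∣≤n , next)) f =
    combine (answer f q ∣q∣≤n) (transcript T (next ∣ f ∩ q ∣) f)

  transcript-injective : ∀ T {S : Candidates k} (s : SolvableIn k n T S) {f g : Subset k} →
                         S f → S g → transcript T s f ≡ transcript T s g → f ≡ g
  transcript-injective zero    d        Sf Sg eq = d _ _ Sf Sg
  transcript-injective (suc T) (inj₁ d) Sf Sg eq = d _ _ Sf Sg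
  transcript-injective (suc T) (inj₂ (q , ∣q∣≤n , next)) {f} {g} Sf Sg eq =
    transcript-injective T (next ∣ f ∩ q ∣) (Sf , refl) (Sg , sym same)
      (trans eq₂ (cong (λ a → transcript T (next a) g) (sym same)))
    where
    eqs = Fin.combine-injective (answer f q ∣q∣≤n) (transcript T (next ∣ f ∩ q ∣) f)
                                (answer g q ∣q∣≤n) (transcript T (next ∣ g ∩ q ∣) g) eq
    same : ∣ f ∩ q ∣ ≡ ∣ g ∩ q ∣
    same = Fin.fromℕ<-injective _ _ _ _ (proj₁ eqs)
    eq₂ = proj₂ eqs

module _ (m r : ℕ) where

  -- Shaped so that `sparse` can concatenate vectors; `r` absorbs the remainder of `k` modulo `n`.
  blocks : ℕ → ℕ
  blocks zero    = r
  blocks (suc j) = m + blocks j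

  oneOrNone : Fin (suc m) → Subset m
  oneOrNone Fin.zero    = ⊥
  oneOrNone (Fin.suc x) = ⁅ x ⁆

  sparse : ∀ j → Fin (suc m ^ j) → Subset (blocks j)
  sparse zero    i = ⊥
  sparse (suc j) i = oneOrNone (proj₁ (remQuot {suc m} (suc m ^ j) i)) Vec.++
                     sparse j (proj₂ (remQuot {suc m} (suc m ^ j) i))

  ∣oneOrNone∣≤1 : ∀ x → ∣ oneOrNone x ∣ ≤ 1
  ∣oneOrNone∣≤1 Fin.zero    = ≤-trans (≤-reflexive (∣⊥∣≡0 m)) z≤n
  ∣oneOrNone∣≤1 (Fin.suc x) = ≤-reflexive (∣⁅x⁆∣≡1 x)

  ∣sparse∣≤ : ∀ j i → ∣ sparse j i ∣ ≤ j
  ∣sparse∣≤ zero    i = ≤-reflexive (∣⊥∣≡0 r)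
  ∣sparse∣≤ (suc j) i = ≤-trans (≤-reflexive (∣p++q∣ (oneOrNone (proj₁ xi)) (sparse j (proj₂ xi))))
                                (+-mono-≤ (∣oneOrNone∣≤1 (proj₁ xi)) (∣sparse∣≤ j (proj₂ xi)))
    where xi = remQuot {suc m} (suc m ^ j) i

  oneOrNone-injective : ∀ x y → oneOrNone x ≡ oneOrNone y → x ≡ y
  oneOrNone-injective Fin.zero    Fin.zero    eq = refl
  oneOrNone-injective Fin.zero    (Fin.suc y) eq = ⊥-elim (∉⊥ (subst (y ∈_) (sym eq) (x∈⁅x⁆ y)))
  oneOrNone-injective (Fin.suc x) Fin.zero    eq = ⊥-elim (∉⊥ (subst (x ∈_) eq (x∈⁅x⁆ x)))
  oneOrNone-injective (Fin.suc x) (Fin.suc y) eq = cong Fin.suc (x∈⁅y⁆⇒x≡y y (subst (x ∈_) eq (x∈⁅x⁆ x)))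

  sparse-injective : ∀ j i i′ → sparse j i ≡ sparse j i′ → i ≡ i′
  sparse-injective zero    Fin.zero Fin.zero eq = refl
  sparse-injective (suc j) i i′ eq =
    trans (sym (Fin.combine-remQuot {suc m} (suc m ^ j) i))
      (trans (cong₂ (combine {suc m})
        (oneOrNone-injective x x′ (Vec.++-injectiveˡ (oneOrNone x) (oneOrNone x′) eq))
        (sparse-injective j (proj₂ (rq i)) (proj₂ (rq i′))
          (Vec.++-injectiveʳ (oneOrNone x) (oneOrNone x′) eq)))
      (Fin.combine-remQuot {suc m} (suc m ^ j) i′))
    where
    rq : Fin (suc m ^ suc j) → Fin (suc m) × Fin (suc m ^ j)
    rq = remQuot {suc m} (suc m ^ j)
    x  = proj₁ (rq i)
    x′ = proj₁ (rq i′)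

  blocks≡ : ∀ j → blocks j ≡ r + j * m
  blocks≡ zero    = sym (+-identityʳ r)
  blocks≡ (suc j) = begin
    m + blocks j     ≡⟨ cong (m +_) (blocks≡ j) ⟩
    m + (r + j * m)  ≡⟨ +-assoc m r (j * m) ⟨
    m + r + j * m    ≡⟨ cong (_+ j * m) (+-comm m r) ⟩
    r + m + j * m    ≡⟨ +-assoc r m (j * m) ⟩
    r + (m + j * m)  ∎
    where open ≡-Reasoning

solvable⇒counting : ∀ m r n T → SolvableIn (blocks m r n) n T (Initial (blocks m r n) n) →
                    suc m ^ n ≤ suc n ^ T
solvable⇒counting m r n T s = Fin.injective⇒≤
  {f = λ i → transcript T s (sparse m r n i)}
  (λ {i} {i′} eq → sparse-injective m r n i i′
    (transcript-injective T s (∣sparse∣≤ m r n i) (∣sparse∣≤ m r n i′) eq))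

2^⌊log₂n⌋≤n : ∀ n → 1 ≤ n → 2 ^ ⌊log₂ n ⌋ ≤ n
2^⌊log₂n⌋≤n = <-rec _ go
  where
  go : ∀ n → (∀ {j} → j < n → 1 ≤ j → 2 ^ ⌊log₂ j ⌋ ≤ j) → 1 ≤ n → 2 ^ ⌊log₂ n ⌋ ≤ n
  go (suc zero) rec _ = ≤-refl
  go n@(suc (suc n′)) rec _ = begin
    2 ^ ⌊log₂ n ⌋                    ≡⟨ cong (2 ^_) (sym (m+[n∸m]≡n 1≤log)) ⟩
    2 ^ (1 + (⌊log₂ n ⌋ ∸ 1))        ≡⟨ cong (λ e → 2 ^ (1 + e)) (⌊log₂⌊n/2⌋⌋≡⌊log₂n⌋∸1 n) ⟨
    2 * 2 ^ ⌊log₂ ⌊ n /2⌋ ⌋          ≤⟨ *-monoʳ-≤ 2 (rec (⌊n/2⌋<n (suc n′)) (s≤s z≤n)) ⟩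
    2 * ⌊ n /2⌋                      ≡⟨ cong (⌊ n /2⌋ +_) (+-identityʳ _) ⟩
    ⌊ n /2⌋ + ⌊ n /2⌋                ≤⟨ +-monoʳ-≤ ⌊ n /2⌋ (⌊n/2⌋≤⌈n/2⌉ n) ⟩
    ⌊ n /2⌋ + ⌈ n /2⌉                ≡⟨ ⌊n/2⌋+⌈n/2⌉≡n n ⟩
    n                                ∎
    where
    open ≤-Reasoning
    1≤log : 1 ≤ ⌊log₂ n ⌋
    1≤log = ⌊log₂⌋-mono-≤ {2} {n} (s≤s (s≤s z≤n))

n<2^1+⌊log₂n⌋ : ∀ n → n < 2 ^ suc ⌊log₂ n ⌋
n<2^1+⌊log₂n⌋ n = ≰⇒> (λ le → 1+n≰n
  (≤-trans (≤-reflexive (sym (⌊log₂[2^n]⌋≡n (suc ⌊log₂ n ⌋)))) (⌊log₂⌋-mono-≤ le)))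

2^-cancel-≤ : ∀ {a b} → 2 ^ a ≤ 2 ^ b → a ≤ b
2^-cancel-≤ {a} {b} le = ≮⇒≥ (λ b<a → <⇒≱ (^-monoʳ-< 2 (s≤s (s≤s z≤n)) b<a) le)

1≤⌊log₂n⌋ : ∀ {n} → 2 ≤ n → 1 ≤ ⌊log₂ n ⌋
1≤⌊log₂n⌋ = ⌊log₂⌋-mono-≤ {2}

lowerBound : ∀ k n T → 2 ≤ n → SolvableIn k n T (Initial k n) → Num k n ≤ 3 * (T * Den n)
lowerBound k n@(suc n′) T 2≤n s = begin
  n * λ′ + m * ℓ          ≤⟨ +-mono-≤ info (*-monoˡ-≤ ℓ cover) ⟩
  2 * (T * ℓ) + T * ℓ     ≡⟨ +-comm (2 * (T * ℓ)) (T * ℓ) ⟩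
  3 * (T * ℓ)             ∎
  where
  open ≤-Reasoning
  m = k / n
  ℓ = ⌊log₂ n ⌋
  λ′ = ⌊log₂ (1 + m) ⌋
  k≡ : k ≡ blocks m (k % n) n
  k≡ = trans (m≡m%n+[m/n]*n k n) (trans (cong (k % n +_) (*-comm m n)) (sym (blocks≡ m (k % n) n)))
  cover : m ≤ T
  cover = ≤-trans (/-monoˡ-≤ n (solvable⇒k≤Tn T (≤-trans (s≤s z≤n) 2≤n) s)) (≤-reflexive (m*n/n≡m T n))
  info : n * λ′ ≤ 2 * (T * ℓ)
  info = begin
    n * λ′         ≤⟨ 2^-cancel-≤ (begin
      2 ^ (n * λ′)         ≡⟨ cong (2 ^_) (*-comm n λ′) ⟩
      2 ^ (λ′ * n)         ≡⟨ ^-*-assoc 2 λ′ n ⟨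
      (2 ^ λ′) ^ n         ≤⟨ ^-monoˡ-≤ n (2^⌊log₂n⌋≤n (1 + m) (s≤s z≤n)) ⟩
      suc m ^ n            ≤⟨ solvable⇒counting m (k % n) n T
                               (subst (λ k → SolvableIn k n T (Initial k n)) k≡ s) ⟩
      suc n ^ T            ≤⟨ ^-monoˡ-≤ T (n<2^1+⌊log₂n⌋ n) ⟩
      (2 ^ suc ℓ) ^ T      ≡⟨ ^-*-assoc 2 (suc ℓ) T ⟩
      2 ^ (suc ℓ * T)      ∎) ⟩
    -- An answer carries fewer than `suc ℓ` bits, and `suc ℓ` is at most `ℓ + ℓ` because `n` is at
    -- least 2.
    suc ℓ * T      ≤⟨ *-monoˡ-≤ T (+-monoˡ-≤ ℓ (1≤⌊log₂n⌋ 2≤n)) ⟩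
    (ℓ + ℓ) * T    ≡⟨ cong (λ e → (ℓ + e) * T) (sym (+-identityʳ ℓ)) ⟩
    2 * ℓ * T      ≡⟨ *-assoc 2 ℓ T ⟩
    2 * (ℓ * T)    ≡⟨ cong (2 *_) (*-comm ℓ T) ⟩
    2 * (T * ℓ)    ∎

-- Sums of naturals and of integers

∑-cong : ∀ k {g h : ℕ → ℕ} → (∀ x → x < k → g x ≡ h x) → ∑ k g ≡ ∑ k h
∑-cong zero    eq = refl
∑-cong (suc k) eq = cong₂ _+_ (eq 0 (s≤s z≤n)) (∑-cong k (λ x x<k → eq (suc x) (s≤s x<k)))

∑-mono : ∀ k {g h : ℕ → ℕ} → (∀ x → x < k → g x ≤ h x) → ∑ k g ≤ ∑ k h
∑-mono zero    le = z≤n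
∑-mono (suc k) le = +-mono-≤ (le 0 (s≤s z≤n)) (∑-mono k (λ x x<k → le (suc x) (s≤s x<k)))

∑-+ : ∀ k (g h : ℕ → ℕ) → ∑ k (λ x → g x + h x) ≡ ∑ k g + ∑ k h
∑-+ zero    g h = refl
∑-+ (suc k) g h rewrite ∑-+ k (g ∘ suc) (h ∘ suc) =
  interchange (g 0) (h 0) (∑ k (g ∘ suc)) (∑ k (h ∘ suc))
  where
  interchange : ∀ a b c d → a + b + (c + d) ≡ a + c + (b + d)
  interchange = ℕ-Solver.solve-∀

∑-0 : ∀ k → ∑ k (λ _ → 0) ≡ 0
∑-0 zero    = refl
∑-0 (suc k) = ∑-0 k

∑ᶻ : ℕ → (ℕ → ℤ) → ℤ
∑ᶻ zero    g = 0ℤ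
∑ᶻ (suc k) g = g 0 ℤ.+ ∑ᶻ k (g ∘ suc)

∑ᶻ-cong : ∀ k {g h : ℕ → ℤ} → (∀ x → x < k → g x ≡ h x) → ∑ᶻ k g ≡ ∑ᶻ k h
∑ᶻ-cong zero    eq = refl
∑ᶻ-cong (suc k) eq = cong₂ ℤ._+_ (eq 0 (s≤s z≤n)) (∑ᶻ-cong k (λ x x<k → eq (suc x) (s≤s x<k)))

∑ᶻ-+ : ∀ k (g h : ℕ → ℤ) → ∑ᶻ k (λ x → g x ℤ.+ h x) ≡ ∑ᶻ k g ℤ.+ ∑ᶻ k h
∑ᶻ-+ zero    g h = refl
∑ᶻ-+ (suc k) g h rewrite ∑ᶻ-+ k (g ∘ suc) (h ∘ suc) =
  interchange (g 0) (h 0) (∑ᶻ k (g ∘ suc)) (∑ᶻ k (h ∘ suc))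
  where
  interchange : ∀ a b c d → a ℤ.+ b ℤ.+ (c ℤ.+ d) ≡ a ℤ.+ c ℤ.+ (b ℤ.+ d)
  interchange = ℤ-Solver.solve-∀

∑ᶻ-neg : ∀ k (g : ℕ → ℤ) → ∑ᶻ k (λ x → ℤ.- g x) ≡ ℤ.- ∑ᶻ k g
∑ᶻ-neg zero    g = refl
∑ᶻ-neg (suc k) g = trans (cong (λ s → ℤ.- g 0 ℤ.+ s) (∑ᶻ-neg k (g ∘ suc)))
                         (sym (ℤ.neg-distrib-+ (g 0) (∑ᶻ k (g ∘ suc))))

∑ᶻ-0 : ∀ k → ∑ᶻ k (λ _ → 0ℤ) ≡ 0ℤ
∑ᶻ-0 zero    = refl
∑ᶻ-0 (suc k) = trans (ℤ.+-identityˡ _) (∑ᶻ-0 k)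

-- Signed queries

Even : ℤ → Set
Even a = ∃ λ b → a ≡ b ℤ.+ b

signed : Bool → ℤ → ℤ
signed false a = a
signed true  a = ℤ.- a

hosted : (List Bool → ℤ) → List Bool → ℤ
hosted g []          = 0ℤ
hosted g (false ∷ j) = 0ℤ
hosted g (true  ∷ j) = g j

-- `z p j` is the number that instance `p` hosts in its row `j`. The path `p` descends through the
-- recursion, `true` leading to the first copy and `false` to the second.
Content : Set
Content = List Bool → List Bool → ℤ

-- The sign bit β chooses between a + b and a - b. The number hosted at a node perturbs the second
-- copy: the first has to absorb the perturbation that the node itself receives from above, whereas
-- the second is free to take a fresh one.
combined : Content → List Bool → ℤ
combined z []      = 0ℤ
combined z (β ∷ r) =
  combined (z ∘ (true ∷_)) r ℤ.+ signed β (combined (z ∘ (false ∷_)) r ℤ.+ hosted (z []) r)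

-- Measures the room of a row: every leading true is one passage into a first copy, and each passage
-- halves the perturbation.
lead : List Bool → ℕ
lead []          = 0
lead (false ∷ r) = 0
lead (true  ∷ r) = suc (lead r)

-- The 2 accounts for the sign bit and for the leading true of a hosting row; the latter also
-- explains `suc (lead j)`. Evenness is granted as a premise because the pair of rows establishes it
-- before the size of the hosted number matters.
Hosts : ℕ → Content → Set
Hosts t z = ∀ p s → length p + (2 + s) ≡ t → (∀ j → length j ≡ s → Even (z p j)) →
            ∀ j → length j ≡ s → ℤ.∣ z p j ∣ < 2 ^ suc (lead j)

<1⇒≡0 : ∀ a → ℤ.∣ a ∣ < 1 → a ≡ 0ℤ
<1⇒≡0 a (s≤s le) = ℤ.∣i∣≡0⇒i≡0 (n≤0⇒n≡0 le)

∣a+a∣≡2∣a∣ : ∀ a → ℤ.∣ a ℤ.+ a ∣ ≡ 2 * ℤ.∣ a ∣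
∣a+a∣≡2∣a∣ a = trans (cong ℤ.∣_∣ (double a)) (ℤ.abs-* (+ᶻ 2) a)
  where
  double : ∀ a → a ℤ.+ a ≡ +ᶻ 2 ℤ.* a
  double = ℤ-Solver.solve-∀

-- Adding the two rows gives 2A + e₁ = 0, so the perturbation e₁ is halved on its way down
-- into the first half, where there is one leading true less.
combined-injective : ∀ t z (e : List Bool → ℤ) →
  (∀ r → length r ≡ t → combined z r ℤ.+ e r ≡ 0ℤ) →
  (∀ r → length r ≡ t → ℤ.∣ e r ∣ < 2 ^ lead r) → Hosts t z →
  (∀ r → length r ≡ t → e r ≡ 0ℤ) ×
  (∀ p j → length p + (2 + length j) ≡ t → z p j ≡ 0ℤ)
combined-injective zero z e eqs small hosts = e≡0 , λ p j eq → ⊥-elim (1+n≢0 (trans (sym (+-suc (length p) _)) eq))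
  where
  e≡0 : ∀ r → length r ≡ 0 → e r ≡ 0ℤ
  e≡0 [] _ = trans (sym (ℤ.+-identityˡ _)) (eqs [] refl)
combined-injective (suc t) z e eqs small hosts = e≡0 , z≡0
  where
  zᵃ zᵇ : Content
  zᵃ = z ∘ (true ∷_)
  zᵇ = z ∘ (false ∷_)
  A B : List Bool → ℤ
  A r = combined zᵃ r
  B r = combined zᵇ r ℤ.+ hosted (z []) r

  e₀≡0 : ∀ r → length r ≡ t → e (false ∷ r) ≡ 0ℤ
  e₀≡0 r eq = <1⇒≡0 _ (small (false ∷ r) (cong suc eq))

  e₁≡-2A : ∀ r → length r ≡ t → e (true ∷ r) ≡ ℤ.- (A r ℤ.+ A r)
  e₁≡-2A r eq = begin
    e₁                                                                   ≡⟨ split (A r) (B r) e₀ e₁ ⟩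
    (A r ℤ.- B r ℤ.+ e₁) ℤ.+ (A r ℤ.+ B r ℤ.+ e₀) ℤ.- (A r ℤ.+ A r) ℤ.- e₀
      ≡⟨ cong₂ (λ u v → u ℤ.+ v ℤ.- (A r ℤ.+ A r) ℤ.- e₀) (eqs (true ∷ r) (cong suc eq)) (eqs (false ∷ r) (cong suc eq)) ⟩
    0ℤ ℤ.+ 0ℤ ℤ.- (A r ℤ.+ A r) ℤ.- e₀                                    ≡⟨ cong (λ u → 0ℤ ℤ.+ 0ℤ ℤ.- (A r ℤ.+ A r) ℤ.- u) (e₀≡0 r eq) ⟩
    0ℤ ℤ.+ 0ℤ ℤ.- (A r ℤ.+ A r) ℤ.- 0ℤ                                    ≡⟨ tidy (A r) ⟩
    ℤ.- (A r ℤ.+ A r)                                                    ∎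
    where
    open ≡-Reasoning
    e₀ = e (false ∷ r)
    e₁ = e (true ∷ r)
    split : ∀ a b c d → d ≡ (a ℤ.- b ℤ.+ d) ℤ.+ (a ℤ.+ b ℤ.+ c) ℤ.- (a ℤ.+ a) ℤ.- c
    split = ℤ-Solver.solve-∀
    tidy : ∀ a → 0ℤ ℤ.+ 0ℤ ℤ.- (a ℤ.+ a) ℤ.- 0ℤ ≡ ℤ.- (a ℤ.+ a)
    tidy = ℤ-Solver.solve-∀

  smallᵃ : ∀ r → length r ≡ t → ℤ.∣ ℤ.- A r ∣ < 2 ^ lead r
  smallᵃ r eq = *-cancelˡ-< 2 _ _ (subst (_< 2 ^ suc (lead r)) abs (small (true ∷ r) (cong suc eq)))
    where
    abs : ℤ.∣ e (true ∷ r) ∣ ≡ 2 * ℤ.∣ ℤ.- A r ∣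
    abs = trans (cong ℤ.∣_∣ (e₁≡-2A r eq))
         (trans (ℤ.∣-i∣≡∣i∣ (A r ℤ.+ A r))
         (trans (∣a+a∣≡2∣a∣ (A r)) (cong (2 *_) (sym (ℤ.∣-i∣≡∣i∣ (A r))))))

  inᵃ = combined-injective t zᵃ (λ r → ℤ.- A r) (λ r _ → ℤ.+-inverseʳ (A r)) smallᵃ
          (λ p s eq → hosts (true ∷ p) s (cong suc eq))

  A≡0 : ∀ r → length r ≡ t → A r ≡ 0ℤ
  A≡0 r eq = ℤ.neg-injective (proj₁ inᵃ r eq)

  e≡0 : ∀ r → length r ≡ suc t → e r ≡ 0ℤ
  e≡0 (false ∷ r) eq = e₀≡0 r (suc-injective eq)
  e≡0 (true  ∷ r) eq = trans (e₁≡-2A r (suc-injective eq))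
                             (cong (λ a → ℤ.- (a ℤ.+ a)) (A≡0 r (suc-injective eq)))

  B≡0 : ∀ r → length r ≡ t → B r ≡ 0ℤ
  B≡0 r eq = begin
    B r                         ≡⟨ split (A r) (B r) (e (false ∷ r)) ⟩
    (A r ℤ.+ B r ℤ.+ e (false ∷ r)) ℤ.- A r ℤ.- e (false ∷ r)
      ≡⟨ cong₂ (λ u v → u ℤ.- v ℤ.- e (false ∷ r)) (eqs (false ∷ r) (cong suc eq)) (A≡0 r eq) ⟩
    0ℤ ℤ.- 0ℤ ℤ.- e (false ∷ r) ≡⟨ cong (λ u → 0ℤ ℤ.- 0ℤ ℤ.- u) (e₀≡0 r eq) ⟩
    0ℤ                          ∎
    where
    open ≡-Reasoning
    split : ∀ a b c → b ≡ (a ℤ.+ b ℤ.+ c) ℤ.- a ℤ.- c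
    split = ℤ-Solver.solve-∀

  smallᵇ : ∀ r → length r ≡ t → ℤ.∣ hosted (z []) r ∣ < 2 ^ lead r
  smallᵇ []          eq = s≤s z≤n
  smallᵇ (false ∷ j) eq = s≤s z≤n
  smallᵇ (true  ∷ j) eq = hosts [] (length j) (cong suc eq) even j refl
    where
    -- The rows `true ∷ i` and `false ∷ i` of the second copy add up to 2U plus the hosted number,
    -- and both vanish.
    even : ∀ i → length i ≡ length j → Even (z [] i)
    even i eqᵢ = ℤ.- U , (begin
      z [] i                          ≡⟨ split U V (z [] i) ⟩
      (U ℤ.- V ℤ.+ z [] i) ℤ.+ (U ℤ.+ V ℤ.+ 0ℤ) ℤ.+ (ℤ.- U ℤ.+ ℤ.- U)
        ≡⟨ cong₂ (λ u v → u ℤ.+ v ℤ.+ (ℤ.- U ℤ.+ ℤ.- U)) (B≡0 (true ∷ i) eq′) (B≡0 (false ∷ i) eq′) ⟩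
      0ℤ ℤ.+ 0ℤ ℤ.+ (ℤ.- U ℤ.+ ℤ.- U) ≡⟨ ℤ.+-identityˡ _ ⟩
      ℤ.- U ℤ.+ ℤ.- U                 ∎)
      where
      open ≡-Reasoning
      eq′ : suc (length i) ≡ t
      eq′ = trans (cong suc eqᵢ) eq
      U = combined (zᵇ ∘ (true ∷_)) i
      V = combined (zᵇ ∘ (false ∷_)) i ℤ.+ hosted (zᵇ []) i
      split : ∀ u v w → w ≡ (u ℤ.- v ℤ.+ w) ℤ.+ (u ℤ.+ v ℤ.+ 0ℤ) ℤ.+ (ℤ.- u ℤ.+ ℤ.- u)
      split = ℤ-Solver.solve-∀

  inᵇ = combined-injective t zᵇ (hosted (z [])) B≡0 smallᵇ
          (λ p s eq → hosts (false ∷ p) s (cong suc eq))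

  z≡0 : ∀ p j → length p + (2 + length j) ≡ suc t → z p j ≡ 0ℤ
  z≡0 []          j eq = proj₁ inᵇ (true ∷ j) (suc-injective eq)
  z≡0 (true  ∷ p) j eq = proj₂ inᵃ p j (suc-injective eq)
  z≡0 (false ∷ p) j eq = proj₂ inᵇ p j (suc-injective eq)

-- Linearity of the scheme and sizes of its rows

signed-∑ᶻ : ∀ β k (g : ℕ → ℤ) → signed β (∑ᶻ k g) ≡ ∑ᶻ k (signed β ∘ g)
signed-∑ᶻ false k g = refl
signed-∑ᶻ true  k g = sym (∑ᶻ-neg k g)

signed-* : ∀ β a c → signed β (a ℤ.* c) ≡ signed β a ℤ.* c
signed-* false a c = refl
signed-* true  a c = ℤ.neg-distribˡ-* a c

∣signed∣ : ∀ β a → ℤ.∣ signed β a ∣ ≡ ℤ.∣ a ∣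
∣signed∣ false a = refl
∣signed∣ true  a = ℤ.∣-i∣≡∣i∣ a

hosted-∑ᶻ : ∀ k (g : ℕ → List Bool → ℤ) r →
            hosted (λ j → ∑ᶻ k (λ x → g x j)) r ≡ ∑ᶻ k (λ x → hosted (g x) r)
hosted-∑ᶻ k g []          = sym (∑ᶻ-0 k)
hosted-∑ᶻ k g (false ∷ r) = sym (∑ᶻ-0 k)
hosted-∑ᶻ k g (true  ∷ r) = refl

combined-∑ᶻ : ∀ k (z : ℕ → Content) r →
              combined (λ p j → ∑ᶻ k (λ x → z x p j)) r ≡ ∑ᶻ k (λ x → combined (z x) r)
combined-∑ᶻ k z []      = sym (∑ᶻ-0 k)
combined-∑ᶻ k z (β ∷ r) = begin
  combined (λ p j → ∑ᶻ k (λ x → zᵃ x p j)) r ℤ.+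
    signed β (combined (λ p j → ∑ᶻ k (λ x → zᵇ x p j)) r ℤ.+ hosted (λ j → ∑ᶻ k (λ x → z x [] j)) r)
    ≡⟨ cong₂ (λ u v → u ℤ.+ signed β v) (combined-∑ᶻ k zᵃ r)
         (cong₂ ℤ._+_ (combined-∑ᶻ k zᵇ r) (hosted-∑ᶻ k (λ x → z x []) r)) ⟩
  ∑ᶻ k a ℤ.+ signed β (∑ᶻ k (λ x → combined (zᵇ x) r) ℤ.+ ∑ᶻ k (λ x → hosted (z x []) r))
    ≡⟨ cong (λ v → ∑ᶻ k a ℤ.+ signed β v) (∑ᶻ-+ k _ _) ⟨
  ∑ᶻ k a ℤ.+ signed β (∑ᶻ k b)            ≡⟨ cong (λ v → ∑ᶻ k a ℤ.+ v) (signed-∑ᶻ β k b) ⟩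
  ∑ᶻ k a ℤ.+ ∑ᶻ k (signed β ∘ b)          ≡⟨ ∑ᶻ-+ k _ _ ⟨
  ∑ᶻ k (λ x → a x ℤ.+ signed β (b x))     ∎
  where
  open ≡-Reasoning
  zᵃ zᵇ : ℕ → Content
  zᵃ x = z x ∘ (true ∷_)
  zᵇ x = z x ∘ (false ∷_)
  a b : ℕ → ℤ
  a x = combined (zᵃ x) r
  b x = combined (zᵇ x) r ℤ.+ hosted (z x []) r

hosted-* : ∀ g c r → hosted (λ j → g j ℤ.* c) r ≡ hosted g r ℤ.* c
hosted-* g c []          = refl
hosted-* g c (false ∷ r) = refl
hosted-* g c (true  ∷ r) = refl

combined-* : ∀ (z : Content) c r → combined (λ p j → z p j ℤ.* c) r ≡ combined z r ℤ.* c
combined-* z c []      = refl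
combined-* z c (β ∷ r) = begin
  combined (λ p j → z (true ∷ p) j ℤ.* c) r ℤ.+
    signed β (combined (λ p j → z (false ∷ p) j ℤ.* c) r ℤ.+ hosted (λ j → z [] j ℤ.* c) r)
    ≡⟨ cong₂ (λ u v → u ℤ.+ signed β v) (combined-* (z ∘ (true ∷_)) c r)
         (cong₂ ℤ._+_ (combined-* (z ∘ (false ∷_)) c r) (hosted-* (z []) c r)) ⟩
  a ℤ.* c ℤ.+ signed β (b ℤ.* c ℤ.+ h ℤ.* c)
    ≡⟨ cong (λ v → a ℤ.* c ℤ.+ signed β v) (ℤ.*-distribʳ-+ c b h) ⟨
  a ℤ.* c ℤ.+ signed β ((b ℤ.+ h) ℤ.* c)     ≡⟨ cong (λ v → a ℤ.* c ℤ.+ v) (signed-* β (b ℤ.+ h) c) ⟩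
  a ℤ.* c ℤ.+ signed β (b ℤ.+ h) ℤ.* c       ≡⟨ ℤ.*-distribʳ-+ c a _ ⟨
  (a ℤ.+ signed β (b ℤ.+ h)) ℤ.* c           ∎
  where
  open ≡-Reasoning
  a = combined (z ∘ (true ∷_)) r
  b = combined (z ∘ (false ∷_)) r
  h = hosted (z []) r

hosted⁺ : (List Bool → ℕ) → List Bool → ℕ
hosted⁺ g []          = 0
hosted⁺ g (false ∷ j) = 0
hosted⁺ g (true  ∷ j) = g j

-- The recursion of `combined` without signs. Applied to the sizes of the hosted sets it bounds the
-- number of elements in a row; applied to the labels of one element it bounds the coefficient of
-- that element.
combined⁺ : (List Bool → List Bool → ℕ) → List Bool → ℕ
combined⁺ y []      = 0
combined⁺ y (β ∷ r) =
  combined⁺ (y ∘ (true ∷_)) r + (combined⁺ (y ∘ (false ∷_)) r + hosted⁺ (y []) r)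

hosted⁺-∑ : ∀ k (g : ℕ → List Bool → ℕ) r →
            hosted⁺ (λ j → ∑ k (λ x → g x j)) r ≡ ∑ k (λ x → hosted⁺ (g x) r)
hosted⁺-∑ k g []          = sym (∑-0 k)
hosted⁺-∑ k g (false ∷ r) = sym (∑-0 k)
hosted⁺-∑ k g (true  ∷ r) = refl

combined⁺-∑ : ∀ k (y : ℕ → List Bool → List Bool → ℕ) r →
              combined⁺ (λ p j → ∑ k (λ x → y x p j)) r ≡ ∑ k (λ x → combined⁺ (y x) r)
combined⁺-∑ k y []      = sym (∑-0 k)
combined⁺-∑ k y (β ∷ r) = begin
  combined⁺ (λ p j → ∑ k (λ x → y x (true ∷ p) j)) r +
    (combined⁺ (λ p j → ∑ k (λ x → y x (false ∷ p) j)) r + hosted⁺ (λ j → ∑ k (λ x → y x [] j)) r)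
    ≡⟨ cong₂ _+_ (combined⁺-∑ k (λ x → y x ∘ (true ∷_)) r)
         (cong₂ _+_ (combined⁺-∑ k (λ x → y x ∘ (false ∷_)) r) (hosted⁺-∑ k (λ x → y x []) r)) ⟩
  ∑ k (λ x → combined⁺ (y x ∘ (true ∷_)) r) +
    (∑ k (λ x → combined⁺ (y x ∘ (false ∷_)) r) + ∑ k (λ x → hosted⁺ (y x []) r))
    ≡⟨ cong (∑ k (λ x → combined⁺ (y x ∘ (true ∷_)) r) +_) (∑-+ k _ _) ⟨
  ∑ k (λ x → combined⁺ (y x ∘ (true ∷_)) r) +
    ∑ k (λ x → combined⁺ (y x ∘ (false ∷_)) r + hosted⁺ (y x []) r)
    ≡⟨ ∑-+ k _ _ ⟨
  ∑ k (λ x → combined⁺ (y x) (β ∷ r))   ∎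
  where open ≡-Reasoning

∣hosted∣≤ : ∀ (g : List Bool → ℕ) r → ℤ.∣ hosted (+ᶻ_ ∘ g) r ∣ ≤ hosted⁺ g r
∣hosted∣≤ g []          = z≤n
∣hosted∣≤ g (false ∷ r) = z≤n
∣hosted∣≤ g (true  ∷ r) = ≤-refl

∣combined∣≤ : ∀ (y : List Bool → List Bool → ℕ) r →
              ℤ.∣ combined (λ p j → +ᶻ y p j) r ∣ ≤ combined⁺ y r
∣combined∣≤ y []      = z≤n
∣combined∣≤ y (β ∷ r) = begin
  ℤ.∣ a ℤ.+ signed β (b ℤ.+ h) ∣          ≤⟨ ℤ.∣i+j∣≤∣i∣+∣j∣ a _ ⟩
  ℤ.∣ a ∣ + ℤ.∣ signed β (b ℤ.+ h) ∣      ≡⟨ cong (ℤ.∣ a ∣ +_) (∣signed∣ β (b ℤ.+ h)) ⟩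
  ℤ.∣ a ∣ + ℤ.∣ b ℤ.+ h ∣                 ≤⟨ +-mono-≤ (∣combined∣≤ _ r)
      (≤-trans (ℤ.∣i+j∣≤∣i∣+∣j∣ b h) (+-mono-≤ (∣combined∣≤ _ r) (∣hosted∣≤ (y []) r))) ⟩
  combined⁺ y (β ∷ r)                     ∎
  where
  open ≤-Reasoning
  a = combined (λ p j → +ᶻ y (true ∷ p) j) r
  b = combined (λ p j → +ᶻ y (false ∷ p) j) r
  h = hosted (λ j → +ᶻ y [] j) r

-- the profile of instance sizes c·4^(h∸1), …, 4·c, c by depth, for which rows stay small
profile : ℕ → ℕ → ℕ → ℕ
profile c zero    d       = 0
profile c (suc h) zero    = c * 4 ^ h
profile c (suc h) (suc d) = profile c h d

hosted⁺-≤ : ∀ {c} g r → (∀ j → g j ≤ c) → hosted⁺ g r ≤ c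
hosted⁺-≤ g []          le = z≤n
hosted⁺-≤ g (false ∷ r) le = z≤n
hosted⁺-≤ g (true  ∷ r) le = le r

combined⁺-zero : ∀ y r → (∀ p j → y p j ≤ 0) → combined⁺ y r ≤ 0
combined⁺-zero y []      le = z≤n
combined⁺-zero y (β ∷ r) le =
  +-mono-≤ (combined⁺-zero _ r (le ∘ (true ∷_)))
    (+-mono-≤ (combined⁺-zero _ r (le ∘ (false ∷_))) (hosted⁺-≤ (y []) r (le [])))

-- A row over one more depth consists of rows of two copies and one hosted set, so its size
-- satisfies S(h+1) ≤ 2·S(h) + c·4^h, which S(h) = c·4^h / 2 solves. Hosted sets that grow fourfold
-- towards the root outweigh the doubling of the copies.
combined⁺-≤ : ∀ c h y r → (∀ p j → y p j ≤ profile c h (length p)) →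
              2 * combined⁺ y r ≤ c * 4 ^ h
combined⁺-≤ c zero    y r       le = ≤-trans (*-monoʳ-≤ 2 (combined⁺-zero y r le)) z≤n
combined⁺-≤ c (suc h) y []      le = z≤n
combined⁺-≤ c (suc h) y (β ∷ r) le = begin
  2 * (A + (B + C))         ≡⟨ expand A B C ⟩
  2 * A + (2 * B + 2 * C)   ≤⟨ +-mono-≤ (combined⁺-≤ c h _ r (le ∘ (true ∷_)))
      (+-mono-≤ (combined⁺-≤ c h _ r (le ∘ (false ∷_))) (*-monoʳ-≤ 2 (hosted⁺-≤ (y []) r (le [])))) ⟩
  c * 4 ^ h + (c * 4 ^ h + 2 * (c * 4 ^ h)) ≡⟨ collect c (4 ^ h) ⟩
  c * (4 * 4 ^ h)           ∎
  where
  open ≤-Reasoning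
  A = combined⁺ (y ∘ (true ∷_)) r
  B = combined⁺ (y ∘ (false ∷_)) r
  C = hosted⁺ (y []) r
  expand : ∀ a b c → 2 * (a + (b + c)) ≡ 2 * a + (2 * b + 2 * c)
  expand = ℕ-Solver.solve-∀
  collect : ∀ c q → c * q + (c * q + 2 * (c * q)) ≡ c * (4 * q)
  collect = ℕ-Solver.solve-∀

-- A row meets each path in at most one hosted entry. Hence an element labelled on one path only has
-- coefficient -1, 0 or 1 in every row, however many entries of that path contain it.
SinglePath : (List Bool → List Bool → Bool) → Set
SinglePath u = ∀ {p j p′ j′} → u p j ≡ true → u p′ j′ ≡ true → p ≡ p′

hosted⁺-support : ∀ (u : List Bool → Bool) r →
                  hosted⁺ (bit ∘ u) r ≡ 0 ⊎ hosted⁺ (bit ∘ u) r ≡ 1 × ∃ λ j → u j ≡ true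
hosted⁺-support u []          = inj₁ refl
hosted⁺-support u (false ∷ j) = inj₁ refl
hosted⁺-support u (true  ∷ j) with u j in eq
... | true  = inj₂ (refl , j , eq)
... | false = inj₁ refl

combined⁺-support : ∀ u r → SinglePath u → combined⁺ (λ p j → bit (u p j)) r ≡ 0 ⊎
                    combined⁺ (λ p j → bit (u p j)) r ≡ 1 × ∃₂ λ p j → u p j ≡ true
combined⁺-support u []      single = inj₁ refl
combined⁺-support u (β ∷ r) single
  with combined⁺-support (u ∘ (true ∷_)) r (λ e e′ → ∷-injectiveʳ (single e e′))
     | combined⁺-support (u ∘ (false ∷_)) r (λ e e′ → ∷-injectiveʳ (single e e′))
     | hosted⁺-support (u []) r
... | inj₁ a | inj₁ b | inj₁ c rewrite a | b | c = inj₁ refl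
... | inj₁ a | inj₁ b | inj₂ (c , j , e) rewrite a | b | c = inj₂ (refl , [] , j , e)
... | inj₁ a | inj₂ (b , p , j , e) | inj₁ c rewrite a | b | c = inj₂ (refl , false ∷ p , j , e)
... | inj₂ (a , p , j , e) | inj₁ b | inj₁ c rewrite a | b | c = inj₂ (refl , true ∷ p , j , e)
... | inj₁ _ | inj₂ (_ , _ , _ , e) | inj₂ (_ , _ , e′) = case single e e′ of λ ()
... | inj₂ (_ , _ , _ , e) | inj₁ _ | inj₂ (_ , _ , e′) = case single e e′ of λ ()
... | inj₂ (_ , _ , _ , e) | inj₂ (_ , _ , _ , e′) | _ = case single e e′ of λ ()

combined⁺≤1 : ∀ u r → SinglePath u → combined⁺ (λ p j → bit (u p j)) r ≤ 1
combined⁺≤1 u r single with combined⁺-support u r single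
... | inj₁ eq       = ≤-trans (≤-reflexive eq) z≤n
... | inj₂ (eq , _) = ≤-reflexive eq

allBits : ℕ → List (List Bool)
allBits zero    = [] ∷ []
allBits (suc t) = map (true ∷_) (allBits t) ++ map (false ∷_) (allBits t)

length-allBits : ∀ t → length (allBits t) ≡ 2 ^ t
length-allBits zero    = refl
length-allBits (suc t) = begin
  length (map (true ∷_) (allBits t) ++ map (false ∷_) (allBits t))
    ≡⟨ length-++ (map (true ∷_) (allBits t)) ⟩
  length (map (true ∷_) (allBits t)) + length (map (false ∷_) (allBits t))
    ≡⟨ cong₂ _+_ (trans (length-map _ (allBits t)) (length-allBits t))
                 (trans (length-map _ (allBits t)) (length-allBits t)) ⟩
  2 ^ t + 2 ^ t ≡⟨ cong (2 ^ t +_) (+-identityʳ _) ⟨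
  2 ^ suc t ∎
  where open ≡-Reasoning

allBits-All : ∀ {P : List Bool → Set} t → All P (allBits t) → ∀ r → length r ≡ t → P r
allBits-All zero    (Pr ∷ []) [] eq = Pr
allBits-All (suc t) all (true  ∷ r) eq =
  allBits-All t (All.map⁻ (All.++⁻ˡ (map (true ∷_) (allBits t)) all)) r (suc-injective eq)
allBits-All (suc t) all (false ∷ r) eq =
  allBits-All t (All.map⁻ (All.++⁻ʳ (map (true ∷_) (allBits t)) all)) r (suc-injective eq)

-- From signed rows to pairs of queries

diff : ∀ {k} → Subset k → Subset k → ℕ → ℤ
diff f g x = +ᶻ bit (at f x) ℤ.- +ᶻ bit (at g x)

∑-diff : ∀ k (a b P : ℕ → Bool) →
         ∑ᶻ k (λ x → +ᶻ bit (P x) ℤ.* (+ᶻ bit (a x) ℤ.- +ᶻ bit (b x))) ≡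
         +ᶻ # k (λ x → a x ∧ P x) ℤ.- +ᶻ # k (λ x → b x ∧ P x)
∑-diff zero    a b P = refl
∑-diff (suc k) a b P rewrite ∑-diff k (a ∘ suc) (b ∘ suc) (P ∘ suc) =
  trans (cong₂ ℤ._+_ (head (a 0) (b 0) (P 0)) refl)
        (regroup (+ᶻ bit (a 0 ∧ P 0)) (+ᶻ bit (b 0 ∧ P 0))
                 (+ᶻ # k (λ x → a (suc x) ∧ P (suc x))) (+ᶻ # k (λ x → b (suc x) ∧ P (suc x))))
  where
  head : ∀ a b p → +ᶻ bit p ℤ.* (+ᶻ bit a ℤ.- +ᶻ bit b) ≡ +ᶻ bit (a ∧ p) ℤ.- +ᶻ bit (b ∧ p)
  head true  true  true  = refl
  head true  true  false = refl
  head true  false true  = refl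
  head true  false false = refl
  head false true  true  = refl
  head false true  false = refl
  head false false true  = refl
  head false false false = refl
  regroup : ∀ u v s t → (u ℤ.- v) ℤ.+ (s ℤ.- t) ≡ (u ℤ.+ s) ℤ.- (v ℤ.+ t)
  regroup = ℤ-Solver.solve-∀

module _ (k H : ℕ) (w : ℕ → List Bool → List Bool → Bool) where

  coefficient : ℕ → List Bool → ℤ
  coefficient x r = combined (λ p j → +ᶻ bit (w x p j)) r

  plus minus : List Bool → ℕ → Bool
  plus  r x = does (coefficient x r ℤ.≟ 1ℤ)
  minus r x = does (coefficient x r ℤ.≟ -1ℤ)

  -- The game has no signs, so a row is asked as two sets, the elements of coefficient 1 and those
  -- of coefficient -1.
  pass : List (ℕ → Bool)
  pass = map plus (allBits H) ++ map minus (allBits H)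

  length-pass : length pass ≡ 2 * 2 ^ H
  length-pass = begin
    length pass ≡⟨ length-++ (map plus (allBits H)) ⟩
    length (map plus (allBits H)) + length (map minus (allBits H))
      ≡⟨ cong₂ _+_ (trans (length-map _ (allBits H)) (length-allBits H))
                   (trans (length-map _ (allBits H)) (length-allBits H)) ⟩
    2 ^ H + 2 ^ H ≡⟨ cong (2 ^ H +_) (+-identityʳ _) ⟨
    2 * 2 ^ H ∎
    where open ≡-Reasoning

  bit-does : ∀ a b → b ≢ 0ℤ → bit (does (a ℤ.≟ b)) ≤ ℤ.∣ a ∣
  bit-does a b b≢0 with a ℤ.≟ b
  ... | no  _    = z≤n
  ... | yes refl = n≢0⇒n>0 (b≢0 ∘ ℤ.∣i∣≡0⇒i≡0)

  pass-sizes : ∀ c h {n} → (∀ p j → # k (λ x → w x p j) ≤ profile c h (length p)) →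
               c * 4 ^ h ≤ 2 * n → All (λ P → # k P ≤ n) pass
  pass-sizes c h {n} le bound =
    All.++⁺ (All.map⁺ (All.universal (λ r → size r 1ℤ (λ ())) (allBits H)))
            (All.map⁺ (All.universal (λ r → size r -1ℤ (λ ())) (allBits H)))
    where
    size : ∀ r b → b ≢ 0ℤ → # k (λ x → does (coefficient x r ℤ.≟ b)) ≤ n
    size r b b≢0 = *-cancelˡ-≤ 2 (begin
      2 * # k (λ x → does (coefficient x r ℤ.≟ b))
        ≤⟨ *-monoʳ-≤ 2 (∑-mono k (λ x _ → ≤-trans (bit-does (coefficient x r) b b≢0)
                                                   (∣combined∣≤ (λ p j → bit (w x p j)) r))) ⟩
      2 * ∑ k (λ x → combined⁺ (λ p j → bit (w x p j)) r)
        ≡⟨ cong (2 *_) (combined⁺-∑ k (λ x p j → bit (w x p j)) r) ⟨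
      2 * combined⁺ (λ p j → # k (λ x → w x p j)) r
        ≤⟨ combined⁺-≤ c h _ r le ⟩
      c * 4 ^ h ≤⟨ bound ⟩
      2 * n ∎)
      where open ≤-Reasoning

  content : Subset k → Subset k → Content
  content f g p j = ∑ᶻ k (λ x → +ᶻ bit (w x p j) ℤ.* diff f g x)

  coefficient-signs : (∀ x → SinglePath (w x)) → ∀ x r →
                      coefficient x r ≡ +ᶻ bit (plus r x) ℤ.- +ᶻ bit (minus r x)
  coefficient-signs single x r
    with coefficient x r | ≤-trans (∣combined∣≤ (λ p j → bit (w x p j)) r) (combined⁺≤1 (w x) r (single x))
  ... | +ᶻ 0          | _ = refl
  ... | +ᶻ 1          | _ = refl
  ... | -[1+ 0 ]     | _ = refl
  ... | +ᶻ suc (suc _) | s≤s ()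
  ... | -[1+ suc _ ] | s≤s ()

  -- By linearity the rows of the difference of `f` and `g` vanish, so the scheme can be decoded
  -- with no perturbation at the root.
  pass-determines : (∀ x → SinglePath (w x)) → ∀ {f g} → Same pass f g → Hosts H (content f g) →
                    ∀ p j → length p + (2 + length j) ≡ H → content f g p j ≡ 0ℤ
  pass-determines single {f} {g} same hosts = proj₂ (combined-injective H (content f g) (λ _ → 0ℤ)
    (λ r eq → trans (ℤ.+-identityʳ _) (vanish r eq)) (λ r _ → m^n>0 2 (lead r)) hosts)
    where
    balanced : ∀ {P} → hits f P ≡ hits g P → ∑ᶻ k (λ x → +ᶻ bit (P x) ℤ.* diff f g x) ≡ 0ℤ
    balanced {P} eq = trans (∑-diff k (at f) (at g) P)
      (trans (cong (λ v → +ᶻ v ℤ.- +ᶻ hits g P) eq) (ℤ.+-inverseʳ (+ᶻ hits g P)))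
    vanish : ∀ r → length r ≡ H → combined (content f g) r ≡ 0ℤ
    vanish r eq = begin
      combined (content f g) r
        ≡⟨ combined-∑ᶻ k (λ x p j → +ᶻ bit (w x p j) ℤ.* diff f g x) r ⟩
      ∑ᶻ k (λ x → combined (λ p j → +ᶻ bit (w x p j) ℤ.* diff f g x) r)
        ≡⟨ ∑ᶻ-cong k (λ x _ → trans (combined-* (λ p j → +ᶻ bit (w x p j)) (diff f g x) r)
             (trans (cong (ℤ._* diff f g x) (coefficient-signs single x r))
               (ℤ.*-distribʳ-+ (diff f g x) (+ᶻ bit (plus r x)) (ℤ.- +ᶻ bit (minus r x))))) ⟩
      ∑ᶻ k (λ x → +ᶻ bit (plus r x) ℤ.* diff f g x ℤ.+ ℤ.- +ᶻ bit (minus r x) ℤ.* diff f g x)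
        ≡⟨ ∑ᶻ-+ k _ _ ⟩
      ∑ᶻ k (λ x → +ᶻ bit (plus r x) ℤ.* diff f g x) ℤ.+ ∑ᶻ k (λ x → ℤ.- +ᶻ bit (minus r x) ℤ.* diff f g x)
        ≡⟨ cong₂ ℤ._+_ (balanced {plus r} (allBits-All H (All.map⁻ (All.++⁻ˡ (map plus (allBits H)) same)) r eq))
             (trans (∑ᶻ-cong k (λ x _ → sym (ℤ.neg-distribˡ-* (+ᶻ bit (minus r x)) (diff f g x))))
               (trans (∑ᶻ-neg k _)
                 (cong ℤ.-_ (balanced {minus r} (allBits-All H (All.map⁻ (All.++⁻ʳ (map plus (allBits H)) same)) r eq))))) ⟩
      0ℤ ∎
      where open ≡-Reasoning

does⇒ : ∀ {P : Set} (P? : Dec P) → does P? ≡ true → P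
does⇒ (yes p) refl = p

≡true-ext : ∀ {a b} → (a ≡ true → b ≡ true) → (b ≡ true → a ≡ true) → a ≡ b
≡true-ext {true}  {b}     to from = sym (to refl)
≡true-ext {false} {true}  to from = from refl
≡true-ext {false} {false} to from = refl

#-false : ∀ k {P} → (∀ x → x < k → P x ≡ false) → # k P ≡ 0
#-false k eq = trans (∑-cong k (λ x x<k → cong bit (eq x x<k))) (∑-0 k)

bit-∧-≤ : ∀ a b → bit (a ∧ b) ≤ bit a
bit-∧-≤ true  true  = ≤-refl
bit-∧-≤ true  false = z≤n
bit-∧-≤ false b     = z≤n

-- Counting below a bound

prefix : ∀ {k} → Subset k → ℕ → ℕ
prefix {k} f b = hits f (λ x → x <ᵇ b)

<ᵇ-true : ∀ {x b} → x < b → (x <ᵇ b) ≡ true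
<ᵇ-true {x} {b} = dec-true (x <? b)

<ᵇ-false : ∀ {x b} → b ≤ x → (x <ᵇ b) ≡ false
<ᵇ-false {x} {b} = dec-false (x <? b) ∘ ≤⇒≯

<ᵇ-mono : ∀ x {b b′} → b ≤ b′ → bit (x <ᵇ b) ≤ bit (x <ᵇ b′)
<ᵇ-mono x {b} {b′} b≤b′ with x <? b
... | yes x<b rewrite <ᵇ-true x<b | <ᵇ-true (<-≤-trans x<b b≤b′) = ≤-refl
... | no  x≮b rewrite <ᵇ-false (≮⇒≥ x≮b) = z≤n

bit-∧-mono : ∀ a {b c} → bit b ≤ bit c → bit (a ∧ b) ≤ bit (a ∧ c)
bit-∧-mono true  le = le
bit-∧-mono false le = z≤n

module _ {k : ℕ} (f : Subset k) where

  prefix-mono : ∀ {b b′} → b ≤ b′ → prefix f b ≤ prefix f b′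
  prefix-mono b≤b′ = ∑-mono k (λ x _ → bit-∧-mono (at f x) (<ᵇ-mono x b≤b′))

  hits≤∣f∣ : ∀ P → hits f P ≤ ∣ f ∣
  hits≤∣f∣ P = ≤-trans (∑-mono k (λ x _ → bit-∧-≤ (at f x) (P x))) (≤-reflexive (sym (∣f∣≡#at f)))

  prefix-full : ∀ {b} → k ≤ b → prefix f b ≡ # k (at f)
  prefix-full k≤b = ∑-cong k (λ x x<k → cong bit
    (trans (cong (at f x ∧_) (<ᵇ-true (<-≤-trans x<k k≤b))) (Bool.∧-identityʳ (at f x))))

-- An identity of indicator functions, so that summation over `x` yields both the hits in terms of
-- prefix counts and the bound on the size.
Interval : ℕ → (ℕ → Bool) → ℕ → ℕ → Set
Interval k P l r = ∀ x → x < k → bit (P x) + bit (x <ᵇ l) ≡ bit (x <ᵇ r)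

interval : ∀ k P {l r} → l ≤ r → (∀ x → x < k → P x ≡ true → l ≤ x × x < r) →
           (∀ x → x < k → l ≤ x → x < r → P x ≡ true) → Interval k P l r
interval k P {l} {r} l≤r to from x x<k with x <? l
... | yes x<l rewrite <ᵇ-true x<l | <ᵇ-true (<-≤-trans x<l l≤r) with P x in eq
...   | true  = ⊥-elim (<⇒≱ x<l (proj₁ (to x x<k eq)))
...   | false = refl
interval k P {l} {r} l≤r to from x x<k | no x≮l with x <? r
... | yes x<r rewrite <ᵇ-false (≮⇒≥ x≮l) | <ᵇ-true x<r | from x x<k (≮⇒≥ x≮l) x<r = refl
... | no  x≮r rewrite <ᵇ-false (≮⇒≥ x≮l) | <ᵇ-false (≮⇒≥ x≮r) with P x in eq
...   | true  = ⊥-elim (x≮r (proj₂ (to x x<k eq)))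
...   | false = refl

hits-interval : ∀ {k} (f : Subset k) P {l r} → Interval k P l r →
                hits f P + prefix f l ≡ prefix f r
hits-interval {k} f P {l} {r} int =
  trans (sym (∑-+ k _ _)) (∑-cong k (λ x x<k → split (at f x) (P x) (x <ᵇ l) (x <ᵇ r) (int x x<k)))
  where
  split : ∀ a p s t → bit p + bit s ≡ bit t → bit (a ∧ p) + bit (a ∧ s) ≡ bit (a ∧ t)
  split true  p s t eq = eq
  split false p s t eq = refl

#<ᵇ-≤ : ∀ k b → # k (λ x → x <ᵇ b) ≤ b
#<ᵇ-≤ zero    b       = z≤n
#<ᵇ-≤ (suc k) zero    = ≤-reflexive (∑-0 k)
#<ᵇ-≤ (suc k) (suc b) = s≤s (#<ᵇ-≤ k b)

#<ᵇ-+ : ∀ k l M → # k (λ x → x <ᵇ (M + l)) ≤ M + # k (λ x → x <ᵇ l)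
#<ᵇ-+ zero    l       M = z≤n
#<ᵇ-+ (suc k) zero    M rewrite +-identityʳ M | ∑-0 k | +-identityʳ M = #<ᵇ-≤ (suc k) M
#<ᵇ-+ (suc k) (suc l) M rewrite +-suc M l | +-suc M (# k (λ x → x <ᵇ l)) = s≤s (#<ᵇ-+ k l M)

#-interval : ∀ k P {l} M → Interval k P l (M + l) → # k P ≤ M
#-interval k P {l} M int = +-cancelʳ-≤ (# k (λ x → x <ᵇ l)) _ _ (begin
  # k P + # k (λ x → x <ᵇ l)  ≡⟨ ∑-+ k _ _ ⟨
  ∑ k (λ x → bit (P x) + bit (x <ᵇ l)) ≡⟨ ∑-cong k int ⟩
  # k (λ x → x <ᵇ (M + l))    ≤⟨ #<ᵇ-+ k l M ⟩
  M + # k (λ x → x <ᵇ l)      ∎)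
  where open ≤-Reasoning

module _ (M : ℕ) .{{_ : NonZero M}} where

  block-bounds : ∀ {x y} → x / M ≡ y → y * M ≤ x × x < M + y * M
  block-bounds {x} refl = m/n*n≤m x M ,
    subst (_< M + x / M * M) (sym (m≡m%n+[m/n]*n x M)) (+-monoˡ-< (x / M * M) (m%n<n x M))

  x/M≡y : ∀ {x y} → y * M ≤ x → x < M + y * M → x / M ≡ y
  x/M≡y {x} {y} lo hi = ≤-antisym
    (s≤s⁻¹ (m<n*o⇒m/o<n hi))
    (≤-trans (≤-reflexive (sym (m*n/n≡m y M))) (/-monoˡ-≤ M lo))

  block : ℕ → ℕ → Bool
  block y x = does (x / M ≟ y)

  block-interval : ∀ k y → Interval k (block y) (y * M) (M + y * M)
  block-interval k y = interval k (block y) (m≤n+m _ M)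
    (λ x _ eq → block-bounds (does⇒ (x / M ≟ y) eq))
    (λ x _ lo hi → dec-true (x / M ≟ y) (x/M≡y lo hi))

  #block≤ : ∀ k y → # k (block y) ≤ M
  #block≤ k y = #-interval k (block y) {y * M} M (block-interval k y)

  hits-block : ∀ {k} (f : Subset k) y → hits f (block y) + prefix f (y * M) ≡ prefix f (M + y * M)
  hits-block {k} f y = hits-interval f (block y) {y * M} {M + y * M} (block-interval k y)

  prefix-+ : ∀ {k} (f : Subset k) y → prefix f (M + y * M) ≤ M + prefix f (y * M)
  prefix-+ {k} f y = ≤-trans (≤-reflexive (sym (hits-block f y)))
    (+-monoˡ-≤ _ (≤-trans (∑-mono k (λ x _ → subst (λ b → bit b ≤ bit (block y x)) (Bool.∧-comm (block y x) (at f x)) (bit-∧-≤ (block y x) (at f x))))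
                           (#block≤ k y)))

  blockCount : ℕ → ℕ
  blockCount k = suc (k / M)

  blockQueries : ℕ → List (ℕ → Bool)
  blockQueries k = applyUpTo block (blockCount k)

  k≤blockCount*M : ∀ k → k ≤ blockCount k * M
  k≤blockCount*M k = <⇒≤ (proj₂ (block-bounds {k} refl))

  blockQueries-determine : ∀ {k} {f g : Subset k} → Same (blockQueries k) f g →
                           ∀ v → prefix f (v * M) ≡ prefix g (v * M)
  blockQueries-determine {k} {f} {g} same v = [ below v , above v ]′ (≤-total v N)
    where
    N = blockCount k
    each : ∀ {i} → i < N → hits f (block i) ≡ hits g (block i)
    each = All.applyUpTo⁻ block N same
    below : ∀ v → v ≤ N → prefix f (v * M) ≡ prefix g (v * M)
    below zero    v≤N = trans (#-false k (λ x _ → Bool.∧-zeroʳ (at f x)))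
                              (sym (#-false k (λ x _ → Bool.∧-zeroʳ (at g x))))
    below (suc v) v<N = trans (sym (hits-block f v))
      (trans (cong₂ _+_ (each v<N) (below v (<⇒≤ v<N))) (hits-block g v))
    above : ∀ v → N ≤ v → prefix f (v * M) ≡ prefix g (v * M)
    above v N≤v = begin
      prefix f (v * M)  ≡⟨ prefix-full f (≤-trans (k≤blockCount*M k) (*-monoˡ-≤ M N≤v)) ⟩
      # k (at f)        ≡⟨ prefix-full f (k≤blockCount*M k) ⟨
      prefix f (N * M)  ≡⟨ below N ≤-refl ⟩
      prefix g (N * M)  ≡⟨ prefix-full g (k≤blockCount*M k) ⟩
      # k (at g)        ≡⟨ prefix-full g (≤-trans (k≤blockCount*M k) (*-monoˡ-≤ M N≤v)) ⟨
      prefix g (v * M)  ∎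
      where open ≡-Reasoning

-- Parity families

∑ₛ : ∀ k → (Subset k → ℕ) → ℕ
∑ₛ zero    ω = ω []
∑ₛ (suc k) ω = ∑ₛ k (ω ∘ (false ∷_)) + ∑ₛ k (ω ∘ (true ∷_))

∑ₛ-mono : ∀ k {ω ω′ : Subset k → ℕ} → (∀ z → ω z ≤ ω′ z) → ∑ₛ k ω ≤ ∑ₛ k ω′
∑ₛ-mono zero    le = le []
∑ₛ-mono (suc k) le = +-mono-≤ (∑ₛ-mono k (le ∘ (false ∷_))) (∑ₛ-mono k (le ∘ (true ∷_)))

∑ₛ-* : ∀ k c (ω : Subset k → ℕ) → ∑ₛ k (λ z → c * ω z) ≡ c * ∑ₛ k ω
∑ₛ-* zero    c ω = refl
∑ₛ-* (suc k) c ω = trans (cong₂ _+_ (∑ₛ-* k c (ω ∘ (false ∷_))) (∑ₛ-* k c (ω ∘ (true ∷_))))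
                         (sym (*-distribˡ-+ c _ _))

term≤∑ₛ : ∀ k (ω : Subset k → ℕ) z → ω z ≤ ∑ₛ k ω
term≤∑ₛ zero    ω []          = ≤-refl
term≤∑ₛ (suc k) ω (false ∷ z) = ≤-trans (term≤∑ₛ k (ω ∘ (false ∷_)) z) (m≤m+n _ _)
term≤∑ₛ (suc k) ω (true  ∷ z) = ≤-trans (term≤∑ₛ k (ω ∘ (true ∷_)) z) (m≤n+m _ _)

parityₛ : ∀ {k} → Subset k → (ℕ → Bool) → Bool
parityₛ []      Y = false
parityₛ (b ∷ z) Y = (b ∧ Y 0) xor parityₛ z (Y ∘ suc)

none : ∀ k → Subset k
none zero    = []
none (suc k) = false ∷ none k

parity-none : ∀ k Y → parityₛ (none k) Y ≡ false
parity-none zero    Y = refl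
parity-none (suc k) Y = parity-none k (Y ∘ suc)

prepend : Bool → (ℕ → Bool) → ℕ → Bool
prepend y Y zero    = y
prepend y Y (suc x) = Y x

∑ₛ-split : ∀ k (b : Subset k → Bool) (ω : Subset k → ℕ) →
           ∑ₛ k (λ z → if b z then 0 else ω z) + ∑ₛ k (λ z → if not (b z) then 0 else ω z) ≡ ∑ₛ k ω
∑ₛ-split zero b ω with b []
... | true  = refl
... | false = +-identityʳ _
∑ₛ-split (suc k) b ω = trans (interchange (∑ₛ k (λ z → if b (false ∷ z) then 0 else ω (false ∷ z))) _ _ _)
  (cong₂ _+_ (∑ₛ-split k (b ∘ (false ∷_)) (ω ∘ (false ∷_))) (∑ₛ-split k (b ∘ (true ∷_)) (ω ∘ (true ∷_))))
  where
  interchange : ∀ a b c d → a + b + (c + d) ≡ a + c + (b + d)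
  interchange = ℕ-Solver.solve-∀

-- The set is chosen coordinate by coordinate. Putting the new coordinate into `Y` flips the parity
-- of exactly those `z` that contain it, so one of the two choices leaves at most half of their
-- weight undetected; the other `z` are covered by the recursive choice. At the end only the empty
-- set remains, which has weight 0.
halving : ∀ k (ω : Subset k → ℕ) → ω (none k) ≡ 0 →
          ∃ λ Y → 2 * ∑ₛ k (λ z → if parityₛ z Y then 0 else ω z) ≤ ∑ₛ k ω
halving zero    ω ω∅ = (λ _ → false) , ≤-trans (≤-reflexive (cong (2 *_) ω∅)) z≤n
halving (suc k) ω ω∅ with halving k (ω ∘ (false ∷_)) ω∅
... | Y , le = [ (λ s≤s′ → prepend false Y , subst (2 * (a + s) ≤_) (cong (c +_) split) (step s s′ s≤s′))
               , (λ s′≤s → prepend true Y , subst (2 * (a + s′) ≤_)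
                                     (cong (c +_) (trans (+-comm s′ s) split)) (step s′ s s′≤s))
               ]′ (≤-total s s′)
  where
  a  = ∑ₛ k (λ z → if parityₛ z Y then 0 else ω (false ∷ z))
  c  = ∑ₛ k (ω ∘ (false ∷_))
  s  = ∑ₛ k (λ z → if parityₛ z Y then 0 else ω (true ∷ z))
  s′ = ∑ₛ k (λ z → if not (parityₛ z Y) then 0 else ω (true ∷ z))
  split : s + s′ ≡ ∑ₛ k (ω ∘ (true ∷_))
  split = ∑ₛ-split k (λ z → parityₛ z Y) (ω ∘ (true ∷_))
  step : ∀ u v → u ≤ v → 2 * (a + u) ≤ c + (u + v)
  step u v u≤v = ≤-trans (≤-reflexive (*-distribˡ-+ 2 a u))
    (+-mono-≤ le (+-monoʳ-≤ u (≤-trans (≤-reflexive (+-identityʳ u)) u≤v)))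

AllEven : ∀ {k} → ℕ → (List Bool → ℕ → Bool) → Subset k → Set
AllEven μ Y z = ∀ y → length y ≡ μ → parityₛ z (Y y) ≡ false

select : (List Bool → ℕ → Bool) → (List Bool → ℕ → Bool) → List Bool → ℕ → Bool
select Y₁ Y₂ []          = λ _ → false
select Y₁ Y₂ (true  ∷ y) = Y₁ y
select Y₁ Y₂ (false ∷ y) = Y₂ y

-- The second recursive call halves what the first leaves undetected, so the 2^μ tests divide the
-- weight by 2^(2^μ). Bit strings serve as indices because the end of a row will address a test.
parityFamily : ∀ {k} μ (ω : Subset k → ℕ) → ω (none k) ≡ 0 →
  ∃ λ Y → ∃ λ (ω′ : Subset k → ℕ) → ω′ (none k) ≡ 0 ×
    (∀ z → AllEven μ Y z → ω′ z ≡ ω z) × 2 ^ 2 ^ μ * ∑ₛ k ω′ ≤ ∑ₛ k ω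
parityFamily {k} zero ω ω∅ with halving k ω ω∅
... | Y , le = (λ _ → Y) , ω′ , ω′∅ ,
      (λ z even → cong (λ b → if b then 0 else ω z) (even [] refl)) , le
  where
  ω′ : Subset k → ℕ
  ω′ z = if parityₛ z Y then 0 else ω z
  ω′∅ : ω′ (none k) ≡ 0
  ω′∅ rewrite parity-none k Y = ω∅
parityFamily {k} (suc μ) ω ω∅ with parityFamily μ ω ω∅
... | Y₁ , ω₁ , ω₁∅ , eq₁ , le₁ with parityFamily μ ω₁ ω₁∅
... | Y₂ , ω₂ , ω₂∅ , eq₂ , le₂ = select Y₁ Y₂ , ω₂ , ω₂∅ ,
  (λ z even → trans (eq₂ z (λ y eq → even (false ∷ y) (cong suc eq)))
                    (eq₁ z (λ y eq → even (true ∷ y) (cong suc eq)))) ,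
  (begin
    2 ^ (2 ^ μ + (2 ^ μ + 0)) * ∑ₛ k ω₂  ≡⟨ cong (λ e → 2 ^ (2 ^ μ + e) * ∑ₛ k ω₂) (+-identityʳ (2 ^ μ)) ⟩
    2 ^ (2 ^ μ + 2 ^ μ) * ∑ₛ k ω₂        ≡⟨ cong (_* ∑ₛ k ω₂) (^-distribˡ-+-* 2 (2 ^ μ) (2 ^ μ)) ⟩
    Q * Q * ∑ₛ k ω₂                      ≡⟨ *-assoc Q Q (∑ₛ k ω₂) ⟩
    Q * (Q * ∑ₛ k ω₂)                    ≤⟨ *-monoʳ-≤ Q le₂ ⟩
    Q * ∑ₛ k ω₁                          ≤⟨ le₁ ⟩
    ∑ₛ k ω                               ∎)
  where
  open ≤-Reasoning
  Q = 2 ^ 2 ^ μ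

factor : ℕ → Bool → Bool → ℕ
factor m true  false = m
factor m true  true  = 1
factor m false false = 1
factor m false true  = 0

-- m^(#R ∸ ∣z∣) for z inside the region R and 0 otherwise
weight : ∀ {k} → ℕ → (ℕ → Bool) → Subset k → ℕ
weight m R []      = 1
weight m R (b ∷ z) = factor m (R 0) b * weight m (R ∘ suc) z

∑-weight : ∀ k m R → ∑ₛ k (weight m R) ≡ suc m ^ # k R
∑-weight zero    m R = refl
∑-weight (suc k) m R = trans (cong₂ _+_ (∑ₛ-* k (factor m (R 0) false) _) (∑ₛ-* k (factor m (R 0) true) _))
  (trans (cong (λ s → factor m (R 0) false * s + factor m (R 0) true * s) (∑-weight k m (R ∘ suc)))
         (both (R 0)))
  where
  s = suc m ^ # k (R ∘ suc)
  both : ∀ b → factor m b false * s + factor m b true * s ≡ suc m ^ (bit b + # k (R ∘ suc))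
  both true  = trans (cong (m * s +_) (+-identityʳ s)) (+-comm (m * s) s)
  both false = trans (+-identityʳ _) (+-identityʳ s)

weight-∣z∣ : ∀ {k} m R (z : Subset k) → (∀ x → x < k → at z x ≡ true → R x ≡ true) →
             weight m R z * m ^ # k (at z) ≡ m ^ # k R
weight-∣z∣ m R []      sub = refl
weight-∣z∣ {suc k} m R (b ∷ z) sub =
  trans (both b (R 0) (sub 0 (s≤s z≤n)))
        (trans (cong (m ^ bit (R 0) *_) (weight-∣z∣ m (R ∘ suc) z (λ x x<k → sub (suc x) (s≤s x<k))))
               (sym (^-distribˡ-+-* m (bit (R 0)) (# k (R ∘ suc)))))
  where
  w = weight m (R ∘ suc) z
  e = m ^ # k (at z)
  both : ∀ b r → (b ≡ true → r ≡ true) →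
         factor m r b * w * m ^ (bit b + # k (at z)) ≡ m ^ bit r * (w * e)
  both true true _ = rearrange m w e
    where
    rearrange : ∀ m w e → 1 * w * (m * e) ≡ m * 1 * (w * e)
    rearrange = ℕ-Solver.solve-∀
  both false true _ = rearrange m w e
    where
    rearrange : ∀ m w e → m * w * e ≡ m * 1 * (w * e)
    rearrange = ℕ-Solver.solve-∀
  both false false _ = rearrange w e
    where
    rearrange : ∀ w e → 1 * w * e ≡ 1 * (w * e)
    rearrange = ℕ-Solver.solve-∀
  both true false b⇒r = case b⇒r refl of λ ()

isNone? : ∀ {k} (z : Subset k) → Dec (z ≡ none k)
isNone? z = z ≟ˢ none _

module _ {k : ℕ} (m : ℕ) (R : ℕ → Bool) where

  weight⁺ : Subset k → ℕ
  weight⁺ z = if does (isNone? z) then 0 else weight m R z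

  weight⁺-none : weight⁺ (none k) ≡ 0
  weight⁺-none rewrite dec-true (isNone? (none k)) refl = refl

  weight⁺≤ : ∀ z → weight⁺ z ≤ weight m R z
  weight⁺≤ z with does (isNone? z)
  ... | true  = z≤n
  ... | false = ≤-refl

  weight⁺≡ : ∀ z → ¬ z ≡ none k → weight⁺ z ≡ weight m R z
  weight⁺≡ z ne rewrite dec-false (isNone? z) ne = refl

  tests : ℕ → List Bool → ℕ → Bool
  tests μ = proj₁ (parityFamily μ weight⁺ weight⁺-none)

  -- A nonempty z all of whose tests are even has weight at most the 2^(2^μ)-th part of the total.
  tests-separate : ∀ μ c → .{{_ : NonZero m}} → suc m ^ # k R * m ^ c < 2 ^ 2 ^ μ * m ^ # k R →
                   ∀ z → (∀ x → x < k → at z x ≡ true → R x ≡ true) → # k (at z) ≤ c →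
                   AllEven μ (tests μ) z → z ≡ none k
  tests-separate μ c bound z sub ∣z∣≤c even = decidable-stable (isNone? z) (λ ne → <⇒≱ bound (begin
    Q * m ^ # k R                          ≡⟨ cong (Q *_) (weight-∣z∣ m R z sub) ⟨
    Q * (weight m R z * m ^ # k (at z))    ≤⟨ *-monoʳ-≤ Q (*-monoʳ-≤ (weight m R z) (^-monoʳ-≤ m ∣z∣≤c)) ⟩
    Q * (weight m R z * m ^ c)             ≡⟨ *-assoc Q _ _ ⟨
    Q * weight m R z * m ^ c               ≤⟨ *-monoˡ-≤ (m ^ c) (begin
      Q * weight m R z                       ≡⟨ cong (Q *_) (trans (proj₁ (proj₂ (proj₂ (proj₂ fam))) z even) (weight⁺≡ z ne)) ⟨
      Q * ω′ z                               ≤⟨ *-monoʳ-≤ Q (term≤∑ₛ k ω′ z) ⟩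
      Q * ∑ₛ k ω′                            ≤⟨ proj₂ (proj₂ (proj₂ (proj₂ fam))) ⟩
      ∑ₛ k weight⁺                           ≤⟨ ∑ₛ-mono k weight⁺≤ ⟩
      ∑ₛ k (weight m R)                      ≡⟨ ∑-weight k m R ⟩
      suc m ^ # k R                          ∎) ⟩
    suc m ^ # k R * m ^ c                  ∎))
    where
    open ≤-Reasoning
    Q = 2 ^ 2 ^ μ
    fam = parityFamily μ weight⁺ weight⁺-none
    ω′ = proj₁ (proj₂ fam)

-- Differences of candidates modulo 2

at-subset : ∀ k P x → x < k → at (subset k P) x ≡ P x
at-subset (suc k) P zero    x<k       = refl
at-subset (suc k) P (suc x) (s≤s x<k) = at-subset k (P ∘ suc) x x<k

at-none : ∀ k x → at (none k) x ≡ false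
at-none zero    x       = refl
at-none (suc k) zero    = refl
at-none (suc k) (suc x) = at-none k x

-- Signs do not matter modulo 2, so the signed sum has the parity of the intersection of `Y` with
-- the symmetric difference of the two sets inside `R`.
∑-diff-parity : ∀ k (a b R Y : ℕ → Bool) → ∃ λ c →
  ∑ᶻ k (λ x → +ᶻ bit (R x ∧ Y x) ℤ.* (+ᶻ bit (a x) ℤ.- +ᶻ bit (b x))) ≡
  +ᶻ bit (parityₛ (subset k (λ x → (a x xor b x) ∧ R x)) Y) ℤ.+ (c ℤ.+ c)
∑-diff-parity zero    a b R Y = 0ℤ , refl
∑-diff-parity (suc k) a b R Y
  with ∑-diff-parity k (a ∘ suc) (b ∘ suc) (R ∘ suc) (Y ∘ suc)
     | term (a 0) (b 0) (R 0) (Y 0)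
  where
  term : ∀ a b r y → ∃ λ c → +ᶻ bit (r ∧ y) ℤ.* (+ᶻ bit a ℤ.- +ᶻ bit b) ≡
         +ᶻ bit (((a xor b) ∧ r) ∧ y) ℤ.+ (c ℤ.+ c)
  term true  true  true  true  = 0ℤ , refl
  term true  false true  true  = 0ℤ , refl
  term false true  true  true  = -1ℤ , refl
  term false false true  true  = 0ℤ , refl
  term true  true  true  false = 0ℤ , refl
  term true  false true  false = 0ℤ , refl
  term false true  true  false = 0ℤ , refl
  term false false true  false = 0ℤ , refl
  term true  true  false y     = 0ℤ , refl
  term true  false false y     = 0ℤ , refl
  term false true  false y     = 0ℤ , refl
  term false false false y     = 0ℤ , refl
... | c , eq | c₀ , eq₀ with xor-sum (((a 0 xor b 0) ∧ R 0) ∧ Y 0) (parityₛ (subset k (λ x → (a (suc x) xor b (suc x)) ∧ R (suc x))) (Y ∘ suc))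
  where
  xor-sum : ∀ u v → ∃ λ c → +ᶻ bit u ℤ.+ +ᶻ bit v ≡ +ᶻ bit (u xor v) ℤ.+ (c ℤ.+ c)
  xor-sum true  true  = 1ℤ , refl
  xor-sum true  false = 0ℤ , refl
  xor-sum false true  = 0ℤ , refl
  xor-sum false false = 0ℤ , refl
... | d , eq′ = d ℤ.+ (c₀ ℤ.+ c) , trans (cong₂ ℤ._+_ eq₀ eq)
    (trans (gather u c₀ v c)
    (trans (cong (λ s → s ℤ.+ ((c₀ ℤ.+ c) ℤ.+ (c₀ ℤ.+ c))) eq′)
           (regroup (+ᶻ bit (parityₛ (subset (suc k) (λ x → (a x xor b x) ∧ R x)) Y)) d (c₀ ℤ.+ c))))
  where
  u = +ᶻ bit (((a 0 xor b 0) ∧ R 0) ∧ Y 0)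
  v = +ᶻ bit (parityₛ (subset k (λ x → (a (suc x) xor b (suc x)) ∧ R (suc x))) (Y ∘ suc))
  gather : ∀ u c v d → (u ℤ.+ (c ℤ.+ c)) ℤ.+ (v ℤ.+ (d ℤ.+ d)) ≡ (u ℤ.+ v) ℤ.+ ((c ℤ.+ d) ℤ.+ (c ℤ.+ d))
  gather = ℤ-Solver.solve-∀
  regroup : ∀ s d e → (s ℤ.+ (d ℤ.+ d)) ℤ.+ (e ℤ.+ e) ≡ s ℤ.+ ((d ℤ.+ e) ℤ.+ (d ℤ.+ e))
  regroup = ℤ-Solver.solve-∀

1-not-even : ∀ b → ¬ 1ℤ ≡ b ℤ.+ b
1-not-even b eq = 1≢2* ℤ.∣ b ∣ (trans (cong ℤ.∣_∣ eq) (∣a+a∣≡2∣a∣ b))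
  where
  1≢2* : ∀ n → ¬ 1 ≡ 2 * n
  1≢2* (suc n) eq = case trans eq (cong suc (+-suc n (n + 0))) of λ ()

even⇒false : ∀ b c → Even (+ᶻ bit b ℤ.+ (c ℤ.+ c)) → b ≡ false
even⇒false false c _        = refl
even⇒false true  c (e , eq) = ⊥-elim (1-not-even (e ℤ.- c) (begin
  1ℤ                                   ≡⟨ drop-even 1ℤ c ⟩
  1ℤ ℤ.+ (c ℤ.+ c) ℤ.- (c ℤ.+ c)       ≡⟨ cong (λ s → s ℤ.- (c ℤ.+ c)) eq ⟩
  e ℤ.+ e ℤ.- (c ℤ.+ c)                ≡⟨ regroup e c ⟩
  (e ℤ.- c) ℤ.+ (e ℤ.- c)              ∎))
  where
  open ≡-Reasoning
  drop-even : ∀ a c → a ≡ a ℤ.+ (c ℤ.+ c) ℤ.- (c ℤ.+ c)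
  drop-even = ℤ-Solver.solve-∀
  regroup : ∀ e c → e ℤ.+ e ℤ.- (c ℤ.+ c) ≡ (e ℤ.- c) ℤ.+ (e ℤ.- c)
  regroup = ℤ-Solver.solve-∀

module _ {k : ℕ} (m : ℕ) .{{_ : NonZero m}} (R : ℕ → Bool) (f g : Subset k) where

  private
    z : Subset k
    z = subset k (λ x → (at f x xor at g x) ∧ R x)

  ∣z∣≤ : # k (at z) ≤ hits f R + hits g R
  ∣z∣≤ = ≤-trans (∑-mono k (λ x x<k → ≤-trans (≤-reflexive (cong bit (at-subset k _ x x<k)))
                                              (le (at f x) (at g x) (R x))))
                 (≤-reflexive (∑-+ k _ _))
    where
    le : ∀ a b r → bit ((a xor b) ∧ r) ≤ bit (a ∧ r) + bit (b ∧ r)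
    le true  true  r     = z≤n
    le true  false r     = m≤m+n _ _
    le false b     r     = ≤-refl

  -- The symmetric difference within `R` has at most `hits f R + hits g R` elements, and this is the
  -- size up to which the tests separate it from the empty set.
  tests-determine : ∀ μ → suc m ^ # k R * m ^ (hits f R + hits g R) < 2 ^ 2 ^ μ * m ^ # k R →
    (∀ y → length y ≡ μ → Even (∑ᶻ k (λ x → +ᶻ bit (R x ∧ tests m R μ y x) ℤ.* diff f g x))) →
    ∀ x → x < k → R x ≡ true → diff f g x ≡ 0ℤ
  tests-determine μ bound even x x<k Rx =
    same (at f x) (at g x) (R x) Rx (trans (sym (at-subset k _ x x<k)) (trans (cong (λ z → at z x) z≡∅) (at-none k x)))
    where
    ∧-right : ∀ a {b} → a ∧ b ≡ true → b ≡ true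
    ∧-right true eq = eq
    z≡∅ : z ≡ none k
    z≡∅ = tests-separate m R μ (hits f R + hits g R) bound z
      (λ x x<k eq → ∧-right (at f x xor at g x) (trans (sym (at-subset k _ x x<k)) eq)) ∣z∣≤
      (λ y eq → let (c , sum) = ∑-diff-parity k (at f) (at g) R (tests m R μ y) in
        even⇒false _ c (subst Even sum (even y eq)))
    same : ∀ a b r → r ≡ true → (a xor b) ∧ r ≡ false → +ᶻ bit a ℤ.- +ᶻ bit b ≡ 0ℤ
    same true  true  r eq _ = refl
    same false false r eq _ = refl
    same true  false true eq ()
    same false true  true eq ()

-- Bernoulli's inequality and powers of 1 + 1/m

bernoulli : ∀ m j d → j + d ≡ suc m → suc m ^ j * d ≤ m ^ j * suc m
bernoulli m zero    d eq = *-monoʳ-≤ 1 (≤-reflexive eq)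
bernoulli m (suc j) d eq = begin
  suc m * suc m ^ j * d        ≡⟨ rearrange (suc m) (suc m ^ j) d ⟩
  suc m ^ j * (suc m * d)      ≤⟨ *-monoʳ-≤ (suc m ^ j) (begin
    d + m * d                    ≤⟨ +-monoˡ-≤ (m * d) (m+n≤o⇒n≤o j (≤-reflexive (suc-injective eq))) ⟩
    m + m * d                    ≡⟨ *-suc m d ⟨
    m * suc d                    ∎) ⟩
  suc m ^ j * (m * suc d)      ≡⟨ rearrange′ (suc m ^ j) m (suc d) ⟩
  m * (suc m ^ j * suc d)      ≤⟨ *-monoʳ-≤ m (bernoulli m j (suc d) (trans (+-suc j d) eq)) ⟩
  m * (m ^ j * suc m)          ≡⟨ *-assoc m (m ^ j) (suc m) ⟨
  m * m ^ j * suc m            ∎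
  where
  open ≤-Reasoning
  rearrange : ∀ s p d → s * p * d ≡ p * (s * d)
  rearrange = ℕ-Solver.solve-∀
  rearrange′ : ∀ p m d → p * (m * d) ≡ m * (p * d)
  rearrange′ = ℕ-Solver.solve-∀

-- With m = 2h, Bernoulli gives (1 + 1/m)^j ≤ (m+1)/(m+1-j), which is at most 2 since 2j ≤ m.
1+m^j≤2*m^j : ∀ h j → j ≤ h → suc (2 * h) ^ j ≤ 2 * (2 * h) ^ j
1+m^j≤2*m^j h j j≤h = *-cancelʳ-≤ _ _ (suc m) (begin
  suc m ^ j * suc m         ≤⟨ *-monoʳ-≤ (suc m ^ j) suc-m≤2d ⟩
  suc m ^ j * (2 * d)       ≡⟨ rearrange (suc m ^ j) d ⟩
  2 * (suc m ^ j * d)       ≤⟨ *-monoʳ-≤ 2 (bernoulli m j d (m+[n∸m]≡n (≤-trans j≤h (≤-trans (m≤n*m h 2) (n≤1+n m))))) ⟩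
  2 * (m ^ j * suc m)       ≡⟨ *-assoc 2 (m ^ j) (suc m) ⟨
  2 * m ^ j * suc m         ∎)
  where
  open ≤-Reasoning
  m = 2 * h
  d = suc m ∸ j
  rearrange : ∀ p d → p * (2 * d) ≡ 2 * (p * d)
  rearrange = ℕ-Solver.solve-∀
  suc-m≤2d : suc m ≤ 2 * d
  suc-m≤2d = begin
    suc m            ≤⟨ n≤1+n (suc m) ⟩
    suc (suc m)      ≡⟨ *-suc 2 h ⟨
    2 * suc h        ≤⟨ *-monoʳ-≤ 2 (m+n≤o⇒m≤o∸n (suc h) (s≤s (≤-trans (+-monoʳ-≤ h j≤h) (≤-reflexive (cong (h +_) (sym (+-identityʳ h))))))) ⟩
    2 * d            ∎

1+m^r≤2^q*m^r : ∀ h q r → r ≤ q * h → suc (2 * h) ^ r ≤ 2 ^ q * (2 * h) ^ r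
1+m^r≤2^q*m^r h zero    zero z≤n = ≤-refl
1+m^r≤2^q*m^r h (suc q) r le with r ≤? h
... | yes r≤h = ≤-trans (1+m^j≤2*m^j h r r≤h)
                        (*-monoˡ-≤ ((2 * h) ^ r) (≤-trans (≤-reflexive (sym (*-identityʳ 2))) (*-monoʳ-≤ 2 (m^n>0 2 q))))
... | no  r≰h = begin
  suc m ^ r                                 ≡⟨ cong (suc m ^_) r≡ ⟨
  suc m ^ (h + r′)                          ≡⟨ ^-distribˡ-+-* (suc m) h r′ ⟩
  suc m ^ h * suc m ^ r′                    ≤⟨ *-mono-≤ (1+m^j≤2*m^j h h ≤-refl) (1+m^r≤2^q*m^r h q r′ r′≤) ⟩
  2 * m ^ h * (2 ^ q * m ^ r′)              ≡⟨ rearrange (m ^ h) (2 ^ q) (m ^ r′) ⟩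
  2 * 2 ^ q * (m ^ h * m ^ r′)              ≡⟨ cong (2 * 2 ^ q *_) (^-distribˡ-+-* m h r′) ⟨
  2 * 2 ^ q * m ^ (h + r′)                  ≡⟨ cong (λ r → 2 * 2 ^ q * m ^ r) r≡ ⟩
  2 * 2 ^ q * m ^ r                         ∎
  where
  open ≤-Reasoning
  m = 2 * h
  r′ = r ∸ h
  r≡ : h + r′ ≡ r
  r≡ = m+[n∸m]≡n (≰⇒≥ r≰h)
  r′≤ : r′ ≤ q * h
  r′≤ = ≤-trans (∸-monoˡ-≤ h le) (≤-reflexive (m+n∸m≡n h (q * h)))
  rearrange : ∀ a b c → 2 * a * (b * c) ≡ 2 * b * (a * c)
  rearrange = ℕ-Solver.solve-∀

-- Bit strings as addresses

toBits : ℕ → ℕ → List Bool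
toBits zero    i = []
toBits (suc L) i = does (i % 2 ≟ 1) ∷ toBits L (i / 2)

length-toBits : ∀ L i → length (toBits L i) ≡ L
length-toBits zero    i = refl
length-toBits (suc L) i = cong suc (length-toBits L (i / 2))

toBits-injective : ∀ L {i j} → i < 2 ^ L → j < 2 ^ L → toBits L i ≡ toBits L j → i ≡ j
toBits-injective zero    (s≤s z≤n) (s≤s z≤n) eq = refl
toBits-injective (suc L) {i} {j} i< j< eq = begin
  i                  ≡⟨ m≡m%n+[m/n]*n i 2 ⟩
  i % 2 + i / 2 * 2  ≡⟨ cong₂ (λ r q → r + q * 2) (low (i % 2) (j % 2) (m%n<n i 2) (m%n<n j 2) (∷-injectiveˡ eq))
                          (toBits-injective L (half i<) (half j<) (∷-injectiveʳ eq)) ⟩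
  j % 2 + j / 2 * 2  ≡⟨ m≡m%n+[m/n]*n j 2 ⟨
  j                  ∎
  where
  open ≡-Reasoning
  half : ∀ {i} → i < 2 * 2 ^ L → i / 2 < 2 ^ L
  half {i} i< = m<n*o⇒m/o<n (subst (i <_) (*-comm 2 (2 ^ L)) i<)
  low : ∀ a b → a < 2 → b < 2 → does (a ≟ 1) ≡ does (b ≟ 1) → a ≡ b
  low 0 0 _ _ _ = refl
  low 1 1 _ _ _ = refl
  low (suc (suc _)) _ (s≤s (s≤s ())) _ _
  low _ (suc (suc _)) _ (s≤s (s≤s ())) _

take-length : ∀ (xs ys : List Bool) → take (length xs) (xs ++ ys) ≡ xs
take-length []       ys = refl
take-length (x ∷ xs) ys = cong (x ∷_) (take-length xs ys)

drop-length : ∀ (xs ys : List Bool) → drop (length xs) (xs ++ ys) ≡ ys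
drop-length []       ys = refl
drop-length (x ∷ xs) ys = drop-length xs ys

profile-≥ : ∀ c h d → d < h → c ≤ profile c h d
profile-≥ c (suc h) zero    _         = ≤-trans (≤-reflexive (sym (*-identityʳ c))) (*-monoʳ-≤ c (m^n>0 4 h))
profile-≥ c (suc h) (suc d) (s≤s d<h) = profile-≥ c h d d<h

n<2^n : ∀ n → n < 2 ^ n
n<2^n zero    = s≤s z≤n
n<2^n (suc n) = ≤-trans (+-mono-≤ (m^n>0 2 n) (n<2^n n)) (≤-reflexive (cong (2 ^ n +_) (sym (+-identityʳ _))))

any<? : ∀ k (P : ℕ → Bool) → (∃ λ x → x < k × P x ≡ true) ⊎ (∀ x → x < k → P x ≡ false)
any<? k P with anyUpTo? (λ x → P x Bool.≟ true) k
... | yes found = inj₁ found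
... | no ¬found = inj₂ (λ x x<k → Bool.¬-not (λ Px → ¬found (x , x<k , Px)))

∧-left : ∀ {a b} → a ∧ b ≡ true → a ≡ true
∧-left {true} eq = refl

-- Small k/n: groups of blocks identified by parities

module Dense (k n s′ a : ℕ) .{{_ : NonZero a}} (s≤a : suc s′ ≤ a) (2^32a≤n : 2 ^ (32 * a) ≤ n) where

  s = suc s′
  -- `m` is 2^s, comparable to `k / n`, so that an element of a difference weighs `s` bits. Blocks
  -- of size `W` are large enough to be counted with O(n / 2^a) queries. A group gets 2^`μ` = 2·`δ`
  -- tests. `H` is made of `a` bits that select a group, `μ` bits that select a test, the sign bit
  -- and the leading true of a hosting row.
  m = 2 * 2 ^ s′
  W = 2 ^ (s + a)
  μ = suc (3 * a + 3)
  δ = 2 ^ (3 * a + 3)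
  H = 2 + (μ + a)

  instance
    2^a≢0 : NonZero (2 ^ a)
    2^a≢0 = m^n≢0 2 a
    W≢0 : NonZero W
    W≢0 = m^n≢0 2 (s + a)
    δ≢0 : NonZero δ
    δ≢0 = m^n≢0 2 (3 * a + 3)

  N : ℕ
  N = blockCount W k

  W≡ : W ≡ 2 ^ suc a * 2 ^ s′
  W≡ = trans (cong (λ e → 2 ^ suc e) (+-comm s′ a)) (^-distribˡ-+-* 2 (suc a) s′)

  x<k⇒x/W<N : ∀ {x} → x < k → x / W < N
  x<k⇒x/W<N x<k = s≤s (/-monoˡ-≤ W (<⇒≤ x<k))

  module Groups (f₀ : Subset k) where

    -- Bits that suffice for the first `i` blocks. An element counts 2s: it may enter the difference
    -- through either candidate, each time at the price of a factor `m` = 2^s. A block counts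
    -- 2^(a+1), because (1 + 1/m)^W is at most 2^(2^(a+1)).
    cost : ℕ → ℕ
    cost i = 2 * s * prefix f₀ (i * W) + 2 ^ suc a * i

    cost-mono : ∀ {i j} → i ≤ j → cost i ≤ cost j
    cost-mono i≤j = +-mono-≤ (*-monoʳ-≤ (2 * s) (prefix-mono f₀ (*-monoˡ-≤ W i≤j))) (*-monoʳ-≤ (2 ^ suc a) i≤j)

    -- A block has at most `W` elements, so its cost is at most 2sW + 2^(a+1) ≤ 2^(3a+2); this is
    -- the origin of the exponent in `δ`.
    cost-suc : ∀ i → cost (suc i) ≤ cost i + δ
    cost-suc i = begin
      2 * s * prefix f₀ (W + i * W) + 2 ^ suc a * suc i
        ≤⟨ +-monoˡ-≤ _ (*-monoʳ-≤ (2 * s) (prefix-+ W f₀ i)) ⟩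
      2 * s * (W + prefix f₀ (i * W)) + 2 ^ suc a * suc i
        ≡⟨ rearrange (2 * s) W (prefix f₀ (i * W)) (2 ^ suc a) i ⟩
      cost i + (2 * s * W + 2 ^ suc a)
        ≤⟨ +-monoʳ-≤ (cost i) step ⟩
      cost i + δ ∎
      where
      open ≤-Reasoning
      rearrange : ∀ s w p q i → s * (w + p) + q * suc i ≡ s * p + q * i + (s * w + q)
      rearrange = ℕ-Solver.solve-∀
      step : 2 * s * W + 2 ^ suc a ≤ δ
      step = begin
        2 * s * W + 2 ^ suc a                      ≤⟨ +-mono-≤ (*-mono-≤ (*-monoʳ-≤ 2 (≤-trans s≤a (<⇒≤ (n<2^n a)))) (^-monoʳ-≤ 2 (+-monoˡ-≤ a s≤a)))
                                                         (^-monoʳ-≤ 2 (s≤s (m≤m+n a (a + a)))) ⟩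
        2 ^ suc a * 2 ^ (a + a) + 2 ^ suc (a + (a + a)) ≡⟨ cong (_+ 2 ^ suc (a + (a + a))) (^-distribˡ-+-* 2 (suc a) (a + a)) ⟨
        2 ^ suc (a + (a + a)) + 2 ^ suc (a + (a + a))   ≡⟨ cong (2 ^ suc (a + (a + a)) +_) (+-identityʳ _) ⟨
        2 ^ suc (suc (a + (a + a)))                     ≤⟨ ^-monoʳ-≤ 2 (≤-trans (n≤1+n _) (≤-reflexive (exponent a))) ⟩
        δ ∎
        where
        exponent : ∀ a → suc (suc (suc (a + (a + a)))) ≡ 3 * a + 3
        exponent = ℕ-Solver.solve-∀

    group : ℕ → ℕ
    group i = cost i / δ

    -- As `cost` is monotone, this is the number of blocks among the first `i` whose cost is below
    -- `G * δ`, and hence the boundary at which group `G` begins.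
    start : ℕ → ℕ → ℕ
    start G zero    = 0
    start G (suc i) = if does (cost i <? G * δ) then suc i else start G i

    start≤ : ∀ G i → start G i ≤ i
    start≤ G zero = z≤n
    start≤ G (suc i) with does (cost i <? G * δ)
    ... | true  = ≤-refl
    ... | false = m≤n⇒m≤1+n (start≤ G i)

    below-start : ∀ G M {i} → i < start G M → cost i < G * δ
    below-start G (suc M) {i} lt with does (cost M <? G * δ) in eq
    ... | true  = ≤-<-trans (cost-mono (s≤s⁻¹ lt)) (does⇒ (cost M <? G * δ) eq)
    ... | false = below-start G M lt

    above-start : ∀ G M {i} → i < M → start G M ≤ i → G * δ ≤ cost i
    above-start G (suc M) {i} lt le with does (cost M <? G * δ) in eq
    ... | true  = ⊥-elim (<⇒≱ lt le)
    ... | false with m≤n⇒m<n∨m≡n (s≤s⁻¹ lt)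
    ...   | inj₁ i<M  = above-start G M i<M le
    ...   | inj₂ refl = ≮⇒≥ (λ cost< → case trans (sym eq) (dec-true (cost M <? G * δ) cost<) of λ ())

    first last : ℕ → ℕ
    first G = start G N
    last  G = start (suc G) N

    first≤last : ∀ G → first G ≤ last G
    first≤last G = ≮⇒≥ (λ lt → <⇒≱ (below-start G N lt)
      (≤-trans (m≤n+m _ δ) (above-start (suc G) N (<-≤-trans lt (start≤ G N)) ≤-refl)))

    region : ℕ → ℕ → Bool
    region G x = does (group (x / W) ≟ G)

    region-interval : ∀ G → Interval k (region G) (first G * W) (last G * W)
    region-interval G = interval k (region G) (*-monoˡ-≤ W (first≤last G)) to from
      where
      to : ∀ x → x < k → region G x ≡ true → first G * W ≤ x × x < last G * W
      to x x<k eq with does⇒ (group (x / W) ≟ G) eq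
      ... | refl =
        ≤-trans (*-monoˡ-≤ W (≮⇒≥ (λ lt → <⇒≱ (below-start G N lt) (m/n*n≤m (cost (x / W)) δ)))) (m/n*n≤m x W) ,
        <-≤-trans (proj₂ (block-bounds W {x} refl))
          (*-monoˡ-≤ W (≰⇒> (λ le → <⇒≱ (proj₂ (block-bounds δ {cost (x / W)} refl))
                                         (above-start (suc G) N (x<k⇒x/W<N x<k) le))))
      from : ∀ x → x < k → first G * W ≤ x → x < last G * W → region G x ≡ true
      from x x<k lo hi = dec-true (group (x / W) ≟ G) (x/M≡y δ
        (above-start G N (x<k⇒x/W<N x<k) (≤-trans (≤-reflexive (sym (m*n/n≡m (first G) W))) (/-monoˡ-≤ W lo)))
        (below-start (suc G) N (m<n*o⇒m/o<n hi)))

    -- The last block of a group starts below (G+1)·δ and adds at most another δ. The total 2·δ is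
    -- the number of tests of the group.
    window : ∀ G → cost (last G) < cost (first G) + 2 * δ
    window G with m≤n⇒m<n∨m≡n (first≤last G)
    ... | inj₂ eq = subst (λ l → cost l < cost (first G) + 2 * δ) eq
                      (m<m+n _ (<-≤-trans (m^n>0 2 (3 * a + 3)) (m≤n*m δ 2)))
    ... | inj₁ lt = begin-strict
      cost (last G)                ≡⟨ cong cost (suc-pred (last G) {{>-nonZero (≤-<-trans z≤n lt)}}) ⟨
      cost (suc i)                 ≤⟨ cost-suc i ⟩
      cost i + δ                   <⟨ +-monoˡ-< δ (below-start (suc G) N (≤-reflexive (suc-pred (last G) {{>-nonZero (≤-<-trans z≤n lt)}}))) ⟩
      δ + G * δ + δ                ≤⟨ +-monoˡ-≤ δ (+-monoʳ-≤ δ (above-start G N (<-≤-trans lt (start≤ (suc G) N)) ≤-refl)) ⟩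
      δ + cost (first G) + δ       ≡⟨ rearrange δ (cost (first G)) ⟩
      cost (first G) + 2 * δ       ∎
      where
      open ≤-Reasoning
      i = pred (last G)
      rearrange : ∀ d c → d + c + d ≡ c + 2 * d
      rearrange = ℕ-Solver.solve-∀

    κ : ℕ → ℕ
    κ G = last G ∸ first G

    κ+first : ∀ G → κ G + first G ≡ last G
    κ+first G = m∸n+n≡m (first≤last G)

    #region≤ : ∀ G → # k (region G) ≤ 2 ^ suc a * κ G * 2 ^ s′
    #region≤ G = ≤-trans
      (#-interval k (region G) {first G * W} (κ G * W)
        (λ x x<k → trans (region-interval G x x<k) (cong (λ b → bit (x <ᵇ b))
          (trans (cong (_* W) (sym (κ+first G))) (*-distribʳ-+ W (κ G) (first G))))))
      (≤-reflexive (trans (cong (κ G *_) W≡) (rearrange (κ G) (2 ^ suc a) (2 ^ s′))))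
      where
      rearrange : ∀ k a s → k * (a * s) ≡ a * k * s
      rearrange = ℕ-Solver.solve-∀

    -- the logarithm to base 2 of the inequality needed by tests-determine
    budget : ∀ G → 2 ^ suc a * κ G + s * (hits f₀ (region G) + hits f₀ (region G)) < 2 ^ μ
    budget G = +-cancelˡ-< (cost (first G)) _ _ (subst (_< cost (first G) + 2 * δ) (begin
      2 * s * prefix f₀ (last G * W) + 2 ^ suc a * last G
        ≡⟨ cong₂ (λ p l → 2 * s * p + 2 ^ suc a * l)
             (sym (hits-interval f₀ (region G) {first G * W} {last G * W} (region-interval G))) (sym (κ+first G)) ⟩
      2 * s * (h + prefix f₀ (first G * W)) + 2 ^ suc a * (κ G + first G)
        ≡⟨ rearrange s h (prefix f₀ (first G * W)) (2 ^ suc a) (κ G) (first G) ⟩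
      cost (first G) + (2 ^ suc a * κ G + s * (h + h)) ∎) (window G))
      where
      open ≡-Reasoning
      h = hits f₀ (region G)
      rearrange : ∀ s h p q k f → 2 * s * (h + p) + q * (k + f) ≡ 2 * s * p + q * f + (q * k + s * (h + h))
      rearrange = ℕ-Solver.solve-∀

    -- where group G is hosted: pass π, instance p at depth ∣p∣ < a, rows starting with the rest
    -- of the bits of G % 2^a
    record Sits (π G : ℕ) (p j : List Bool) : Set where
      constructor sitting
      field
        quotient≡ : G / 2 ^ a ≡ π * a + length p
        depth<    : length p < a
        bits≡     : toBits a (G % 2 ^ a) ≡ p ++ take (a ∸ length p) j

    sits? : ∀ π G p j → Dec (Sits π G p j)
    sits? π G p j = map′ (λ (q , d , b) → sitting q d b) (λ (sitting q d b) → q , d , b)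
      ((G / 2 ^ a ≟ π * a + length p) ×-dec (length p <? a) ×-dec
       ≡-dec Bool._≟_ (toBits a (G % 2 ^ a)) (p ++ take (a ∸ length p) j))

    sits-path : ∀ {π G p j p′ j′} → Sits π G p j → Sits π G p′ j′ → p ≡ p′
    sits-path {π} {G} {p} {j} {p′} {j′} (sitting eq _ bits) (sitting eq′ _ bits′) = begin
      p                                                ≡⟨ take-length p _ ⟨
      take (length p) (p ++ take (a ∸ length p) j)     ≡⟨ cong₂ take same (trans (sym bits) bits′) ⟩
      take (length p′) (p′ ++ take (a ∸ length p′) j′) ≡⟨ take-length p′ _ ⟩
      p′                                               ∎
      where
      open ≡-Reasoning
      same : length p ≡ length p′
      same = +-cancelˡ-≡ (π * a) _ _ (trans (sym eq) eq′)

    sits-group : ∀ {π G G′ p j} → Sits π G p j → Sits π G′ p j → G ≡ G′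
    sits-group {π} {G} {G′} (sitting eq _ bits) (sitting eq′ _ bits′) = begin
      G                                  ≡⟨ m≡m%n+[m/n]*n G (2 ^ a) ⟩
      G % 2 ^ a + G / 2 ^ a * 2 ^ a      ≡⟨ cong₂ (λ r q → r + q * 2 ^ a)
           (toBits-injective a (m%n<n G (2 ^ a)) (m%n<n G′ (2 ^ a)) (trans bits (sym bits′))) (trans eq (sym eq′)) ⟩
      G′ % 2 ^ a + G′ / 2 ^ a * 2 ^ a    ≡⟨ m≡m%n+[m/n]*n G′ (2 ^ a) ⟨
      G′                                 ∎
      where open ≡-Reasoning

    test : ℕ → List Bool → ℕ → Bool
    test G = tests {k} m (region G) μ

    label : ℕ → ℕ → List Bool → List Bool → Bool
    label π x p j = does (sits? π (group (x / W)) p j) ∧ test (group (x / W)) (drop (a ∸ length p) j) x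

    label-sits : ∀ π x p j → label π x p j ≡ true → Sits π (group (x / W)) p j
    label-sits π x p j eq = does⇒ (sits? π (group (x / W)) p j) (∧-left eq)

    batches : ℕ → List (ℕ → Bool)
    batches zero    = []
    batches (suc π) = pass k H (label π) ++ batches π

    length-batches : ∀ π → length (batches π) ≡ π * (2 * 2 ^ H)
    length-batches zero    = refl
    length-batches (suc π) = trans (length-++ (pass k H (label π)))
      (cong₂ _+_ (length-pass k H (label π)) (length-batches π))

    c₀ : ℕ
    c₀ = 2 ^ μ * 2 ^ s′

    -- An instance row contains elements of a single group, and `budget` bounds the size of its
    -- region. The bound `c₀` fits even the smallest entry of the profile.
    #label≤ : ∀ π p j → # k (λ x → label π x p j) ≤ profile c₀ a (length p)
    #label≤ π p j with any<? k (λ x → label π x p j)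
    ... | inj₂ never = ≤-trans (≤-reflexive (#-false k never)) z≤n
    ... | inj₁ (x₀ , x₀<k , eq₀) = begin
      # k (λ x → label π x p j)     ≤⟨ ∑-mono k (λ x _ → inRegion x (label π x p j) refl) ⟩
      # k (region G)                ≤⟨ #region≤ G ⟩
      2 ^ suc a * κ G * 2 ^ s′      ≤⟨ *-monoˡ-≤ (2 ^ s′) (<⇒≤ (≤-<-trans (m≤m+n (2 ^ suc a * κ G) _) (budget G))) ⟩
      c₀                            ≤⟨ profile-≥ c₀ a (length p) (Sits.depth< sits₀) ⟩
      profile c₀ a (length p)       ∎
      where
      open ≤-Reasoning
      G = group (x₀ / W)
      sits₀ = label-sits π x₀ p j eq₀
      inRegion : ∀ x b → label π x p j ≡ b → bit b ≤ bit (region G x)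
      inRegion x false _  = z≤n
      inRegion x true  eq = ≤-reflexive (cong bit (sym (dec-true (group (x / W) ≟ G)
        (sits-group (label-sits π x p j eq) sits₀))))

    batches-sizes : ∀ π → All (λ P → # k P ≤ n) (batches π)
    batches-sizes zero    = []
    batches-sizes (suc π) = All.++⁺ (pass-sizes k H (label π) c₀ a (#label≤ π) bound) (batches-sizes π)
      where
      open ≤-Reasoning
      bound : c₀ * 4 ^ a ≤ 2 * n
      bound = begin
        2 ^ μ * 2 ^ s′ * 4 ^ a               ≡⟨ cong₂ _*_ (^-distribˡ-+-* 2 μ s′) (sym (^-*-assoc 2 2 a)) ⟨
        2 ^ (μ + s′) * 2 ^ (2 * a)           ≡⟨ ^-distribˡ-+-* 2 (μ + s′) (2 * a) ⟨
        2 ^ (μ + s′ + 2 * a)                 ≤⟨ ^-monoʳ-≤ 2 (begin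
          μ + s′ + 2 * a                       ≤⟨ +-monoˡ-≤ (2 * a) (+-monoʳ-≤ μ (≤-trans (n≤1+n s′) s≤a)) ⟩
          μ + a + 2 * a                        ≡⟨ collect a ⟩
          6 * a + 4 * 1                        ≤⟨ +-monoʳ-≤ (6 * a) (*-monoʳ-≤ 4 (>-nonZero⁻¹ a)) ⟩
          6 * a + 4 * a                        ≡⟨ *-distribʳ-+ a 6 4 ⟨
          10 * a                               ≤⟨ *-monoˡ-≤ a (m≤m+n 10 22) ⟩
          32 * a                               ∎) ⟩
        2 ^ (32 * a)                         ≤⟨ 2^32a≤n ⟩
        n                                    ≤⟨ m≤n*m n 2 ⟩
        2 * n                                ∎
        where
        collect : ∀ a → suc (3 * a + 3) + a + 2 * a ≡ 6 * a + 4 * 1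
        collect = ℕ-Solver.solve-∀

    module _ {f g : Subset k} (eqᶠ : ∀ v → prefix f₀ (v * W) ≡ prefix f (v * W))
             (eqᵍ : ∀ v → prefix f₀ (v * W) ≡ prefix g (v * W)) where

      hits-region : ∀ {h} → (∀ v → prefix f₀ (v * W) ≡ prefix h (v * W)) → ∀ G →
                    hits f₀ (region G) ≡ hits h (region G)
      hits-region {h} eq G = +-cancelʳ-≡ (prefix f₀ (first G * W)) _ _ (begin
        hits f₀ (region G) + prefix f₀ (first G * W)
          ≡⟨ hits-interval f₀ (region G) {first G * W} {last G * W} (region-interval G) ⟩
        prefix f₀ (last G * W)   ≡⟨ eq (last G) ⟩
        prefix h (last G * W)
          ≡⟨ hits-interval h (region G) {first G * W} {last G * W} (region-interval G) ⟨
        hits h (region G) + prefix h (first G * W)   ≡⟨ cong (hits h (region G) +_) (eq (first G)) ⟨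
        hits h (region G) + prefix f₀ (first G * W)  ∎)
        where open ≡-Reasoning

      separated : ∀ G → suc m ^ # k (region G) * m ^ (hits f (region G) + hits g (region G)) <
                        2 ^ 2 ^ μ * m ^ # k (region G)
      separated G = begin-strict
        suc m ^ r * m ^ (hits f (region G) + hits g (region G))
          ≡⟨ cong (λ e → suc m ^ r * m ^ e) (cong₂ _+_ (hits-region {f} eqᶠ G) (hits-region {g} eqᵍ G)) ⟨
        suc m ^ r * m ^ (h + h)
          ≤⟨ *-monoˡ-≤ (m ^ (h + h)) (1+m^r≤2^q*m^r (2 ^ s′) (2 ^ suc a * κ G) r (#region≤ G)) ⟩
        2 ^ (2 ^ suc a * κ G) * m ^ r * m ^ (h + h)
          ≡⟨ rearrange (2 ^ (2 ^ suc a * κ G)) (m ^ r) (m ^ (h + h)) ⟩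
        2 ^ (2 ^ suc a * κ G) * m ^ (h + h) * m ^ r
          ≡⟨ cong (λ e → 2 ^ (2 ^ suc a * κ G) * e * m ^ r) (^-*-assoc 2 s (h + h)) ⟩
        2 ^ (2 ^ suc a * κ G) * 2 ^ (s * (h + h)) * m ^ r
          ≡⟨ cong (_* m ^ r) (^-distribˡ-+-* 2 (2 ^ suc a * κ G) (s * (h + h))) ⟨
        2 ^ (2 ^ suc a * κ G + s * (h + h)) * m ^ r
          <⟨ *-monoˡ-< (m ^ r) {{m^n≢0 m r {{m^n≢0 2 s}}}} (^-monoʳ-< 2 (s≤s (s≤s z≤n)) (budget G)) ⟩
        2 ^ 2 ^ μ * m ^ r ∎
        where
        open ≤-Reasoning
        r = # k (region G)
        h = hits f₀ (region G)
        rearrange : ∀ a b c → a * b * c ≡ a * c * b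
        rearrange = ℕ-Solver.solve-∀

      -- The tests of `G` occupy the rows `rest ++ y` of instance `p`, where `y` runs over the
      -- strings of length `μ`; evenness of the instance is therefore evenness of the whole family.
      sits-resolves : ∀ {π G p j} → length p + (2 + length j) ≡ H → Sits π G p j →
        (∀ i → length i ≡ length j → Even (content k H (label π) f g p i)) →
        ∀ x → x < k → region G x ≡ true → diff f g x ≡ 0ℤ
      sits-resolves {π} {G} {p} {j} len (sitting eq p<a bits) even =
        tests-determine m {{m^n≢0 2 s}} (region G) f g μ (separated G) (λ y ∣y∣ → subst Even
          (∑ᶻ-cong k (λ x _ → cong (λ b → +ᶻ bit b ℤ.* diff f g x) (label≡ y x))) (even (rest ++ y) (lengths y ∣y∣)))
        where
        d = a ∸ length p
        rest = take d j
        ∣j∣ : d + μ ≡ length j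
        ∣j∣ = +-cancelˡ-≡ (length p) _ _ (begin
          length p + (d + μ)    ≡⟨ +-assoc (length p) d μ ⟨
          length p + d + μ      ≡⟨ cong (_+ μ) (m+[n∸m]≡n (<⇒≤ p<a)) ⟩
          a + μ                 ≡⟨ +-comm a μ ⟩
          μ + a                 ≡⟨ suc-injective (suc-injective (trans (sym len) (+-suc₂ (length p) (length j)))) ⟩
          length p + length j   ∎)
          where
          open ≡-Reasoning
          +-suc₂ : ∀ a b → a + (2 + b) ≡ suc (suc (a + b))
          +-suc₂ = ℕ-Solver.solve-∀
        ∣rest∣ : length rest ≡ d
        ∣rest∣ = trans (length-take d j) (m≤n⇒m⊓n≡m (≤-trans (m≤m+n d μ) (≤-reflexive ∣j∣)))
        lengths : ∀ y → length y ≡ μ → length (rest ++ y) ≡ length j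
        lengths y ∣y∣ = trans (length-++ rest) (trans (cong₂ _+_ ∣rest∣ ∣y∣) ∣j∣)
        sits-y : ∀ y → Sits π G p (rest ++ y)
        sits-y y = sitting eq p<a (trans bits (cong (p ++_)
          (trans (sym (take-length rest y)) (cong (λ e → take e (rest ++ y)) ∣rest∣))))
        drop-y : ∀ y → drop d (rest ++ y) ≡ y
        drop-y y = trans (cong (λ e → drop e (rest ++ y)) (sym ∣rest∣)) (drop-length rest y)
        label≡ : ∀ y x → label π x p (rest ++ y) ≡ region G x ∧ test G y x
        label≡ y x = go (group (x / W)) (group (x / W) ≟ G)
          where
          go : ∀ G′ → Dec (G′ ≡ G) →
               does (sits? π G′ p (rest ++ y)) ∧ test G′ (drop d (rest ++ y)) x ≡ does (G′ ≟ G) ∧ test G y x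
          go G′ (yes refl) = cong₂ _∧_
            (trans (dec-true (sits? π G p (rest ++ y)) (sits-y y)) (sym (dec-true (G ≟ G) refl)))
            (cong (λ e → test G e x) (drop-y y))
          go G′ (no ne) = trans
            (cong (_∧ test G′ (drop d (rest ++ y)) x)
              (dec-false (sits? π G′ p (rest ++ y)) (λ sits′ → ne (sits-group sits′ (sits-y y)))))
            (cong (_∧ test G y x) (sym (dec-false (G′ ≟ G) ne)))

      -- Once the instance is even, `f` and `g` coincide on the group sitting there, so the hosted
      -- difference is exactly 0 and needs no room.
      pass-hosts : ∀ π → Hosts H (content k H (label π) f g)
      pass-hosts π p t len even j ∣j∣ = subst (λ c → ℤ.∣ c ∣ < 2 ^ suc (lead j)) (sym vanish) (m^n>0 2 (suc (lead j)))
        where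
        vanish : content k H (label π) f g p j ≡ 0ℤ
        vanish with any<? k (λ x → label π x p j)
        ... | inj₂ never = trans (∑ᶻ-cong k (λ x x<k → trans
                (cong (λ b → +ᶻ bit b ℤ.* diff f g x) (never x x<k)) (ℤ.*-zeroˡ (diff f g x)))) (∑ᶻ-0 k)
        ... | inj₁ (x₀ , x₀<k , eq₀) = trans (∑ᶻ-cong k (λ x x<k → zero-term x x<k (label π x p j) refl)) (∑ᶻ-0 k)
          where
          sits₀ = label-sits π x₀ p j eq₀
          zero-term : ∀ x → x < k → ∀ b → label π x p j ≡ b → +ᶻ bit b ℤ.* diff f g x ≡ 0ℤ
          zero-term x x<k false _  = ℤ.*-zeroˡ (diff f g x)
          zero-term x x<k true  eq = trans (cong (1ℤ ℤ.*_)
            (sits-resolves {p = p} {j = j} (trans (cong (λ l → length p + (2 + l)) ∣j∣) len) sits₀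
              (λ i ∣i∣ → even i (trans ∣i∣ ∣j∣)) x x<k
              (dec-true (group (x / W) ≟ group (x₀ / W)) (sits-group (label-sits π x p j eq) sits₀)))) refl

      same-pass : ∀ M → Same (batches M) f g → ∀ π → π < M → Same (pass k H (label π)) f g
      same-pass (suc M) same π lt with m≤n⇒m<n∨m≡n (s≤s⁻¹ lt)
      ... | inj₂ refl = All.++⁻ˡ (pass k H (label M)) same
      ... | inj₁ π<M  = same-pass M (All.++⁻ʳ (pass k H (label M)) same) π π<M

      single-path : ∀ π x → SinglePath (label π x)
      single-path π x {p} {j} {p′} {j′} eq eq′ =
        sits-path {j = j} {j′ = j′} (label-sits π x p j eq) (label-sits π x p′ j′ eq′)

      batches-determine : ∀ M → (∀ i → i < N → group i / 2 ^ a / a < M) → Same (batches M) f g → f ≡ g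
      batches-determine M enough same = at-ext f g (λ x x<k → bits-equal (at f x) (at g x) (diff≡0 x x<k))
        where
        bits-equal : ∀ b c → +ᶻ bit b ℤ.- +ᶻ bit c ≡ 0ℤ → b ≡ c
        bits-equal true  true  _ = refl
        bits-equal false false _ = refl
        bits-equal true  false ()
        bits-equal false true  ()
        diff≡0 : ∀ x → x < k → diff f g x ≡ 0ℤ
        -- The last `μ` bits are an arbitrary choice of test: `sits-resolves` considers every row of
        -- the instance.
        diff≡0 x x<k = sits-resolves {π} {G} {p} {rest ++ replicate μ false} len sits
          (λ i ∣i∣ → 0ℤ , pass-determines k H (label π) (single-path π) {f} {g}
            (same-pass M same π (enough (x / W) (x<k⇒x/W<N x<k))) (pass-hosts π) p i
            (trans (cong (λ l → length p + (2 + l)) ∣i∣) len))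
          x x<k (dec-true (group (x / W) ≟ G) refl)
          where
          G = group (x / W)
          π = G / 2 ^ a / a
          d = (G / 2 ^ a) % a
          d<a : d < a
          d<a = m%n<n (G / 2 ^ a) a
          bits = toBits a (G % 2 ^ a)
          p = take d bits
          rest = drop d bits
          ∣p∣ : length p ≡ d
          ∣p∣ = trans (length-take d bits) (m≤n⇒m⊓n≡m (≤-trans (<⇒≤ d<a) (≤-reflexive (sym (length-toBits a (G % 2 ^ a))))))
          ∣rest∣ : length rest ≡ a ∸ d
          ∣rest∣ = trans (length-drop d bits) (cong (_∸ d) (length-toBits a (G % 2 ^ a)))
          len : length p + (2 + length (rest ++ replicate μ false)) ≡ H
          len = begin
            length p + (2 + length (rest ++ replicate μ false))
              ≡⟨ cong₂ (λ u v → u + (2 + v)) ∣p∣ (trans (length-++ rest) (cong₂ _+_ ∣rest∣ (length-replicate μ))) ⟩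
            d + (2 + (a ∸ d + μ))   ≡⟨ rearrange d (a ∸ d) μ ⟩
            2 + (μ + (d + (a ∸ d))) ≡⟨ cong (λ e → 2 + (μ + e)) (m+[n∸m]≡n (<⇒≤ d<a)) ⟩
            H ∎
            where
            open ≡-Reasoning
            rearrange : ∀ d e m → d + (2 + (e + m)) ≡ 2 + (m + (d + e))
            rearrange = ℕ-Solver.solve-∀
          sits : Sits π G p (rest ++ replicate μ false)
          sits = sitting
            (trans (trans (m≡m%n+[m/n]*n (G / 2 ^ a) a) (+-comm d (π * a))) (cong (π * a +_) (sym ∣p∣)))
            (subst (_< a) (sym ∣p∣) d<a)
            (trans (sym (take++drop≡id d bits)) (cong (p ++_)
              (trans (sym (take-length rest (replicate μ false)))
                     (cong (λ e → take e (rest ++ replicate μ false)) (trans ∣rest∣ (cong (a ∸_) (sym ∣p∣)))))))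

  costBound : ℕ
  costBound = 2 * s * n + 2 ^ suc a * N

  passes : ℕ
  passes = suc (costBound / δ / 2 ^ a / a)

  W≤n : W ≤ n
  W≤n = ≤-trans (^-monoʳ-≤ 2 (begin
    s + a        ≤⟨ +-monoˡ-≤ a s≤a ⟩
    a + a        ≡⟨ cong (a +_) (+-identityʳ a) ⟨
    2 * a        ≤⟨ *-monoˡ-≤ a (m≤m+n 2 30) ⟩
    32 * a       ∎)) 2^32a≤n
    where open ≤-Reasoning

  queries# : ℕ
  queries# = N + (passes * (2 * 2 ^ H) + 0)

  solvable : SolvableIn k n queries# (Initial k n)
  solvable = subst (λ l → SolvableIn k n (l + (passes * (2 * 2 ^ H) + 0)) (Initial k n)) (length-applyUpTo (block W) N)
    (askAll (blockQueries W k) _ (All.applyUpTo⁺₂ (block W) N (λ v → ≤-trans (#block≤ W k v) W≤n)) initial?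
      (λ f₀ f₀≤n → let open Groups f₀ in
        subst (λ l → SolvableIn k n (l + 0) (λ f → Initial k n f × Same (blockQueries W k) f₀ f)) (length-batches passes)
          (askAll (batches passes) 0 (batches-sizes passes) (λ f → initial? f ×-dec same? (blockQueries W k) f₀ f)
            (λ f₁ (_ , same₁) f g ((_ , sameᶠ) , bᶠ) ((_ , sameᵍ) , bᵍ) →
              trans (sym (determine f₀ f₀≤n f₁ f same₁ sameᶠ bᶠ)) (determine f₀ f₀≤n f₁ g same₁ sameᵍ bᵍ)))))
    where
    determine : ∀ f₀ → ∣ f₀ ∣ ≤ n → ∀ f₁ f → Same (blockQueries W k) f₀ f₁ → Same (blockQueries W k) f₀ f →
                Same (Groups.batches f₀ passes) f₁ f → f₁ ≡ f
    determine f₀ f₀≤n f₁ f same₁ same = Groups.batches-determine f₀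
      {f₁} {f} (blockQueries-determine W {f = f₀} {g = f₁} same₁) (blockQueries-determine W {f = f₀} {g = f} same) passes
      (λ i i<N → s≤s (/-monoˡ-≤ a (/-monoˡ-≤ (2 ^ a) (/-monoˡ-≤ δ
        (+-mono-≤ (*-monoʳ-≤ (2 * s) (≤-trans (hits≤∣f∣ f₀ _) f₀≤n)) (*-monoʳ-≤ (2 ^ suc a) (<⇒≤ i<N)))))))

-- Prefix counts of single elements, runs of trues, differences of counts

profile≡ : ∀ c h d → d < h → profile c h d ≡ c * 4 ^ (h ∸ suc d)
profile≡ c (suc h) zero    _         = refl
profile≡ c (suc h) (suc d) (s≤s d<h) = profile≡ c h d d<h

prefix-zero : ∀ {k} (f : Subset k) → prefix f 0 ≡ 0
prefix-zero {k} f = #-false k (λ x _ → Bool.∧-zeroʳ (at f x))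

prefix-suc : ∀ {k} (f : Subset k) x → x < k → prefix f (suc x) ≡ bit (at f x) + prefix f x
prefix-suc {suc k} (b ∷ f) zero    _         = trans (cong (λ c → bit c + prefix f 0) (Bool.∧-identityʳ b))
  (cong (bit b +_) (trans (prefix-zero f) (sym (prefix-zero (b ∷ f)))))
prefix-suc {suc k} (b ∷ f) (suc x) (s≤s x<k) = trans
  (cong (bit (b ∧ true) +_) (prefix-suc f x x<k)) (swap (bit (b ∧ true)) (bit (at f x)) (prefix f x))
  where
  swap : ∀ a b c → a + (b + c) ≡ b + (a + c)
  swap = ℕ-Solver.solve-∀

prefix-determines : ∀ {k} {f g : Subset k} → (∀ x → x < k → prefix f x ≡ prefix g x × prefix f (suc x) ≡ prefix g (suc x)) →
                    f ≡ g
prefix-determines {k} {f} {g} eq = at-ext f g (λ x x<k → bit-injective (at f x) (at g x)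
  (+-cancelʳ-≡ (prefix f x) _ _ (begin
    bit (at f x) + prefix f x  ≡⟨ prefix-suc f x x<k ⟨
    prefix f (suc x)           ≡⟨ proj₂ (eq x x<k) ⟩
    prefix g (suc x)           ≡⟨ prefix-suc g x x<k ⟩
    bit (at g x) + prefix g x  ≡⟨ cong (bit (at g x) +_) (proj₁ (eq x x<k)) ⟨
    bit (at g x) + prefix f x  ∎)))
  where
  open ≡-Reasoning
  bit-injective : ∀ a b → bit a ≡ bit b → a ≡ b
  bit-injective true  true  _ = refl
  bit-injective false false _ = refl

lead-run : ∀ q r → lead (replicate q true ++ false ∷ r) ≡ q
lead-run zero    r = refl
lead-run (suc q) r = cong suc (lead-run q r)

hits-cong : ∀ {k} (f : Subset k) {P P′} → (∀ x → x < k → P x ≡ P′ x) → hits f P ≡ hits f P′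
hits-cong {k} f eq = ∑-cong k (λ x x<k → cong (λ b → bit (at f x ∧ b)) (eq x x<k))

∣a-b∣<c : ∀ {a b c} → a < c → b < c → ℤ.∣ +ᶻ a ℤ.- +ᶻ b ∣ < c
∣a-b∣<c {a} {b} a<c b<c = ≤-<-trans
  (≤-trans (≤-reflexive (cong ℤ.∣_∣ (ℤ.m-n≡m⊖n a b))) (ℤ.∣m⊝n∣≤m⊔n a b)) (⊔-lub a<c b<c)

_/2^_ : ℕ → ℕ → ℕ
r /2^ q = _/_ r (2 ^ q) {{m^n≢0 2 q}}

-- Large k/n: pipelined trees

module Pipelined (k n h e : ℕ) (4^h≤n : 4 ^ h ≤ n) where

  -- `Q` is the number of elements that a round serves on each level. A child whose parent has class
  -- q uses 2 + (h + e - q) address bits, a run of q trues closed by a false, a sign bit and the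
  -- leading true of hosting: `H` in all, whatever q is. `D` allows four children for each of the at
  -- most 2^h parents per level and round with at least 2^e elements.
  Q H D : ℕ
  Q = 2 ^ (h + e)
  H = 5 + (h + e)
  D = 2 ^ h * 4

  M : ℕ → ℕ
  M u = 4 ^ (h ∸ u)

  instance
    Q≢0 : NonZero Q
    Q≢0 = m^n≢0 2 (h + e)
    D≢0 : NonZero D
    D≢0 = m*n≢0 (2 ^ h) 4 {{m^n≢0 2 h}}

  M≢0 : ∀ u → NonZero (M u)
  M≢0 u = m^n≢0 4 (h ∸ u)

  node : ℕ → ℕ → ℕ
  node u x = _/_ x (M u) {{M≢0 u}}

  M-suc : ∀ {u} → u < h → M u ≡ 4 * M (suc u)
  M-suc {u} u<h = cong (4 ^_) (+-∸-assoc 1 u<h)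

  M≤n : ∀ u → M u ≤ n
  M≤n u = ≤-trans (^-monoʳ-≤ 4 (m∸n≤m h u)) 4^h≤n

  -- the number of elements of f before the v-th node of level u
  P : Subset k → ℕ → ℕ → ℕ
  P f u v = prefix f (v * M u)

  P-mono : ∀ f u {v v′} → v ≤ v′ → P f u v ≤ P f u v′
  P-mono f u v≤v′ = prefix-mono f (*-monoˡ-≤ (M u) v≤v′)

  refine≡ : ∀ {u} → u < h → ∀ v → v * M u ≡ v * 4 * M (suc u)
  refine≡ u<h v = trans (cong (v *_) (M-suc u<h)) (sym (*-assoc v 4 _))

  P-refine : ∀ f {u} → u < h → ∀ v → P f u v ≡ P f (suc u) (v * 4)
  P-refine f u<h v = cong (prefix f) (refine≡ u<h v)

  count : Subset k → ℕ → ℕ → ℕ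
  count f u v = P f u (suc v) ∸ P f u v

  child : ∀ u → ℕ → ℕ → Bool
  child u = block (M (suc u)) {{M≢0 (suc u)}}

  AgreeAt : ℕ → ℕ → Subset k → Subset k → Set
  AgreeAt u v f g = P f u v ≡ P g u v × P f u (suc v) ≡ P g u (suc v)

  hits-child≤ : ∀ {f₀ f u} → u < h → ∀ y → AgreeAt u (y / 4) f₀ f → hits f (child u y) ≤ count f₀ u (y / 4)
  hits-child≤ {f₀} {f} {u} u<h y (lo , hi) = m+n≤o⇒m≤o∸n _ (begin
    hits f (child u y) + P f₀ u v            ≡⟨ cong (hits f (child u y) +_) (trans lo (P-refine f u<h v)) ⟩
    hits f (child u y) + P f (suc u) (v * 4) ≤⟨ +-monoʳ-≤ (hits f (child u y)) (P-mono f (suc u) (proj₁ bounds)) ⟩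
    hits f (child u y) + P f (suc u) y       ≡⟨ hits-block (M (suc u)) {{M≢0 (suc u)}} f y ⟩
    P f (suc u) (suc y)                      ≤⟨ P-mono f (suc u) (proj₂ bounds) ⟩
    P f (suc u) (suc v * 4)                  ≡⟨ trans (sym (P-refine f u<h (suc v))) (sym hi) ⟩
    P f₀ u (suc v)                           ∎)
    where
    open ≤-Reasoning
    v = y / 4
    bounds = block-bounds 4 {y} refl

  -- Node v of level u is refined at time u + P f u v / Q.
  Agree : ℕ → Subset k → Subset k → Set
  Agree t f g = (∀ v → P f 0 v ≡ P g 0 v) ×
    (∀ u v → u < h → u + P f u v / Q < t → ∀ i → i ≤ 4 → P f (suc u) (i + v * 4) ≡ P g (suc u) (i + v * 4))

  -- A node has no fewer elements before it than its parent has, and lies one level deeper. So its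
  -- boundaries are known when its turn comes.
  earlier : ∀ f u v → u < h → u + P f u (v / 4) / Q < suc u + P f (suc u) v / Q
  earlier f u v u<h = s≤s (+-monoʳ-≤ u (/-monoˡ-≤ Q (≤-trans (≤-reflexive (P-refine f u<h (v / 4)))
    (P-mono f (suc u) (m/n*n≤m v 4)))))

  known : ∀ {t} f₀ f → Agree t f₀ f → ∀ u v → u ≤ h → u + P f₀ u v / Q ≤ t → AgreeAt u v f₀ f
  known f₀ f (base , _) zero v u≤h le = base v , base (suc v)
  known {t} f₀ f (_ , agree) (suc u) v u<h le =
    subst (λ w → AgreeAt (suc u) w f₀ f) (sym (m≡m%n+[m/n]*n v 4))
      (at-i (v % 4) (<⇒≤ (m%n<n v 4)) , at-i (suc (v % 4)) (m%n<n v 4))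
    where at-i = agree u (v / 4) u<h (<-≤-trans (earlier f₀ u v u<h) le)

  -- `Agree` reads the times off its first argument. They may also be read off the second, by
  -- induction on the level: the time of a node depends only on a boundary found when its parent was
  -- refined.
  agree-time : ∀ {t} f₀ f → Agree t f₀ f → ∀ u v → u ≤ h → u + P f u v / Q ≤ t → P f₀ u v ≡ P f u v
  agree-time f₀ f (base , _) zero v u≤h le = base v
  agree-time {t} f₀ f A@(_ , agree) (suc u) v u<h le =
    subst (λ w → P f₀ (suc u) w ≡ P f (suc u) w) (sym (m≡m%n+[m/n]*n v 4))
      (agree u (v / 4) u<h (subst (λ p → u + p / Q < t) (sym (agree-time f₀ f A u (v / 4) (<⇒≤ u<h) (<⇒≤ before))) before)
        (v % 4) (<⇒≤ (m%n<n v 4)))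
    where
    before : u + P f u (v / 4) / Q < t
    before = <-≤-trans (earlier f u v u<h) le

  module Round (f₀ : Subset k) (t : ℕ) where

    time : ℕ → ℕ → ℕ
    time u y = u + P f₀ u (y / 4) / Q

    size : ℕ → ℕ → ℕ
    size u y = count f₀ u (y / 4)

    -- For nodes refined together, P f₀ u v lies in one window of length Q, in which nodes with at
    -- least 2^q elements are at least 2^q apart.
    rank : ℕ → ℕ → ℕ → ℕ
    rank q u y = (P f₀ u (y / 4) % Q) /2^ q

    index : ℕ → ℕ → ℕ → ℕ
    index q u y = y % 4 + rank q u y * 4

    rank-separates : ∀ q a b → a / Q ≡ b / Q → (a % Q) /2^ q ≡ (b % Q) /2^ q → ¬ 2 ^ q + a ≤ b
    rank-separates q a b eq eq′ le = <⇒≱ (proj₂ (block-bounds (2 ^ q) {b % Q} refl)) (begin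
      2 ^ q + (b % Q) / 2 ^ q * 2 ^ q  ≡⟨ cong (λ r → 2 ^ q + r * 2 ^ q) eq′ ⟨
      2 ^ q + (a % Q) / 2 ^ q * 2 ^ q  ≤⟨ +-monoʳ-≤ (2 ^ q) (m/n*n≤m (a % Q) (2 ^ q)) ⟩
      2 ^ q + a % Q                    ≤⟨ +-cancelʳ-≤ (a / Q * Q) _ _ (begin
        2 ^ q + a % Q + a / Q * Q        ≡⟨ +-assoc (2 ^ q) (a % Q) (a / Q * Q) ⟩
        2 ^ q + (a % Q + a / Q * Q)      ≡⟨ cong (2 ^ q +_) (m≡m%n+[m/n]*n a Q) ⟨
        2 ^ q + a                        ≤⟨ le ⟩
        b                                ≡⟨ m≡m%n+[m/n]*n b Q ⟩
        b % Q + b / Q * Q                ≡⟨ cong (λ r → b % Q + r * Q) eq ⟨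
        b % Q + a / Q * Q                ∎) ⟩
      b % Q                            ∎)
      where
      open ≤-Reasoning
      instance
        2^q≢0 : NonZero (2 ^ q)
        2^q≢0 = m^n≢0 2 q

    parent-≮ : ∀ q u {y y′} → time u y ≡ t → time u y′ ≡ t → 2 ^ q ≤ size u y →
               rank q u y ≡ rank q u y′ → ¬ y / 4 < y′ / 4
    parent-≮ q u {y} {y′} eq eq′ big same lt =
      rank-separates q (P f₀ u (y / 4)) (P f₀ u (y′ / 4)) (+-cancelˡ-≡ u _ _ (trans eq (sym eq′))) same (begin
        2 ^ q + P f₀ u (y / 4)        ≤⟨ +-monoˡ-≤ _ big ⟩
        size u y + P f₀ u (y / 4)     ≡⟨ m∸n+n≡m (P-mono f₀ u (n≤1+n (y / 4))) ⟩
        P f₀ u (suc (y / 4))          ≤⟨ P-mono f₀ u lt ⟩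
        P f₀ u (y′ / 4)               ∎)
      where open ≤-Reasoning

    index-injective : ∀ q u {y y′} → time u y ≡ t → time u y′ ≡ t → 2 ^ q ≤ size u y → 2 ^ q ≤ size u y′ →
                      index q u y ≡ index q u y′ → y ≡ y′
    index-injective q u {y} {y′} eq eq′ big big′ same = begin
      y                   ≡⟨ m≡m%n+[m/n]*n y 4 ⟩
      y % 4 + y / 4 * 4   ≡⟨ cong₂ (λ r v → r + v * 4) %≡ /≡ ⟩
      y′ % 4 + y′ / 4 * 4 ≡⟨ m≡m%n+[m/n]*n y′ 4 ⟨
      y′                  ∎
      where
      open ≡-Reasoning
      low : ∀ y → (y % 4 + rank q u y * 4) % 4 ≡ y % 4
      low y = trans ([m+kn]%n≡m%n (y % 4) (rank q u y) 4) (m%n%n≡m%n y 4)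
      %≡ : y % 4 ≡ y′ % 4
      %≡ = trans (sym (low y)) (trans (cong (_% 4) same) (low y′))
      rank≡ : rank q u y ≡ rank q u y′
      rank≡ = *-cancelʳ-≡ _ _ 4 (+-cancelˡ-≡ (y % 4) _ _ (trans same (cong (_+ rank q u y′ * 4) (sym %≡))))
      /≡ : y / 4 ≡ y′ / 4
      /≡ = ≤-antisym (≮⇒≥ (parent-≮ q u {y′} {y} eq′ eq big′ (sym rank≡))) (≮⇒≥ (parent-≮ q u {y} {y′} eq eq′ big rank≡))

    index< : ∀ q u y → q ≤ h + e → index q u y < 2 ^ (2 + (h + e ∸ q))
    index< q u y q≤ = begin-strict
      y % 4 + rank q u y * 4       <⟨ +-monoˡ-< (rank q u y * 4) (m%n<n y 4) ⟩
      suc (rank q u y) * 4         ≤⟨ *-monoˡ-≤ 4 {suc (rank q u y)} {2 ^ (h + e ∸ q)} (m<n*o⇒m/o<n {n = 2 ^ (h + e ∸ q)} (<-≤-trans (m%n<n (P f₀ u (y / 4)) Q) (≤-reflexive Q≡))) ⟩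
      2 ^ (h + e ∸ q) * 4          ≡⟨ *-comm (2 ^ (h + e ∸ q)) 4 ⟩
      4 * 2 ^ (h + e ∸ q)          ≡⟨ *-assoc 2 2 (2 ^ (h + e ∸ q)) ⟩
      2 ^ (2 + (h + e ∸ q))        ∎
      where
      open ≤-Reasoning
      instance
        2^q≢0 : NonZero (2 ^ q)
        2^q≢0 = m^n≢0 2 q
      Q≡ : Q ≡ 2 ^ (h + e ∸ q) * 2 ^ q
      Q≡ = trans (cong (2 ^_) (sym (m∸n+n≡m q≤))) (^-distribˡ-+-* 2 (h + e ∸ q) q)

    -- Nodes with at least 2^e elements: their children are queried directly.

    record Big (u r y : ℕ) : Set where
      constructor big
      field
        level<  : u < h
        time≡   : time u y ≡ t
        size≥   : 2 ^ e ≤ size u y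
        index≡  : index e u y ≡ r

    big? : ∀ u r y → Dec (Big u r y)
    big? u r y = map′ (λ (a , b , c , d) → big a b c d) (λ (big a b c d) → a , b , c , d)
      ((u <? h) ×-dec (time u y ≟ t) ×-dec (2 ^ e ≤? size u y) ×-dec (index e u y ≟ r))

    big-unique : ∀ {u r y y′} → Big u r y → Big u r y′ → y ≡ y′
    big-unique {u} {r} {y} {y′} (big _ eq big₁ i) (big _ eq′ big₂ i′) = index-injective e u {y} {y′} eq eq′ big₁ big₂ (trans i (sym i′))

    bigQuery : ℕ → ℕ → Bool
    bigQuery N x = does (big? (N / D) (N % D) (node (suc (N / D)) x))

    big≡child : ∀ N {y} → Big (N / D) (N % D) y → ∀ x → bigQuery N x ≡ child (N / D) y x
    big≡child N {y} b x = ≡true-ext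
      (λ eq → dec-true (node (suc (N / D)) x ≟ y) (big-unique (does⇒ (big? _ _ _) eq) b))
      (λ eq → dec-true (big? _ _ _) (subst (Big (N / D) (N % D)) (sym (does⇒ (node (suc (N / D)) x ≟ y) eq)) b))

    #bigQuery≤ : ∀ N → # k (bigQuery N) ≤ n
    #bigQuery≤ N with any<? k (bigQuery N)
    ... | inj₂ never = ≤-trans (≤-reflexive (#-false k never)) z≤n
    ... | inj₁ (x₀ , _ , eq) = begin
      # k (bigQuery N)         ≡⟨ ∑-cong k (λ x _ → cong bit (big≡child N (does⇒ (big? _ _ _) eq) x)) ⟩
      # k (child (N / D) (node (suc (N / D)) x₀)) ≤⟨ #block≤ (M (suc (N / D))) {{M≢0 (suc (N / D))}} k _ ⟩
      M (suc (N / D))          ≤⟨ M≤n (suc (N / D)) ⟩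
      n                        ∎
      where open ≤-Reasoning

    -- The other nodes: the bits of the index of a child select its instance and its row,
    -- whose leading trues make room for the possible values of its number of elements.

    class : ℕ → ℕ → ℕ
    class u y = ⌊log₂ size u y ⌋

    bits : ℕ → ℕ → List Bool
    bits u y = toBits (2 + (h + e ∸ class u y)) (index (class u y) u y)

    record Hosted (y : ℕ) (p j : List Bool) : Set where
      constructor hosting
      field
        level< : length p < h
        time≡  : time (length p) y ≡ t
        size>0 : 1 ≤ size (length p) y
        size<  : size (length p) y < 2 ^ e
        path≡  : p ≡ take (length p) (bits (length p) y)
        row≡   : j ≡ replicate (class (length p) y) true ++ false ∷ drop (length p) (bits (length p) y)

    hosted? : ∀ y p j → Dec (Hosted y p j)
    hosted? y p j = map′ (λ (a , b , c , d , e , f) → hosting a b c d e f) (λ (hosting a b c d e f) → a , b , c , d , e , f)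
      ((length p <? h) ×-dec (time (length p) y ≟ t) ×-dec (1 ≤? size (length p) y) ×-dec
       (size (length p) y <? 2 ^ e) ×-dec ≡-dec Bool._≟_ p _ ×-dec ≡-dec Bool._≟_ j _)

    class<e : ∀ {u y} → 1 ≤ size u y → size u y < 2 ^ e → class u y < e
    class<e {u} {y} pos small = ≰⇒> (λ le → <⇒≱ small (≤-trans (^-monoʳ-≤ 2 le) (2^⌊log₂n⌋≤n (size u y) pos)))

    class≤h+e : ∀ {u y} → 1 ≤ size u y → size u y < 2 ^ e → class u y ≤ h + e
    class≤h+e {u} {y} pos small = ≤-trans (<⇒≤ (class<e {u} {y} pos small)) (m≤n+m e h)

    hosted-lead : ∀ {y p j} → Hosted y p j → lead j ≡ class (length p) y
    hosted-lead {y} {p} H = trans (cong lead (Hosted.row≡ H)) (lead-run (class (length p) y) _)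

    -- The run of trues in `j` reveals the class and thus the length of the address, whose bits are
    -- `p` followed by the rest of `j`; within a level, round and class the index identifies the
    -- child.
    hosted-unique : ∀ {y y′ p j} → Hosted y p j → Hosted y′ p j → y ≡ y′
    hosted-unique {y} {y′} {p} {j} H H′ = index-injective q u {y} {y′} (Hosted.time≡ H) (Hosted.time≡ H′)
      (2^⌊log₂n⌋≤n _ (Hosted.size>0 H)) (subst (λ c → 2 ^ c ≤ size u y′) (sym class≡) (2^⌊log₂n⌋≤n _ (Hosted.size>0 H′)))
      (toBits-injective (2 + (h + e ∸ q)) (index< q u y q≤) (index< q u y′ q≤) bits≡)
      where
      u = length p
      q = class u y
      q≤ = class≤h+e {u} {y} (Hosted.size>0 H) (Hosted.size< H)
      class≡ : class u y ≡ class u y′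
      class≡ = trans (sym (hosted-lead H)) (hosted-lead H′)
      tails : drop u (bits u y) ≡ drop u (bits u y′)
      tails = ∷-injectiveʳ (++-cancelˡ (replicate q true) _ _
        (trans (sym (Hosted.row≡ H)) (trans (Hosted.row≡ H′)
          (cong (λ c → replicate c true ++ false ∷ drop u (bits u y′)) (sym class≡)))))
      bits≡ : toBits (2 + (h + e ∸ q)) (index q u y) ≡ toBits (2 + (h + e ∸ q)) (index q u y′)
      bits≡ = trans (sym (take++drop≡id u (bits u y))) (trans (cong₂ _++_
        (trans (sym (Hosted.path≡ H)) (Hosted.path≡ H′)) tails)
        (trans (take++drop≡id u (bits u y′))
          (cong (λ c → toBits (2 + (h + e ∸ c)) (index c u y′)) (sym class≡))))

    label : ℕ → List Bool → List Bool → Bool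
    label x p j = does (hosted? (node (suc (length p)) x) p j)

    label⇒ : ∀ x p j → label x p j ≡ true → Hosted (node (suc (length p)) x) p j
    label⇒ x p j = does⇒ (hosted? (node (suc (length p)) x) p j)

    label≡child : ∀ {y p j} → Hosted y p j → ∀ x → label x p j ≡ child (length p) y x
    label≡child {y} {p} {j} H x = ≡true-ext
      (λ eq → dec-true (node (suc (length p)) x ≟ y) (hosted-unique (label⇒ x p j eq) H))
      (λ eq → dec-true (hosted? _ p j)
        (subst (λ y → Hosted y p j) (sym (does⇒ (node (suc (length p)) x ≟ y) eq)) H))

    node-start : ∀ x u u′ → u ≤ u′ → u′ < h → P f₀ u (node (suc u) x / 4) ≤ P f₀ u′ (node (suc u′) x / 4)
    node-start x u u′ u≤u′ u′<h = prefix-mono f₀ (begin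
      node (suc u) x / 4 * M u              ≡⟨ cong (node (suc u) x / 4 *_) Mu≡ ⟩
      node (suc u) x / 4 * (4 ^ d * M u′)   ≡⟨ *-assoc (node (suc u) x / 4) (4 ^ d) (M u′) ⟨
      node (suc u) x / 4 * 4 ^ d * M u′     ≤⟨ *-monoˡ-≤ (M u′) (begin
        node (suc u) x / 4 * 4 ^ d            ≡⟨ m*n/n≡m _ (M u′) {{M≢0 u′}} ⟨
        node u′ (node (suc u) x / 4 * 4 ^ d * M u′) ≤⟨ /-monoˡ-≤ (M u′) {{M≢0 u′}} (begin
          node (suc u) x / 4 * 4 ^ d * M u′     ≡⟨ *-assoc (node (suc u) x / 4) (4 ^ d) (M u′) ⟩
          node (suc u) x / 4 * (4 ^ d * M u′)   ≡⟨ cong (node (suc u) x / 4 *_) Mu≡ ⟨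
          node (suc u) x / 4 * M u              ≡⟨ refine≡ (≤-<-trans u≤u′ u′<h) (node (suc u) x / 4) ⟩
          node (suc u) x / 4 * 4 * M (suc u)    ≤⟨ *-monoˡ-≤ (M (suc u)) (m/n*n≤m (node (suc u) x) 4) ⟩
          node (suc u) x * M (suc u)            ≤⟨ m/n*n≤m x (M (suc u)) {{M≢0 (suc u)}} ⟩
          x                                    ∎) ⟩
        node u′ x                            ≡⟨ parent u′<h ⟩
        node (suc u′) x / 4                   ∎) ⟩
      node (suc u′) x / 4 * M u′            ∎)
      where
      open ≤-Reasoning
      d = u′ ∸ u
      Mu≡ : M u ≡ 4 ^ d * M u′
      Mu≡ = trans (cong (4 ^_) (trans (cong (_∸ u) (sym (m+[n∸m]≡n (<⇒≤ u′<h))))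
              (trans (cong (λ w → w + (h ∸ u′) ∸ u) (sym (m+[n∸m]≡n u≤u′)))
                (trans (cong (_∸ u) (+-assoc u d (h ∸ u′))) (m+n∸m≡n u (d + (h ∸ u′)))))))
            (^-distribˡ-+-* 4 d (h ∸ u′))
      parent : ∀ {u} → u < h → node u x ≡ node (suc u) x / 4
      parent {u} u<h = trans (/-congʳ {{M≢0 u}} {{M*4≢0}} (trans (M-suc u<h) (*-comm 4 (M (suc u)))))
                             (sym (m/n/o≡m/[n*o] x (M (suc u)) 4 {{M≢0 (suc u)}} {{_}} {{M*4≢0}}))
        where
        M*4≢0 : NonZero (M (suc u) * 4)
        M*4≢0 = m*n≢0 (M (suc u)) 4 {{M≢0 (suc u)}}

    -- Along the nodes that contain `x` the times increase strictly, so a round concerns `x` on at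
    -- most one level. This is what allows all levels to share one pass.
    time-mono : ∀ x u u′ → u < u′ → u′ < h → time u (node (suc u) x) < time u′ (node (suc u′) x)
    time-mono x u u′ u<u′ u′<h = +-mono-<-≤ u<u′ (/-monoˡ-≤ Q (node-start x u u′ (<⇒≤ u<u′) u′<h))

    single-path : ∀ x → SinglePath (label x)
    single-path x {p} {j} {p′} {j′} eq eq′ =
      trans (Hosted.path≡ H₁) (trans (cong (λ u → take u (bits u (node (suc u) x))) same) (sym (Hosted.path≡ H₂)))
      where
      H₁ = label⇒ x p j eq
      H₂ = label⇒ x p′ j′ eq′
      times : time (length p) (node (suc (length p)) x) ≡ time (length p′) (node (suc (length p′)) x)
      times = trans (Hosted.time≡ H₁) (sym (Hosted.time≡ H₂))
      same : length p ≡ length p′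
      same = ≤-antisym (≮⇒≥ (λ lt → <-irrefl (sym times) (time-mono x _ _ lt (Hosted.level< H₁))))
                       (≮⇒≥ (λ lt → <-irrefl times (time-mono x _ _ lt (Hosted.level< H₂))))

    -- A child hosted at depth u has size 4^(h-u-1), exactly the entry of the profile: levels of the
    -- trees are matched with depths of the scheme.
    #label≤ : ∀ p j → # k (λ x → label x p j) ≤ profile 1 h (length p)
    #label≤ p j with any<? k (λ x → label x p j)
    ... | inj₂ never = ≤-trans (≤-reflexive (#-false k never)) z≤n
    ... | inj₁ (x₀ , _ , eq) = begin
      # k (λ x → label x p j)        ≡⟨ ∑-cong k (λ x _ → cong bit (label≡child H₀ x)) ⟩
      # k (child (length p) _)       ≤⟨ #block≤ (M (suc (length p))) {{M≢0 (suc (length p))}} k _ ⟩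
      M (suc (length p))             ≡⟨ *-identityˡ _ ⟨
      1 * M (suc (length p))         ≡⟨ profile≡ 1 h (length p) (Hosted.level< H₀) ⟨
      profile 1 h (length p)         ∎
      where
      open ≤-Reasoning
      H₀ = label⇒ x₀ p j eq

    bigQueries : List (ℕ → Bool)
    bigQueries = applyUpTo bigQuery (h * D)

    queries : List (ℕ → Bool)
    queries = pass k H label ++ bigQueries

    length-queries : length queries ≡ 2 * 2 ^ H + h * D
    length-queries = trans (length-++ (pass k H label))
      (cong₂ _+_ (length-pass k H label) (length-applyUpTo bigQuery (h * D)))

    queries-sizes : All (λ P → # k P ≤ n) queries
    queries-sizes = All.++⁺
      (pass-sizes k H label 1 h #label≤
        (≤-trans (≤-reflexive (*-identityˡ (4 ^ h))) (≤-trans 4^h≤n (m≤n*m n 2))))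
      (All.applyUpTo⁺₂ bigQuery (h * D) #bigQuery≤)

    module _ {f g : Subset k} (Aᶠ : Agree t f₀ f) (Aᵍ : Agree t f₀ g) (same : Same queries f g) where

      known-at : ∀ f → Agree t f₀ f → ∀ {u y} → u < h → time u y ≡ t → AgreeAt u (y / 4) f₀ f
      known-at f A {u} {y} u<h eq = known f₀ f A u (y / 4) (<⇒≤ u<h) (≤-reflexive eq)

      hosted-content : ∀ {y p j} → Hosted y p j → content k H label f g p j ≡
                       +ᶻ hits f (child (length p) y) ℤ.- +ᶻ hits g (child (length p) y)
      hosted-content {y} {p} {j} H = trans
        (∑ᶻ-cong k (λ x _ → cong (λ b → +ᶻ bit b ℤ.* diff f g x) (label≡child H x)))
        (∑-diff k (at f) (at g) (child (length p) y))

      -- Both numbers are at most that of the parent, which is below 2^(q+1) for its class q, and q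
      -- is the number of leading trues of the row.
      pass-hosts : Hosts H (content k H label f g)
      pass-hosts p s len even j ∣j∣ with any<? k (λ x → label x p j)
      ... | inj₂ never = subst (λ c → ℤ.∣ c ∣ < 2 ^ suc (lead j)) (sym (trans (∑ᶻ-cong k (λ x x<k → trans
              (cong (λ b → +ᶻ bit b ℤ.* diff f g x) (never x x<k)) (ℤ.*-zeroˡ (diff f g x)))) (∑ᶻ-0 k)))
              (m^n>0 2 (suc (lead j)))
      ... | inj₁ (x₀ , _ , eq) = subst (λ c → ℤ.∣ c ∣ < 2 ^ suc (lead j)) (sym (hosted-content H₀))
              (∣a-b∣<c (below f Aᶠ) (below g Aᵍ))
        where
        y₀ = node (suc (length p)) x₀
        H₀ = label⇒ x₀ p j eq
        below : ∀ f → Agree t f₀ f → hits f (child (length p) y₀) < 2 ^ suc (lead j)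
        below f A = ≤-<-trans
          (hits-child≤ {f₀} {f} (Hosted.level< H₀) y₀ (known-at f A {y = y₀} (Hosted.level< H₀) (Hosted.time≡ H₀)))
          (subst (λ c → size (length p) y₀ < 2 ^ suc c) (sym (hosted-lead H₀)) (n<2^1+⌊log₂n⌋ _))

      child-small : ∀ u y → u < h → time u y ≡ t → 1 ≤ size u y → size u y < 2 ^ e →
                    hits f (child u y) ≡ hits g (child u y)
      child-small u y u<h eq pos small = subst (λ u → hits f (child u y) ≡ hits g (child u y)) ∣p∣
        (ℤ.+-injective (ℤ.i-j≡0⇒i≡j _ _ (trans (sym (hosted-content hosted₀))
          (pass-determines k H label single-path {f} {g} (All.++⁻ˡ (pass k H label) same) pass-hosts p j len))))
        where
        q = class u y
        L = 2 + (h + e ∸ q)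
        q<e = class<e {u} {y} pos small
        p = take u (bits u y)
        j = replicate q true ++ false ∷ drop u (bits u y)
        -- The class is below `e`, so the address has more than `h` bits, enough to spell a path of
        -- length `u`.
        u≤L : u ≤ L
        u≤L = ≤-trans (<⇒≤ u<h) (≤-trans (≤-trans (m≤m+n h (e ∸ q)) (≤-reflexive (sym (+-∸-assoc h (<⇒≤ q<e))))) (m≤n+m _ 2))
        ∣p∣ : length p ≡ u
        ∣p∣ = trans (length-take u (bits u y)) (m≤n⇒m⊓n≡m (≤-trans u≤L (≤-reflexive (sym (length-toBits L (index q u y))))))
        hosted₀ : Hosted y p j
        hosted₀ = hosting (subst (_< h) (sym ∣p∣) u<h) (trans (cong (λ v → time v y) ∣p∣) eq)
          (subst (λ v → 1 ≤ size v y) (sym ∣p∣) pos) (subst (λ v → size v y < 2 ^ e) (sym ∣p∣) small)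
          (cong (λ v → take v (bits v y)) (sym ∣p∣))
          (cong (λ v → replicate (class v y) true ++ false ∷ drop v (bits v y)) (sym ∣p∣))
        len : length p + (2 + length j) ≡ H
        len = begin
          length p + (2 + length j)       ≡⟨ cong₂ (λ a b → a + (2 + b)) ∣p∣ (trans (length-++ (replicate q true))
                                               (cong₂ (λ a b → a + suc b) (length-replicate q)
                                                 (trans (length-drop u (bits u y)) (cong (_∸ u) (length-toBits L (index q u y)))))) ⟩
          u + (2 + (q + suc (L ∸ u)))     ≡⟨ rearrange u q (L ∸ u) ⟩
          3 + q + (u + (L ∸ u))           ≡⟨ cong (3 + q +_) (m+[n∸m]≡n u≤L) ⟩
          3 + q + L                       ≡⟨ rearrange′ q (h + e ∸ q) ⟩
          5 + (q + (h + e ∸ q))           ≡⟨ cong (5 +_) (m+[n∸m]≡n (class≤h+e {u} {y} pos small)) ⟩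
          H                               ∎
          where
          open ≡-Reasoning
          rearrange : ∀ u q d → u + (2 + (q + suc d)) ≡ 3 + q + (u + d)
          rearrange = ℕ-Solver.solve-∀
          rearrange′ : ∀ q d → 3 + q + (2 + d) ≡ 5 + (q + d)
          rearrange′ = ℕ-Solver.solve-∀

      child-big : ∀ u y → u < h → time u y ≡ t → 2 ^ e ≤ size u y → hits f (child u y) ≡ hits g (child u y)
      child-big u y u<h eq size≥ = subst (λ u → hits f (child u y) ≡ hits g (child u y)) N/D≡u (begin
        hits f (child (N / D) y)  ≡⟨ hits-cong f (λ x _ → big≡child N big₀ x) ⟨
        hits f (bigQuery N)       ≡⟨ All.applyUpTo⁻ bigQuery (h * D) (All.++⁻ʳ (pass k H label) same) N< ⟩
        hits g (bigQuery N)       ≡⟨ hits-cong g (λ x _ → big≡child N big₀ x) ⟩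
        hits g (child (N / D) y)  ∎)
        where
        open ≡-Reasoning
        r = index e u y
        r<D : r < D
        r<D = subst (r <_) (trans (cong (λ d → 2 ^ (2 + d)) (m+n∸n≡m h e)) (trans (sym (*-assoc 2 2 (2 ^ h))) (*-comm 4 (2 ^ h))))
                    (index< e u y (m≤n+m e h))
        N = r + u * D
        N/D≡u : N / D ≡ u
        N/D≡u = x/M≡y D (m≤n+m (u * D) r) (+-monoˡ-< (u * D) r<D)
        N%D≡r : N % D ≡ r
        N%D≡r = trans ([m+kn]%n≡m%n r u D) (m<n⇒m%n≡m r<D)
        N< : N < h * D
        N< = <-≤-trans (+-monoˡ-< (u * D) r<D) (*-monoˡ-≤ D u<h)
        big₀ : Big (N / D) (N % D) y
        big₀ = subst₂ (λ u r → Big u r y) (sym N/D≡u) (sym N%D≡r) (big u<h eq size≥ refl)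

      child-same : ∀ u y → u < h → time u y ≡ t → hits f (child u y) ≡ hits g (child u y)
      child-same u y u<h eq with 2 ^ e ≤? size u y
      ... | yes large = child-big u y u<h eq large
      ... | no  ¬large with size u y in empty
      ...   | suc c = child-small u y u<h eq (subst (1 ≤_) (sym empty) (s≤s z≤n)) (subst (_< 2 ^ e) (sym empty) (≰⇒> ¬large))
      -- An empty parent is hosted nowhere; its children are empty for every candidate.
      ...   | zero  = trans (none-hit f Aᶠ) (sym (none-hit g Aᵍ))
        where
        none-hit : ∀ f → Agree t f₀ f → hits f (child u y) ≡ 0
        none-hit f A = n≤0⇒n≡0 (≤-trans (hits-child≤ {f₀} {f} u<h y (known-at f A {y = y} u<h eq)) (≤-reflexive empty))

      boundaries : ∀ u v → u < h → u + P f₀ u v / Q ≡ t → ∀ i → i ≤ 4 → P f (suc u) (i + v * 4) ≡ P g (suc u) (i + v * 4)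
      boundaries u v u<h eq zero    _   = begin
        P f (suc u) (v * 4)  ≡⟨ P-refine f u<h v ⟨
        P f u v              ≡⟨ proj₁ (known f₀ f Aᶠ u v (<⇒≤ u<h) (≤-reflexive eq)) ⟨
        P f₀ u v             ≡⟨ proj₁ (known f₀ g Aᵍ u v (<⇒≤ u<h) (≤-reflexive eq)) ⟩
        P g u v              ≡⟨ P-refine g u<h v ⟩
        P g (suc u) (v * 4)  ∎
        where open ≡-Reasoning
      boundaries u v u<h eq (suc i) i<4 = begin
        P f (suc u) (suc y)                       ≡⟨ hits-block (M (suc u)) {{M≢0 (suc u)}} f y ⟨
        hits f (child u y) + P f (suc u) y        ≡⟨ cong₂ _+_ (child-same u y u<h (trans (cong (λ w → u + P f₀ u w / Q) y/4≡v) eq))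
                                                              (boundaries u v u<h eq i (<⇒≤ i<4)) ⟩
        hits g (child u y) + P g (suc u) y        ≡⟨ hits-block (M (suc u)) {{M≢0 (suc u)}} g y ⟩
        P g (suc u) (suc y)                       ∎
        where
        open ≡-Reasoning
        y = i + v * 4
        y/4≡v : y / 4 ≡ v
        y/4≡v = x/M≡y 4 (m≤n+m (v * 4) i) (+-monoˡ-< (v * 4) i<4)

  -- The times now come from the new representative `f₁`; for nodes due by round `t` they agree with
  -- those of `f₀`, which chose the queries.
  step : ∀ t {f₀ f f₁} → ∣ f₀ ∣ ≤ n → ∣ f ∣ ≤ n → ∣ f₁ ∣ ≤ n → Agree t f₀ f → Agree t f₀ f₁ →
         Same (Round.queries f₀ t) f₁ f → Agree (suc t) f₁ f
  step t {f₀} {f} {f₁} _ _ _ A@(base , agree) A₁@(base₁ , agree₁) same =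
    (λ v → trans (sym (base₁ v)) (base v)) , refined
    where
    refined : ∀ u v → u < h → u + P f₁ u v / Q < suc t → ∀ i → i ≤ 4 → P f₁ (suc u) (i + v * 4) ≡ P f (suc u) (i + v * 4)
    refined u v u<h (s≤s le) i i≤4
      with m≤n⇒m<n∨m≡n (subst (λ p → u + p / Q ≤ t) (sym (agree-time f₀ f₁ A₁ u v (<⇒≤ u<h) le)) le)
    ... | inj₁ lt = trans (sym (agree₁ u v u<h lt i i≤4)) (agree u v u<h lt i i≤4)
    ... | inj₂ eq = Round.boundaries f₀ t {f₁} {f} A₁ A same u v u<h eq i i≤4

  rounds# : ℕ
  rounds# = h + n / Q

  -- Nodes of level `h` are single elements, and since a prefix count is at most `n`, all their
  -- boundaries are known by time `h + n / Q`.
  final : ∀ {f₀ f} → ∣ f₀ ∣ ≤ n → ∣ f ∣ ≤ n → Agree (rounds# + 0) f₀ f → f₀ ≡ f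
  final {f₀} {f} f₀≤n _ A = prefix-determines {f = f₀} {g = f} (λ x _ →
    subst₂ (λ b b′ → prefix f₀ b ≡ prefix f b × prefix f₀ b′ ≡ prefix f b′) (unit x) (unit (suc x))
      (known f₀ f A h x ≤-refl (≤-trans (+-monoʳ-≤ h (/-monoˡ-≤ Q (≤-trans (hits≤∣f∣ f₀ _) f₀≤n)))
                                 (≤-reflexive (sym (+-identityʳ rounds#))))))
    where
    unit : ∀ x → x * M h ≡ x
    unit x = trans (cong (λ d → x * 4 ^ d) (n∸n≡0 h)) (*-identityʳ x)

  queries# : ℕ
  queries# = blockCount (M 0) {{M≢0 0}} k + rounds# * (2 * 2 ^ H + h * D)

  solvable : SolvableIn k n queries# (Initial k n)
  solvable = subst (λ l → SolvableIn k n (l + rounds# * (2 * 2 ^ H + h * D)) (Initial k n))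
    (length-applyUpTo (block (M 0) {{M≢0 0}}) (blockCount (M 0) {{M≢0 0}} k))
    (askAll (blockQueries (M 0) {{M≢0 0}} k) _
      (All.applyUpTo⁺₂ (block (M 0) {{M≢0 0}}) (blockCount (M 0) {{M≢0 0}} k) (λ v → ≤-trans (#block≤ (M 0) {{M≢0 0}} k v) (M≤n 0)))
      initial? (λ f₀ f₀≤n →
        rounds Agree (λ t f₀ → Round.queries f₀ t) (2 * 2 ^ H + h * D)
          (λ t f₀ _ → Round.queries-sizes f₀ t) (λ t f₀ → ≤-reflexive (Round.length-queries f₀ t)) step
          rounds# 0 final f₀ (λ f → initial? f ×-dec same? (blockQueries (M 0) {{M≢0 0}} k) f₀ f) (λ f (f≤n , _) → f≤n) f₀≤n
          (λ f (_ , same) → blockQueries-determine (M 0) {{M≢0 0}} {f = f₀} {g = f} same , λ _ _ _ ())))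

-- Number of queries

m/n≤o : ∀ {m n o} .{{_ : NonZero n}} → m ≤ o * n → m / n ≤ o
m/n≤o {m} {n} {o} le = ≤-trans (/-monoˡ-≤ n le) (≤-reflexive (m*n/n≡m o n))

module DenseCost (k n s′ a : ℕ) .{{_ : NonZero a}} (s≤a : suc s′ ≤ a) (2^32a≤n : 2 ^ (32 * a) ≤ n)
                 (k≤ : k ≤ 2 * 2 ^ suc s′ * n) where

  open Dense k n s′ a s≤a 2^32a≤n

  open ≤-Reasoning

  1≤a : 1 ≤ a
  1≤a = >-nonZero⁻¹ a

  2^≤n : ∀ {i j} → i ≤ j * a → j ≤ 32 → 2 ^ i ≤ n
  2^≤n i≤ j≤ = ≤-trans (^-monoʳ-≤ 2 (≤-trans i≤ (*-monoˡ-≤ a j≤))) 2^32a≤n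

  blocks≤ : 2 ^ a * N ≤ 3 * n
  blocks≤ = begin
    2 ^ a * suc (k / W)       ≡⟨ *-suc (2 ^ a) (k / W) ⟩
    2 ^ a + 2 ^ a * (k / W)   ≤⟨ +-mono-≤ (2^≤n {a} {1} (≤-reflexive (sym (*-identityˡ a))) (s≤s z≤n)) (*-cancelˡ-≤ (2 ^ s) {{m^n≢0 2 s}} (begin
      2 ^ s * (2 ^ a * (k / W)) ≡⟨ *-assoc (2 ^ s) (2 ^ a) (k / W) ⟨
      2 ^ s * 2 ^ a * (k / W)   ≡⟨ cong (_* (k / W)) (^-distribˡ-+-* 2 s a) ⟨
      W * (k / W)               ≡⟨ *-comm W (k / W) ⟩
      k / W * W                 ≤⟨ m/n*n≤m k W ⟩
      k                         ≤⟨ k≤ ⟩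
      2 * 2 ^ s * n             ≡⟨ rearrange (2 ^ s) n ⟩
      2 ^ s * (2 * n)           ∎)) ⟩
    3 * n                     ∎
    where
    rearrange : ∀ p n → 2 * p * n ≡ p * (2 * n)
    rearrange = ℕ-Solver.solve-∀

  n≤s*n : n ≤ s * n
  n≤s*n = m≤m+n n (s′ * n)

  costBound≤ : costBound ≤ 8 * (s * n)
  costBound≤ = begin
    2 * s * n + 2 * 2 ^ a * N       ≡⟨ cong (2 * s * n +_) (*-assoc 2 (2 ^ a) N) ⟩
    2 * s * n + 2 * (2 ^ a * N)     ≤⟨ +-monoʳ-≤ (2 * s * n) (*-monoʳ-≤ 2 (≤-trans blocks≤ (*-monoʳ-≤ 3 n≤s*n))) ⟩
    2 * s * n + 2 * (3 * (s * n))   ≡⟨ collect s n ⟩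
    8 * (s * n)                     ∎
    where
    collect : ∀ s n → 2 * s * n + 2 * (3 * (s * n)) ≡ 8 * (s * n)
    collect = ℕ-Solver.solve-∀

  rows≡ : 2 * 2 ^ H ≡ 16 * (2 ^ a * δ)
  rows≡ = begin-equality
    2 * 2 ^ (2 + (μ + a))          ≡⟨ cong (2 ^_) (exponent a) ⟩
    2 ^ (4 + (a + (3 * a + 3)))    ≡⟨ ^-distribˡ-+-* 2 4 (a + (3 * a + 3)) ⟩
    16 * 2 ^ (a + (3 * a + 3))     ≡⟨ cong (16 *_) (^-distribˡ-+-* 2 a (3 * a + 3)) ⟩
    16 * (2 ^ a * δ)               ∎
    where
    exponent : ∀ a → suc (2 + (suc (3 * a + 3) + a)) ≡ 4 + (a + (3 * a + 3))
    exponent = ℕ-Solver.solve-∀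

  -- Pays for the one pass that is added when the number of passes is rounded up.
  onePass : a * (16 * (2 ^ a * δ)) ≤ n
  onePass = begin
    a * (16 * (2 ^ a * δ))              ≤⟨ *-monoˡ-≤ (16 * (2 ^ a * δ)) (<⇒≤ (n<2^n a)) ⟩
    2 ^ a * (16 * (2 ^ a * δ))          ≡⟨ cong (λ p → 2 ^ a * (16 * p)) (^-distribˡ-+-* 2 a (3 * a + 3)) ⟨
    2 ^ a * (16 * 2 ^ (a + (3 * a + 3)))   ≡⟨ cong (2 ^ a *_) (^-distribˡ-+-* 2 4 (a + (3 * a + 3))) ⟨
    2 ^ a * 2 ^ (4 + (a + (3 * a + 3))) ≡⟨ ^-distribˡ-+-* 2 a (4 + (a + (3 * a + 3))) ⟨
    2 ^ (a + (4 + (a + (3 * a + 3))))   ≤⟨ 2^≤n {j = 12} exponent (m≤m+n 12 20) ⟩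
    n                                   ∎
    where
    exponent : a + (4 + (a + (3 * a + 3))) ≤ 12 * a
    exponent = begin
      a + (4 + (a + (3 * a + 3)))   ≡⟨ collect a ⟩
      5 * a + 7 * 1                 ≤⟨ +-monoʳ-≤ (5 * a) (*-monoʳ-≤ 7 1≤a) ⟩
      5 * a + 7 * a                 ≡⟨ *-distribʳ-+ a 5 7 ⟨
      12 * a                        ∎
      where
      collect : ∀ a → a + (4 + (a + (3 * a + 3))) ≡ 5 * a + 7 * 1
      collect = ℕ-Solver.solve-∀

  fullPasses : a * (costBound / δ / 2 ^ a / a * (16 * (2 ^ a * δ))) ≤ 128 * (s * n)
  fullPasses = begin
    a * (G * (16 * (2 ^ a * δ)))      ≡⟨ rearrange a G (2 ^ a) δ ⟩
    16 * (G * a * 2 ^ a * δ)          ≤⟨ *-monoʳ-≤ 16 (begin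
      G * a * 2 ^ a * δ                 ≤⟨ *-monoˡ-≤ δ (*-monoˡ-≤ (2 ^ a) (m/n*n≤m (costBound / δ / 2 ^ a) a)) ⟩
      costBound / δ / 2 ^ a * 2 ^ a * δ ≤⟨ *-monoˡ-≤ δ (m/n*n≤m (costBound / δ) (2 ^ a)) ⟩
      costBound / δ * δ                 ≤⟨ m/n*n≤m costBound δ ⟩
      costBound                         ≤⟨ costBound≤ ⟩
      8 * (s * n)                       ∎) ⟩
    16 * (8 * (s * n))                ≡⟨ *-assoc 16 8 (s * n) ⟨
    128 * (s * n)                     ∎
    where
    G = costBound / δ / 2 ^ a / a
    rearrange : ∀ a g p d → a * (g * (16 * (p * d))) ≡ 16 * (g * a * p * d)
    rearrange = ℕ-Solver.solve-∀

  total : a * queries# ≤ 132 * (s * n)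
  total = begin
    a * (N + (suc G * (2 * 2 ^ H) + 0))    ≡⟨ cong (λ r → a * (N + (suc G * r + 0))) rows≡ ⟩
    a * (N + (suc G * r + 0))              ≡⟨ expand a N G r ⟩
    a * N + (a * r + a * (G * r))          ≤⟨ +-mono-≤ (≤-trans (*-monoˡ-≤ N (<⇒≤ (n<2^n a))) (≤-trans blocks≤ (*-monoʳ-≤ 3 n≤s*n)))
                                                (+-mono-≤ (≤-trans onePass n≤s*n) fullPasses) ⟩
    3 * (s * n) + (s * n + 128 * (s * n))  ≡⟨ collect (s * n) ⟩
    132 * (s * n)                          ∎
    where
    G = costBound / δ / 2 ^ a / a
    r = 16 * (2 ^ a * δ)
    expand : ∀ a n g r → a * (n + ((1 + g) * r + 0)) ≡ a * n + (a * r + a * (g * r))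
    expand = ℕ-Solver.solve-∀
    collect : ∀ x → 3 * x + (x + 128 * x) ≡ 132 * x
    collect = ℕ-Solver.solve-∀

module PipelinedCost (k n m h e : ℕ) (4^h≤n : 4 ^ h ≤ n) (n≤4*4^h : n ≤ 4 * 4 ^ h) (1≤m : 1 ≤ m)
                     (k≤ : k ≤ (1 + m) * n) (2e≤h : 2 * e ≤ h) (h≤1+2e : h ≤ 1 + 2 * e) where

  open Pipelined k n h e 4^h≤n

  open ≤-Reasoning

  blocks≤ : blockCount (M 0) {{M≢0 0}} k ≤ 9 * m
  blocks≤ = begin
    1 + node 0 k      ≤⟨ +-mono-≤ 1≤m (m/n≤o {k} {M 0} {4 * (1 + m)} {{M≢0 0}} (begin
      k                     ≤⟨ k≤ ⟩
      (1 + m) * n           ≤⟨ *-monoʳ-≤ (1 + m) n≤4*4^h ⟩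
      (1 + m) * (4 * 4 ^ h) ≡⟨ rearrange (1 + m) (4 ^ h) ⟩
      4 * (1 + m) * 4 ^ h   ∎)) ⟩
    m + 4 * (1 + m)   ≤⟨ +-monoʳ-≤ m (*-monoʳ-≤ 4 (+-monoˡ-≤ m 1≤m)) ⟩
    m + 4 * (m + m)   ≡⟨ collect m ⟩
    9 * m             ∎
    where
    rearrange : ∀ a q → a * (4 * q) ≡ 4 * a * q
    rearrange = ℕ-Solver.solve-∀
    collect : ∀ m → m + 4 * (m + m) ≡ 9 * m
    collect = ℕ-Solver.solve-∀

  h≤2*2^e : h ≤ 2 * 2 ^ e
  h≤2*2^e = begin
    h              ≤⟨ h≤1+2e ⟩
    1 + 2 * e      ≤⟨ n≤1+n (1 + 2 * e) ⟩
    2 + 2 * e      ≡⟨ *-suc 2 e ⟨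
    2 * suc e      ≤⟨ *-monoʳ-≤ 2 (n<2^n e) ⟩
    2 * 2 ^ e      ∎

  Q≡ : Q ≡ 2 ^ h * 2 ^ e
  Q≡ = ^-distribˡ-+-* 2 h e

  round≤ : 2 * 2 ^ H + h * D ≤ 72 * Q
  round≤ = begin
    2 * 2 ^ (5 + (h + e)) + h * (2 ^ h * 4)           ≡⟨ cong (_+ h * (2 ^ h * 4)) (^-distribˡ-+-* 2 6 (h + e)) ⟩
    64 * Q + h * (2 ^ h * 4)                          ≤⟨ +-monoʳ-≤ (64 * Q) (*-monoˡ-≤ (2 ^ h * 4) h≤2*2^e) ⟩
    64 * Q + 2 * 2 ^ e * (2 ^ h * 4)                  ≡⟨ cong (64 * Q +_) (trans (rearrange (2 ^ e) (2 ^ h)) (cong (8 *_) (sym Q≡))) ⟩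
    64 * Q + 8 * Q                                    ≡⟨ *-distribʳ-+ Q 64 8 ⟨
    72 * Q                                            ∎
    where
    rearrange : ∀ a b → 2 * a * (b * 4) ≡ 8 * (b * a)
    rearrange = ℕ-Solver.solve-∀

  -- The cost of the `h` additional rounds in which the pipeline fills: 2^h·2^(2e) ≤ 4^h, and h =
  -- O(2^e).
  h*Q≤ : h * Q ≤ 2 * n
  h*Q≤ = begin
    h * Q                             ≡⟨ cong (h *_) Q≡ ⟩
    h * (2 ^ h * 2 ^ e)               ≤⟨ *-monoˡ-≤ (2 ^ h * 2 ^ e) h≤2*2^e ⟩
    2 * 2 ^ e * (2 ^ h * 2 ^ e)       ≡⟨ rearrange (2 ^ e) (2 ^ h) ⟩
    2 * (2 ^ h * (2 ^ e * 2 ^ e))     ≡⟨ cong (λ p → 2 * (2 ^ h * p)) (trans (cong (2 ^_) (cong (e +_) (+-identityʳ e))) (^-distribˡ-+-* 2 e e)) ⟨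
    2 * (2 ^ h * 2 ^ (2 * e))         ≤⟨ *-monoʳ-≤ 2 (*-monoʳ-≤ (2 ^ h) (^-monoʳ-≤ 2 2e≤h)) ⟩
    2 * (2 ^ h * 2 ^ h)               ≡⟨ cong (2 *_) (trans (cong (2 ^_) (cong (h +_) (+-identityʳ h))) (^-distribˡ-+-* 2 h h)) ⟨
    2 * 2 ^ (2 * h)                   ≡⟨ cong (2 *_) (^-*-assoc 2 2 h) ⟨
    2 * 4 ^ h                         ≤⟨ *-monoʳ-≤ 2 4^h≤n ⟩
    2 * n                             ∎
    where
    rearrange : ∀ a b → 2 * a * (b * a) ≡ 2 * (b * (a * a))
    rearrange = ℕ-Solver.solve-∀

  total : queries# ≤ 9 * m + 216 * n
  total = +-mono-≤ blocks≤ (begin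
    (h + n / Q) * (2 * 2 ^ H + h * D)  ≤⟨ *-monoʳ-≤ (h + n / Q) round≤ ⟩
    (h + n / Q) * (72 * Q)             ≡⟨ rearrange h (n / Q) Q ⟩
    72 * (h * Q + n / Q * Q)           ≤⟨ *-monoʳ-≤ 72 (+-mono-≤ h*Q≤ (m/n*n≤m n Q)) ⟩
    72 * (2 * n + n)                   ≡⟨ collect n ⟩
    216 * n                            ∎)
    where
    rearrange : ∀ h g q → (h + g) * (72 * q) ≡ 72 * (h * q + g * q)
    rearrange = ℕ-Solver.solve-∀
    collect : ∀ n → 72 * (2 * n + n) ≡ 216 * n
    collect = ℕ-Solver.solve-∀

-- Choice between the two regimes

module _ (k n m s′ ℓ : ℕ) (2^ℓ≤n : 2 ^ ℓ ≤ n) where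

  open ≤-Reasoning

  private
    -- The divisor keeps powers of 2 with exponent a fixed multiple of `a` below `n`; the estimates
    -- of the first regime go up to 2^(12a).
    a = ℓ / 32
    s = suc s′

    ℓ<32+32a : ℓ < 32 + a * 32
    ℓ<32+32a = proj₂ (block-bounds 32 {ℓ} refl)

  denseUpperBound : s ≤ a → k ≤ 2 * 2 ^ s * n →
                    ∃ λ T → SolvableIn k n T (Initial k n) × T * ℓ ≤ 8448 * (n * s + m * ℓ)
  denseUpperBound s≤a k≤ = T , Dense.solvable k n s′ a {{a≢0}} s≤a 2^32a≤n , (begin
    T * ℓ                   ≤⟨ *-monoʳ-≤ T ℓ≤64a ⟩
    T * (64 * a)            ≡⟨ rearrange T a ⟩
    64 * (a * T)            ≤⟨ *-monoʳ-≤ 64 (DenseCost.total k n s′ a {{a≢0}} s≤a 2^32a≤n k≤) ⟩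
    -- The final constant is 64 · 132; the other regime arrives at 216 · 32 = 6912.
    64 * (132 * (s * n))    ≡⟨ *-assoc 64 132 (s * n) ⟨
    8448 * (s * n)          ≡⟨ cong (8448 *_) (*-comm s n) ⟩
    8448 * (n * s)          ≤⟨ *-monoʳ-≤ 8448 (m≤m+n (n * s) (m * ℓ)) ⟩
    8448 * (n * s + m * ℓ)  ∎)
    where
    1≤a : 1 ≤ a
    1≤a = ≤-trans (s≤s z≤n) s≤a
    a≢0 : NonZero a
    a≢0 = >-nonZero 1≤a
    2^32a≤n : 2 ^ (32 * a) ≤ n
    2^32a≤n = ≤-trans (^-monoʳ-≤ 2 (≤-trans (≤-reflexive (*-comm 32 a)) (m/n*n≤m ℓ 32))) 2^ℓ≤n
    T : ℕ
    T = Dense.queries# k n s′ a {{a≢0}} s≤a 2^32a≤n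
    ℓ≤64a : ℓ ≤ 64 * a
    ℓ≤64a = begin
      ℓ                ≤⟨ <⇒≤ ℓ<32+32a ⟩
      32 * 1 + a * 32  ≤⟨ +-mono-≤ (*-monoʳ-≤ 32 1≤a) (≤-reflexive (*-comm a 32)) ⟩
      32 * a + 32 * a  ≡⟨ *-distribʳ-+ a 32 32 ⟨
      64 * a           ∎
    rearrange : ∀ t a → t * (64 * a) ≡ 64 * (a * t)
    rearrange = ℕ-Solver.solve-∀

  pipelinedUpperBound : a < s → n < 2 ^ suc ℓ → 1 ≤ m → k ≤ (1 + m) * n →
                        ∃ λ T → SolvableIn k n T (Initial k n) × T * ℓ ≤ 8448 * (n * s + m * ℓ)
  pipelinedUpperBound a<s n<2^1+ℓ 1≤m k≤ = T , Pipelined.solvable k n h e 4^h≤n , (begin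
    T * ℓ                                   ≤⟨ *-monoˡ-≤ ℓ (PipelinedCost.total k n m h e 4^h≤n n≤4*4^h 1≤m k≤ 2e≤h (half-bound h)) ⟩
    (9 * m + 216 * n) * ℓ                   ≡⟨ expand m n ℓ ⟩
    216 * (n * ℓ) + 9 * (m * ℓ)             ≤⟨ +-mono-≤ (*-monoʳ-≤ 216 (*-monoʳ-≤ n ℓ≤32s)) (*-monoˡ-≤ (m * ℓ) (m≤m+n 9 6903)) ⟩
    216 * (n * (32 * s)) + 6912 * (m * ℓ)   ≡⟨ collect n s (m * ℓ) ⟩
    6912 * (n * s + m * ℓ)                  ≤⟨ *-monoˡ-≤ (n * s + m * ℓ) (m≤m+n 6912 1536) ⟩
    8448 * (n * s + m * ℓ)                  ∎)
    where
    h = ℓ / 2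
    e = h / 2
    4^≡ : 4 ^ h ≡ 2 ^ (2 * h)
    4^≡ = ^-*-assoc 2 2 h
    4^h≤n : 4 ^ h ≤ n
    4^h≤n = ≤-trans (≤-reflexive 4^≡) (≤-trans (^-monoʳ-≤ 2 (≤-trans (≤-reflexive (*-comm 2 h)) (m/n*n≤m ℓ 2))) 2^ℓ≤n)
    T : ℕ
    T = Pipelined.queries# k n h e 4^h≤n
    half-bound : ∀ i → i ≤ 1 + 2 * (i / 2)
    half-bound i = s≤s⁻¹ (≤-trans (proj₂ (block-bounds 2 {i} refl)) (≤-reflexive (cong (2 +_) (*-comm (i / 2) 2))))
    n≤4*4^h : n ≤ 4 * 4 ^ h
    n≤4*4^h = begin
      n                   ≤⟨ <⇒≤ n<2^1+ℓ ⟩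
      2 ^ suc ℓ           ≤⟨ ^-monoʳ-≤ 2 (s≤s (half-bound ℓ)) ⟩
      2 ^ (2 + 2 * h)     ≡⟨ ^-distribˡ-+-* 2 2 (2 * h) ⟩
      4 * 2 ^ (2 * h)     ≡⟨ cong (4 *_) 4^≡ ⟨
      4 * 4 ^ h           ∎
    2e≤h : 2 * e ≤ h
    2e≤h = ≤-trans (≤-reflexive (*-comm 2 e)) (m/n*n≤m h 2)
    ℓ≤32s : ℓ ≤ 32 * s
    ℓ≤32s = begin
      ℓ             ≤⟨ <⇒≤ ℓ<32+32a ⟩
      suc a * 32    ≤⟨ *-monoˡ-≤ 32 a<s ⟩
      s * 32        ≡⟨ *-comm s 32 ⟩
      32 * s        ∎
    expand : ∀ m n l → (9 * m + 216 * n) * l ≡ 216 * (n * l) + 9 * (m * l)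
    expand = ℕ-Solver.solve-∀
    collect : ∀ n s x → 216 * (n * (32 * s)) + 6912 * x ≡ 6912 * (n * s + x)
    collect = ℕ-Solver.solve-∀

upperBound : ∀ k n → 2 ≤ n → n ≤ k →
             ∃ λ T → SolvableIn k n T (Initial k n) × T * Den n ≤ 8448 * Num k n
upperBound k n@(suc _) 2≤n n≤k = go ⌊log₂ (1 + m) ⌋ (1≤⌊log₂n⌋ (s≤s 1≤m)) (n<2^1+⌊log₂n⌋ (1 + m))
  where
  m = k / n
  ℓ = ⌊log₂ n ⌋

  1≤m : 1 ≤ m
  1≤m = m≥n⇒m/n>0 n≤k

  k≤ : k ≤ (1 + m) * n
  k≤ = <⇒≤ (proj₂ (block-bounds n {k} refl))

  go : ∀ s → 1 ≤ s → 1 + m < 2 ^ suc s →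
       ∃ λ T → SolvableIn k n T (Initial k n) × T * ℓ ≤ 8448 * (n * s + m * ℓ)
  go (suc s′) _ 1+m< with suc s′ ≤? ℓ / 32
  ... | yes s≤a = denseUpperBound k n m s′ ℓ (2^⌊log₂n⌋≤n n (s≤s z≤n)) s≤a
                    (≤-trans k≤ (*-monoˡ-≤ n (<⇒≤ 1+m<)))
  ... | no  s≰a = pipelinedUpperBound k n m s′ ℓ (2^⌊log₂n⌋≤n n (s≤s z≤n)) (≰⇒> s≰a)
                    (n<2^1+⌊log₂n⌋ n) 1≤m k≤

theorem3 : Σ ℕ (λ c → (k n : ℕ) → 2 ≤ n → n ≤ k →
    Σ ℕ (λ T → IsMinQueries k n T ×
    ((T * Den n ≤ c * Num k n) × (Num k n ≤ c * (T * Den n)))))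
theorem3 = 8448 , λ k n 2≤n n≤k →
  let (T , s , T≤) = upperBound k n 2≤n n≤k
      (T₀ , min , T₀≤T) = minQueries T s
  in T₀ , min , ≤-trans (*-monoˡ-≤ (Den n) T₀≤T) T≤ ,
     ≤-trans (lowerBound k n T₀ 2≤n (proj₁ min)) (*-monoˡ-≤ (T₀ * Den n) (m≤m+n 3 8445))
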